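{- Let $x_n := \left\{ \frac{\log(2n-1)}{\log(2)} \right\}$ for $n = 1,2,\ldots$. For $0 \le \alpha \le 1$, $N \in \mathbb{N}$ and $s \ge 0$ let $$F_{N}^\alpha (s) := \frac{1}{N^{2-\alpha}} \# \left\{ 1 \leq k \neq l \leq N \ : \ \left\| x_k - x_l\right\| \leq \frac{s}{N^\alpha} \right\}.$$ Then $F_N^\alpha(s)$ has the lower bound $$g(N,s,\alpha) = 4 \frac{K_{\max}(N,s,\alpha)}{N^{1-\alpha}} - 2 \frac{K_{\min}(N,s,\alpha)}{N^{1-\alpha}} - \frac{2}{N^{2-\alpha}} - \tilde{K}(N,s,\alpha) \cdot \frac{C_{N,s,\alpha} + 1}{C_{N,s,\alpha} N^{2-\alpha}},$$ and for any $\alpha < 1$ (within the range $0 \le \alpha \le 1$), $$\lim_{N \to \infty} g(N,s,\alpha) = 2s \cdot \frac{3}{4} \log(4),$$ which is independent of $\alpha$ (only the speed of convergence is the faster, the smaller $\alpha$ is). The sequence $(x_n)_{n\in\mathbb{N}}$ does not have weak correlations for any $0 \le \alpha \le 1$.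
   Context: Here $\log$ is the natural logarithm, $\{\cdot\}$ denotes the fractional part of a real number, and $\|\cdot\|$ denotes the distance of a real number from its nearest integer. The function $F_N^\alpha$ is called the weak (or $\alpha$-) pair correlation function of the sequence; a sequence is said to have weak correlations (for the parameter $\alpha$) if $\lim_{N\to\infty} F_N^\alpha(s) = 2s$ for all $s \ge 0$. The quantities in $g$ are $$C_{N,s,\alpha} = 2^{s/N^\alpha} - 1,\qquad K_{\max}(N,s,\alpha) = \left\lfloor \frac{2N C_{N,s,\alpha}}{1+C_{N,s,\alpha}} \right\rfloor,\qquad K_{\min}(N,s,\alpha) = \left\lfloor N C_{N,s,\alpha} \right\rfloor,$$ $$\tilde{K}(N,s,\alpha) = K_{\max}(N,s,\alpha)\big(K_{\max}(N,s,\alpha)+1\big) - K_{\min}(N,s,\alpha)\big(K_{\min}(N,s,\alpha)+1\big).$$ The numbers $K_{\max}(N,s,\alpha)$ and $K_{\min}(N,s,\alpha)$ play the role of the maximum and minimum number of points among $x_1,\ldots,x_N$ lying to the right of a given point at distance at most $s/N^\alpha$.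
   Formalization: The lower bound is proved for s/N^α ≤ 1/2 (it fails e.g. at s = N^α, N ≥ 2); the limit of g is proved for 0 < α < 1 (at α = 0, s = 1 it is 2, not 3 log 2); the informal remark on the speed of convergence, which fails for small α, is left out. -}

module Defs where

open import Algebra.Bundles using (CommutativeRing; Semiring)
open import Data.Fin.Base using (toℕ)
open import Data.Integer.Base as ℤ using (ℤ; +_; -[1+_])
open import Data.List.Base using (List; applyUpTo; cartesianProduct; filter; length)
open import Data.Nat.Base as ℕ using (ℕ; suc; _!)
import Data.Nat.Properties as ℕ
open import Data.Product.Base using (∃; _×_; _,_)
open import Level using (Level; _⊔_) renaming (suc to lsuc)
open import Relation.Binary.Bundles using (TotalOrder)
open import Relation.Binary.Core using (Rel)
open import Relation.Binary.PropositionalEquality.Core using (_≢_)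
open import Relation.Binary.Structures using (IsDecTotalOrder)
open import Relation.Nullary using (¬_; ¬?; _×-dec_)
open import Relation.Unary using (Pred; Decidable)

import Algebra.Construct.NaturalChoice.Max as Max
import Algebra.Construct.NaturalChoice.Min as Min
import Algebra.Definitions.RawSemiring as SemiringDefs
import Relation.Binary.Construct.NonStrictToStrict as ToStrict

module RingEmbeddings {c ℓ : Level} (R : CommutativeRing c ℓ) where
  open CommutativeRing R
  -- n · x is the n-fold sum of x, and x ^ n the n-fold product.
  open SemiringDefs (Semiring.rawSemiring semiring) public
    using (_^_; sum) renaming (_×_ to _·_)

  fromℕ : ℕ → Carrier
  fromℕ n = n · 1#

  fromℤ : ℤ → Carrier
  fromℤ (+ n)    = fromℕ n
  fromℤ -[1+ n ] = - fromℕ (suc n)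

-- The real numbers, axiomatised classically (the order is decidable) as a
-- Dedekind-complete ordered field, over a setoid equality.  Such a field is
-- unique up to isomorphism.
record CompleteOrderedField (c ℓ : Level) : Set (lsuc (c ⊔ ℓ)) where
  infix  8 _⁻¹
  infixl 7 _/_
  infix  4 _≤_

  field
    commutativeRing : CommutativeRing c ℓ

  open CommutativeRing commutativeRing public
  open RingEmbeddings commutativeRing public

  -- The value of 0# ⁻¹ is left unspecified.
  field
    _⁻¹             : Carrier → Carrier
    ⁻¹-cong         : ∀ {x y} → x ≈ y → x ⁻¹ ≈ y ⁻¹
    ⁻¹-inverseʳ     : ∀ x → ¬ (x ≈ 0#) → x * x ⁻¹ ≈ 1#
    0≉1             : ¬ (0# ≈ 1#)
    _≤_             : Rel Carrier ℓ
    isDecTotalOrder : IsDecTotalOrder _≈_ _≤_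
    +-monoˡ-≤       : ∀ {x y} z → x ≤ y → x + z ≤ y + z
    *-nonneg        : ∀ {x y} → 0# ≤ x → 0# ≤ y → 0# ≤ x * y
    supremum        : (P : Pred Carrier ℓ) → ∃ P →
                      (∃ λ b → ∀ x → P x → x ≤ b) →
                      ∃ λ s → (∀ x → P x → x ≤ s) ×
                              (∀ b → (∀ x → P x → x ≤ b) → s ≤ b)

  open IsDecTotalOrder isDecTotalOrder public
    using (_≤?_; isTotalOrder)
    renaming ( refl to ≤-refl; reflexive to ≤-reflexive; trans to ≤-trans
             ; antisym to ≤-antisym; total to ≤-total; _≟_ to _≈?_)
  open ToStrict _≈_ _≤_ public using (_<_)

  totalOrder : TotalOrder c ℓ ℓ
  totalOrder = record { isTotalOrder = isTotalOrder }

  open Min totalOrder public using (_⊓_)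
  open Max totalOrder public using () renaming (_⊔_ to _⊔ʳ_)

  -- The floor function is part of the structure: classically it follows from
  -- completeness, but only via a non-constructive search.
  field
    ⌊_⌋       : Carrier → ℤ
    ⌊⌋-lower  : ∀ x → fromℤ ⌊ x ⌋ ≤ x
    ⌊⌋-upper  : ∀ x → x < fromℤ ⌊ x ⌋ + 1#

  _/_ : Carrier → Carrier → Carrier
  x / y = x * y ⁻¹

  abs : Carrier → Carrier
  abs x = x ⊔ʳ (- x)

  infix 4 _⟶_
  _⟶_ : (ℕ → Carrier) → Carrier → Set (c ⊔ ℓ)
  a ⟶ L = ∀ ε → 0# < ε → ∃ λ n₀ → ∀ n → n₀ ℕ.≤ n → abs (a n - L) < ε

  frac : Carrier → Carrier
  frac x = x - fromℤ ⌊ x ⌋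

  -- Distance to the nearest integer, which is ⌊ x ⌋ or ⌊ x ⌋ + 1.
  ‖_‖ : Carrier → Carrier
  ‖ x ‖ = frac x ⊓ (1# - frac x)

-- A complete ordered field with its exponential function, given by the power
-- series, and its natural logarithm, the inverse of exp on the positive
-- elements (log is left unspecified elsewhere).
record RealNumbers (c ℓ : Level) : Set (lsuc (c ⊔ ℓ)) where
  field
    completeOrderedField : CompleteOrderedField c ℓ

  open CompleteOrderedField completeOrderedField public

  field
    exp        : Carrier → Carrier
    exp-cong   : ∀ {x y} → x ≈ y → exp x ≈ exp y
    exp-series : ∀ x →
                 (λ n → sum {n} (λ k → x ^ toℕ k / fromℕ (toℕ k !))) ⟶ exp x
    log        : Carrier → Carrier
    log-cong   : ∀ {x y} → x ≈ y → log x ≈ log y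
    exp-log    : ∀ x → 0# < x → exp (log x) ≈ x

  -- Real powers of a positive base.
  infixr 8 _**_
  _**_ : Carrier → Carrier → Carrier
  x ** y = exp (y * log x)

module PairCorrelation {c ℓ : Level} (R : RealNumbers c ℓ) where
  open RealNumbers R

  -- The pair (k , l) is counted when k ≠ l and ‖ x k - x l ‖ ≤ s / N ^ α.
  ClosePair : (ℕ → Carrier) → (N : ℕ) (s α : Carrier) → Pred (ℕ × ℕ) ℓ
  ClosePair x N s α (k , l) =
    k ≢ l × ‖ x k - x l ‖ ≤ s / fromℕ N ** α

  closePair? : ∀ x N s α → Decidable (ClosePair x N s α)
  closePair? x N s α (k , l) =
    ¬? (k ℕ.≟ l) ×-dec (‖ x k - x l ‖ ≤? s / fromℕ N ** α)

  -- The list 1, 2, …, N.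
  indices : ℕ → List ℕ
  indices = applyUpTo suc

  #closePairs : (ℕ → Carrier) → (N : ℕ) (s α : Carrier) → ℕ
  #closePairs x N s α =
    length (filter (closePair? x N s α) (cartesianProduct (indices N) (indices N)))

  F : (ℕ → Carrier) → (N : ℕ) (s α : Carrier) → Carrier
  F x N s α = fromℕ (#closePairs x N s α) / fromℕ N ** (fromℕ 2 - α)

  HasWeakCorrelations : (ℕ → Carrier) → Carrier → Set (c ⊔ ℓ)
  HasWeakCorrelations x α = ∀ s → 0# ≤ s → (λ N → F x N s α) ⟶ fromℕ 2 * s

  -- Only the values at n ≥ 1 are meaningful.
  logSeq : ℕ → Carrier
  logSeq n = frac (log (fromℕ (2 ℕ.* n ℕ.∸ 1)) / log (fromℕ 2))

  module _ (N : ℕ) (s α : Carrier) where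
    C : Carrier
    C = fromℕ 2 ** (s / fromℕ N ** α) - 1#

    Kmax Kmin K̃ : ℤ
    Kmax = ⌊ (fromℕ 2 * fromℕ N * C) / (1# + C) ⌋
    Kmin = ⌊ fromℕ N * C ⌋
    K̃    = Kmax ℤ.* (Kmax ℤ.+ ℤ.1ℤ) ℤ.- Kmin ℤ.* (Kmin ℤ.+ ℤ.1ℤ)

    -- At s = 0 one has C = 0, Kmax = Kmin = 0 and K̃ = 0, so the last term
    -- vanishes whatever the value of 0# ⁻¹.
    g : Carrier
    g = fromℕ 4 * (fromℤ Kmax / fromℕ N ** (1# - α))
      - fromℕ 2 * (fromℤ Kmin / fromℕ N ** (1# - α))
      - fromℕ 2 / fromℕ N ** (fromℕ 2 - α)
      - fromℤ K̃ * ((C + 1#) / (C * fromℕ N ** (fromℕ 2 - α)))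

-- The numbers N, …, 2N - 1 have pairwise distinct odd parts, and these are
-- exactly 1, 3, …, 2N - 1; so modulo 1 the points x₁, …, x_N are the numbers
-- log₂ n with N ≤ n < 2N.  On the circle the k-th right neighbour of n is n + k,
-- or 2 (n + k - N) after the turn at 2N, and with C = 2^δ - 1 it lies within
-- δ = s / N^α when it is at most (1 + C) n.  For k ≤ Kmin this holds for all N
-- values of n, for Kmin < k ≤ Kmax at least for k / C < n ≤ 2N - k; adding up,
-- and counting every pair in both orders (which are different pairs since √2 is
-- irrational), gives the lower bound g.
--
-- Replacing Kmax and Kmin by the arguments of their floors changes N^(1-α) g by
-- a bounded amount, and N^α C tends to s log 2; hence
-- ∣ g - 3 s log 2 ∣ ≤ 12 / N^(1-α) + 15 (s log 2)² / N^α once N^α ≥ 2 s log 2.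
-- For 0 < α < 1 this is the limit.  For 0 < α ≤ 1 and s large it contradicts
-- F → 2 s because 3 log 2 > 2.

module Submission where

open import Defs
open import Algebra.Bundles using (CommutativeRing)
import Algebra.Construct.NaturalChoice.Max as Max
import Algebra.Construct.NaturalChoice.Min as Min
import Algebra.Properties.AbelianGroup as AbelianGroupProperties
import Algebra.Properties.CommutativeMonoid.Sum as CommutativeMonoidSum
import Algebra.Properties.Monoid.Mult as MonoidMult
import Algebra.Properties.Ring as RingProperties
import Algebra.Properties.Semiring.Mult as SemiringMult
import Algebra.Properties.Semiring.Sum as SemiringSum
import Algebra.Solver.Ring as RingSolver
open import Algebra.Solver.Ring.AlmostCommutativeRing
  using (fromCommutativeRing; _-Raw-AlmostCommutative⟶_)
open import Data.Empty using (⊥; ⊥-elim)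
open import Data.Fin.Base using (toℕ)
open import Data.Integer.Base as ℤ using (ℤ; +_; -[1+_])
import Data.Integer.Properties as ℤ
open import Data.List.Base
  using (List; []; _∷_; _++_; map; applyUpTo; cartesianProduct; filter; length)
open import Data.List.Membership.Propositional using (_∈_)
open import Data.List.Membership.Propositional.Properties
  using (∈-∃++; ∈-++⁻; ∈-++⁺ˡ; ∈-++⁺ʳ; ∈-map⁻; ∈-filter⁺; ∈-cartesianProduct⁺; ∈-applyUpTo⁺; ∈-applyUpTo⁻)
import Data.List.Properties as List
open import Data.List.Relation.Unary.All as All using ([]; _∷_)
import Data.List.Relation.Unary.All.Properties as All
open import Data.List.Relation.Unary.AllPairs using ([]; _∷_)
open import Data.List.Relation.Unary.Any using (here; there)
open import Data.List.Relation.Unary.Unique.Propositional using (Unique)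
import Data.List.Relation.Unary.Unique.Propositional.Properties as Unique
open import Data.Maybe.Base using (Maybe; just; nothing)
open import Data.Nat.Base as ℕ using (ℕ; zero; suc; _!; NonZero)
import Data.Nat.Properties as ℕ
open import Data.Nat.Tactic.RingSolver using (solve-∀)
open import Data.Product.Base using (∃; ∃₂; _×_; _,_; proj₁; proj₂; swap)
open import Data.Product.Properties using (,-injective)
open import Data.Sum.Base using (_⊎_; inj₁; inj₂)
open import Function.Base using (_∘_)
open import Level using (Level; _⊔_)
import Relation.Binary.Construct.NonStrictToStrict as ToStrict
open import Relation.Binary.Bundles using (Poset; TotalOrder)
open import Relation.Binary.PropositionalEquality.Core as ≡ using (_≡_; _≢_)
import Relation.Binary.Reasoning.PartialOrder as PartialOrderReasoning
import Relation.Binary.Reasoning.Setoid as SetoidReasoning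
open import Relation.Nullary using (¬_; Dec; yes; no; contradiction)

-- The bound `s / N ^ α ≤ 1/2` in the first claim keeps every step to the right within half a turn.
-- Beyond that, two points can be joined by a short step in both directions, and counting steps no
-- longer counts pairs; at exactly half a turn it is the irrationality of √2 that excludes this. The
-- bound also gives `C < 1`, so that no point is reached twice from the same point. Since `exp` is
-- known only as the sum of its series, its addition law has to come first. It is obtained for the
-- coefficients, where both sides solve the same formal differential equation, together with an
-- explicit error for partial sums. The same series gives `log 2 > 2/3`, the only numerical fact
-- behind `3 log 2 > 2`. For `g` an explicit error bound is proved rather than a mere limit, because
-- at `α = 1` the factor `N ^ (1 - α)` is 1 and the error left by the floors does not vanish. At
-- `α = 0` it is `N ^ α` that does not grow, so that `C` does not tend to 0; there the trivial bound
-- on the number of pairs takes over.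

module Combinatorics where
  open import Data.Nat.Base
  open import Data.Nat.Properties
  open import Data.Nat.Tactic.RingSolver using (solve-∀)
  open import Relation.Binary.PropositionalEquality

  -- Each entry of `xs` is struck out of `ys` once; uniqueness keeps the remaining entries of `xs`
  -- inside what is left. The lower bound on the number of close pairs rests on this.
  length-unique-≤ : ∀ {a} {A : Set a} {xs ys : List A} → Unique xs → (∀ {x} → x ∈ xs → x ∈ ys) →
                    length xs ≤ length ys
  length-unique-≤ {xs = []}     {ys} []         xs⊆ys = z≤n
  length-unique-≤ {xs = x ∷ xs} {ys} (x∉ ∷ uniq) xs⊆ys with ∈-∃++ (xs⊆ys (here refl))
  ... | as , bs , refl = begin
    suc (length xs)               ≤⟨ s≤s (length-unique-≤ uniq xs⊆as++bs) ⟩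
    suc (length (as ++ bs))       ≡⟨ cong suc (List.length-++ as) ⟩
    suc (length as + length bs)   ≡⟨ +-suc (length as) (length bs) ⟨
    length as + suc (length bs)   ≡⟨ List.length-++ as ⟨
    length (as ++ x ∷ bs)         ∎
    where
    open ≤-Reasoning
    xs⊆as++bs : ∀ {y} → y ∈ xs → y ∈ as ++ bs
    xs⊆as++bs y∈xs with ∈-++⁻ as (xs⊆ys (there y∈xs))
    ... | inj₁ y∈as         = ∈-++⁺ˡ y∈as
    ... | inj₂ (here y≡x)   = ⊥-elim (All.lookup x∉ y∈xs (sym y≡x))
    ... | inj₂ (there y∈bs) = ∈-++⁺ʳ as y∈bs

  -- Injectivity is asked only on the entries, because `indexPair` is shown to be injective only on
  -- good pairs.
  unique-map : ∀ {a b} {A : Set a} {B : Set b} {f : A → B} {xs} → Unique xs →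
               (∀ {x y} → x ∈ xs → y ∈ xs → f x ≡ f y → x ≡ y) → Unique (map f xs)
  unique-map []           inj = []
  unique-map (x∉ ∷ uniq) inj =
    All.map⁺ (All.tabulate (λ y∈ fx≡fy → All.lookup x∉ y∈ (inj (here refl) (there y∈) fx≡fy)))
    ∷ unique-map uniq (λ x∈ y∈ → inj (there x∈) (there y∈))

  -- Parity, the irrationality of √2, and odd parts

  even-or-odd : ∀ n → ∃ λ k → n ≡ 2 * k ⊎ n ≡ suc (2 * k)
  even-or-odd zero    = 0 , inj₁ refl
  even-or-odd (suc n) with even-or-odd n
  ... | k , inj₁ n≡2k   = k , inj₂ (cong suc n≡2k)
  ... | k , inj₂ n≡1+2k = suc k , inj₁ (trans (cong suc n≡1+2k) (sym (cong suc (+-suc k (k + 0)))))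

  -- Infinite descent: `m = 2 k` turns the equation into `n * n ≡ 2 * (k * k)` with `n < m`, and the
  -- bound `b` on `m` makes the descent structural.
  √2-irrational : ∀ m n → m * m ≡ 2 * (n * n) → m ≡ 0
  √2-irrational m n = descend m m n ≤-refl
    where
    descend : ∀ b m n → m ≤ b → m * m ≡ 2 * (n * n) → m ≡ 0
    descend zero    m n m≤b eq = n≤0⇒n≡0 m≤b
    descend (suc b) m n m≤b eq with even-or-odd m
    ... | k , inj₂ refl = ⊥-elim (even≢odd (n * n) (2 * (k * k) + 2 * k)
      (trans (sym eq) (odd² k)))
      where
      odd² : ∀ k → suc (2 * k) * suc (2 * k) ≡ suc (2 * (2 * (k * k) + 2 * k))
      odd² = solve-∀
    ... | zero , inj₁ refl = refl
    ... | suc k , inj₁ refl = ⊥-elim (n≢0 (descend b n (suc k) (≤-pred (≤-trans n<m m≤b)) n²≡2k²))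
      where
      n²≡2k² : n * n ≡ 2 * (suc k * suc k)
      n²≡2k² = *-cancelˡ-≡ (n * n) _ 2 (trans (sym eq) (double² (suc k)))
        where
        double² : ∀ k → 2 * k * (2 * k) ≡ 2 * (2 * (k * k))
        double² = solve-∀
      n≢0 : n ≢ 0
      n≢0 refl with () ← n²≡2k²
      n<m : n < 2 * suc k
      n<m = ≰⇒> λ m≤n → <⇒≱ (n²<2n² n (n≢0⇒n>0 n≢0)) (subst (_≤ n * n) eq (*-mono-≤ m≤n m≤n))
        where
        n²<2n² : ∀ n → 0 < n → n * n < 2 * (n * n)
        n²<2n² (suc n) _ = m<m+n (suc n * suc n) (s≤s z≤n)

  odd-decomposition : ∀ n → ∃₂ λ e i → suc n ≡ 2 ^ e * suc (2 * i)
  odd-decomposition n = halve (suc n) n ≤-refl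
    where
    halve : ∀ b n → n < b → ∃₂ λ e i → suc n ≡ 2 ^ e * suc (2 * i)
    halve (suc b) n (s≤s n≤b) with even-or-odd (suc n)
    ... | k , inj₂ eq = 0 , k , trans eq (sym (+-identityʳ _))
    ... | suc k , inj₁ eq with halve b k (≤-trans (k<n k n eq) n≤b)
      where
      k<n : ∀ k n → suc n ≡ 2 * suc k → k < n
      k<n k n eq = subst (k <_) (sym (suc-injective eq)) (m<m+n k (s≤s z≤n))
    ...   | e , i , eq′ = suc e , i , trans eq (trans (cong (2 *_) eq′) (sym (*-assoc 2 (2 ^ e) _)))

  -- The index of the odd part of n in the sequence 1, 3, 5, …; junk at 0.
  oddIndex : ℕ → ℕ
  oddIndex zero    = 0
  oddIndex (suc n) = suc (proj₁ (proj₂ (odd-decomposition n)))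

  oddIndex-spec : ∀ n → 1 ≤ n → ∃ λ e → n ≡ 2 ^ e * (2 * oddIndex n ∸ 1)
  oddIndex-spec (suc n) _ with odd-decomposition n
  ... | e , i , eq = e , trans eq (cong (2 ^ e *_) (sym (+-suc i (i + 0))))

  1≤oddIndex : ∀ n → 1 ≤ n → 1 ≤ oddIndex n
  1≤oddIndex (suc n) _ = s≤s z≤n

  -- The odd part `2 i - 1` divides `n`, so `2 i ≤ n + 1 ≤ 2 N`; the strict inequality `n < 2 N`
  -- pays for the 1.
  oddIndex-≤ : ∀ N n → 1 ≤ n → n < N + N → oddIndex n ≤ N
  oddIndex-≤ N n 1≤n n<2N with oddIndex-spec n 1≤n
  ... | e , eq = *-cancelˡ-≤ 2 (begin
    2 * oddIndex n             ≤⟨ m≤n+m∸n (2 * oddIndex n) 1 ⟩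
    suc (2 * oddIndex n ∸ 1)   ≤⟨ s≤s (≤-trans (m≤n*m _ (2 ^ e) {{m^n≢0 2 e}}) (≤-reflexive (sym eq))) ⟩
    suc n                      ≤⟨ n<2N ⟩
    N + N                      ≡⟨ cong (λ k → N + k) (+-identityʳ N) ⟨
    2 * N                      ∎)
    where open ≤-Reasoning

  -- Two numbers in [N , 2N) with the same odd part cannot differ by a factor 2.
  oddIndex-injective : ∀ {N m n} → 1 ≤ N → N ≤ m → m < N + N → N ≤ n → n < N + N →
                       oddIndex m ≡ oddIndex n → m ≡ n
  oddIndex-injective {N} {m} {n} 1≤N N≤m m<2N N≤n n<2N eq
    with oddIndex-spec m (≤-trans 1≤N N≤m) | oddIndex-spec n (≤-trans 1≤N N≤n)
  ... | e , m≡ | e′ , n≡ = trans m≡ (trans (cong₂ (λ e i → 2 ^ e * (2 * i ∸ 1)) e≡e′ eq) (sym n≡))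
    where
    exponent-≤ : ∀ {m n e e′ o} → N ≤ m → n < N + N → m ≡ 2 ^ e * o → n ≡ 2 ^ e′ * o → e′ ≤ e
    exponent-≤ {m} {n} {e} {e′} {o} N≤m n<2N m≡ n≡ = ≮⇒≥ λ e<e′ → <⇒≱ n<2N (begin
      N + N                ≤⟨ +-mono-≤ N≤m N≤m ⟩
      m + m                ≡⟨ cong (λ k → m + k) (+-identityʳ m) ⟨
      2 * m                ≡⟨ cong (2 *_) m≡ ⟩
      2 * (2 ^ e * o)      ≡⟨ *-assoc 2 (2 ^ e) o ⟨
      2 ^ suc e * o        ≤⟨ *-monoˡ-≤ o (^-monoʳ-≤ 2 e<e′) ⟩
      2 ^ e′ * o           ≡⟨ n≡ ⟨
      n                    ∎)
      where open ≤-Reasoning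
    e≡e′ : e ≡ e′
    e≡e′ = ≤-antisym
      (exponent-≤ N≤n m<2N n≡ (subst (λ i → m ≡ 2 ^ e * (2 * i ∸ 1)) eq m≡))
      (exponent-≤ N≤m n<2N (subst (λ i → m ≡ 2 ^ e * (2 * i ∸ 1)) eq m≡) n≡)

length-cartesianProduct : ∀ {a b} {A : Set a} {B : Set b} (xs : List A) (ys : List B) →
                          length (cartesianProduct xs ys) ≡ length xs ℕ.* length ys
length-cartesianProduct []       ys = ≡.refl
length-cartesianProduct (x ∷ xs) ys = ≡.trans (List.length-++ (map (x ,_) ys))
  (≡.cong₂ ℕ._+_ (List.length-map (x ,_) ys) (length-cartesianProduct xs ys))

-- Lists of pairs, and neighbours on a circle

range : ℕ → ℕ → List ℕ
range lo hi = applyUpTo (lo ℕ.+_) (hi ℕ.∸ lo)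

∈-range⁻ : ∀ {n} lo hi → n ∈ range lo hi → (lo ℕ.≤ n) × (n ℕ.< hi)
∈-range⁻ lo hi n∈ with ∈-applyUpTo⁻ (lo ℕ.+_) n∈
... | i , i<hi∸lo , ≡.refl = ℕ.m≤m+n lo i ,
  ℕ.≰⇒> (λ hi≤lo+i → ℕ.<⇒≱ i<hi∸lo (ℕ.m≤n+o⇒m∸n≤o hi lo hi≤lo+i))

range-unique : ∀ lo hi → Unique (range lo hi)
range-unique lo hi = Unique.applyUpTo⁺₁ (lo ℕ.+_) (hi ℕ.∸ lo)
  (λ {i} {j} i<j _ eq → ℕ.<⇒≢ i<j (ℕ.+-cancelˡ-≡ lo i j eq))

-- A pair `(n , k)` stands for the step from `n` to its `k`-th right neighbour. Keeping the offset
-- `k` in the pair makes different blocks disjoint.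
pairsUpTo : (ℕ → List ℕ) → ℕ → List (ℕ × ℕ)
pairsUpTo block zero    = []
pairsUpTo block (suc k) = map (_, suc k) (block (suc k)) ++ pairsUpTo block k

∈-pairsUpTo⁻ : ∀ {block n k} K → (n , k) ∈ pairsUpTo block K → (1 ℕ.≤ k) × (k ℕ.≤ K) × (n ∈ block k)
∈-pairsUpTo⁻ {block} (suc K) nk∈ with ∈-++⁻ (map (_, suc K) (block (suc K))) nk∈
... | inj₂ nk∈′ with ∈-pairsUpTo⁻ K nk∈′
...   | 1≤k , k≤K , n∈ = 1≤k , ℕ.m≤n⇒m≤1+n k≤K , n∈
∈-pairsUpTo⁻ {block} (suc K) nk∈ | inj₁ nk∈′ with ∈-map⁻ (_, suc K) nk∈′
... | n , n∈ , ≡.refl = ℕ.s≤s ℕ.z≤n , ℕ.≤-refl , n∈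

pairsUpTo-unique : ∀ {block} → (∀ k → Unique (block k)) → ∀ K → Unique (pairsUpTo block K)
pairsUpTo-unique uniq zero    = []
pairsUpTo-unique {block} uniq (suc K) = Unique.++⁺
  (Unique.map⁺ (proj₁ ∘ ,-injective) (uniq (suc K)))
  (pairsUpTo-unique uniq K)
  disjoint
  where
  disjoint : ∀ {v} → ¬ (v ∈ map (_, suc K) (block (suc K)) × v ∈ pairsUpTo block K)
  disjoint (v∈ , v∈′) with ∈-map⁻ (_, suc K) v∈
  ... | n , _ , ≡.refl = ℕ.1+n≰n (proj₁ (proj₂ (∈-pairsUpTo⁻ K v∈′)))

length-pairsUpTo-suc : ∀ block k → length (pairsUpTo block (suc k)) ≡ length (block (suc k)) ℕ.+ length (pairsUpTo block k)
length-pairsUpTo-suc block k = ≡.trans (List.length-++ (map (_, suc k) (block (suc k))))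
  (≡.cong (ℕ._+ length (pairsUpTo block k)) (List.length-map (_, suc k) (block (suc k))))

-- The k-th right neighbour of n among N, …, 2N - 1 arranged on a circle.
rightOf : ℕ → ℕ → ℕ → ℕ
rightOf N n k with n ℕ.+ k ℕ.<? N ℕ.+ N
... | yes _ = n ℕ.+ k
... | no  _ = n ℕ.+ k ℕ.∸ N

-- The wrapped case is stated with `N` added on the left, free of truncated subtraction, so that it
-- can be cancelled and carried over to the field.
rightOf-cases : ∀ N n k → (n ℕ.+ k ℕ.< N ℕ.+ N × rightOf N n k ≡ n ℕ.+ k)
                        ⊎ (N ℕ.+ N ℕ.≤ n ℕ.+ k × rightOf N n k ℕ.+ N ≡ n ℕ.+ k)
rightOf-cases N n k with n ℕ.+ k ℕ.<? N ℕ.+ N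
... | yes lt = inj₁ (lt , ≡.refl)
... | no ¬lt = inj₂ (ℕ.≮⇒≥ ¬lt , ℕ.m∸n+n≡m (ℕ.≤-trans (ℕ.m≤m+n N N) (ℕ.≮⇒≥ ¬lt)))

-- A step that wraps meets one that does not only if its offset is larger by `N`.
no-wrap : ∀ n {k l N} → l ℕ.< N → n ℕ.+ k ℕ.+ N ≢ n ℕ.+ l
no-wrap n {k} {l} {N} l<N eq = ℕ.<⇒≱ l<N (ℕ.≤-trans (ℕ.m≤n+m N k)
  (ℕ.≤-reflexive (ℕ.+-cancelˡ-≡ n (k ℕ.+ N) l (≡.trans (≡.sym (ℕ.+-assoc n k N)) eq))))

rightOf-injective : ∀ {N} n {k l} → k ℕ.< N → l ℕ.< N → rightOf N n k ≡ rightOf N n l → k ≡ l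
rightOf-injective {N} n {k} {l} k<N l<N eq with rightOf-cases N n k | rightOf-cases N n l
... | inj₁ (_ , r) | inj₁ (_ , r′) = ℕ.+-cancelˡ-≡ n k l (≡.trans (≡.sym r) (≡.trans eq r′))
... | inj₂ (_ , r) | inj₂ (_ , r′) = ℕ.+-cancelˡ-≡ n k l (≡.trans (≡.sym r) (≡.trans (≡.cong (ℕ._+ N) eq) r′))
... | inj₁ (_ , r) | inj₂ (_ , r′) = ⊥-elim (no-wrap n l<N (≡.trans (≡.cong (ℕ._+ N) (≡.trans (≡.sym r) eq)) r′))
... | inj₂ (_ , r) | inj₁ (_ , r′) = ⊥-elim (no-wrap n k<N (≡.trans (≡.cong (ℕ._+ N) (≡.trans (≡.sym r′) (≡.sym eq))) r))

-- Integers in a commutative ring, and a solver with integer constants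

module IntegerCoefficients {c ℓ : Level} (R : CommutativeRing c ℓ) where
  open CommutativeRing R
  open RingEmbeddings R using (fromℕ; fromℤ)
  open RingProperties ring using (-‿distribˡ-*; -‿distribʳ-*; -0#≈0#)
  open AbelianGroupProperties +-abelianGroup using (⁻¹-involutive; ⁻¹-∙-comm)
  open MonoidMult +-monoid using (×-homo-+)
  open SemiringMult semiring using (×1-homo-*)
  open SetoidReasoning setoid

  fromℕ-+ : ∀ m n → fromℕ (m ℕ.+ n) ≈ fromℕ m + fromℕ n
  fromℕ-+ m n = ×-homo-+ 1# m n

  fromℕ-* : ∀ m n → fromℕ (m ℕ.* n) ≈ fromℕ m * fromℕ n
  fromℕ-* = ×1-homo-*

  fromℤ-⊖ : ∀ m n → fromℤ (m ℤ.⊖ n) ≈ fromℕ m - fromℕ n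
  fromℤ-⊖ m       zero    = sym (trans (+-congˡ -0#≈0#) (+-identityʳ _))
  fromℤ-⊖ zero    (suc n) = sym (+-identityˡ _)
  fromℤ-⊖ (suc m) (suc n) = begin
    fromℤ (suc m ℤ.⊖ suc n)                       ≡⟨ ≡.cong fromℤ (ℤ.[1+m]⊖[1+n]≡m⊖n m n) ⟩
    fromℤ (m ℤ.⊖ n)                               ≈⟨ fromℤ-⊖ m n ⟩
    fromℕ m - fromℕ n                             ≈⟨ +-congʳ (+-identityʳ _) ⟨
    fromℕ m + 0# - fromℕ n                        ≈⟨ +-congʳ (+-congˡ (-‿inverseʳ 1#)) ⟨
    fromℕ m + (1# - 1#) - fromℕ n                 ≈⟨ +-congʳ (+-assoc _ _ _) ⟨
    fromℕ m + 1# - 1# - fromℕ n                   ≈⟨ +-assoc _ _ _ ⟩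
    fromℕ m + 1# + (- 1# - fromℕ n)               ≈⟨ +-cong (+-comm _ _) (⁻¹-∙-comm _ _) ⟩
    fromℕ (suc m) - fromℕ (suc n)                 ∎

  fromℤ-neg : ∀ i → fromℤ (ℤ.- i) ≈ - fromℤ i
  fromℤ-neg (+ zero)  = sym -0#≈0#
  fromℤ-neg (+ suc n) = refl
  fromℤ-neg -[1+ n ]  = sym (⁻¹-involutive _)

  fromℤ-+ : ∀ i j → fromℤ (i ℤ.+ j) ≈ fromℤ i + fromℤ j
  fromℤ-+ (+ m)    (+ n)    = fromℕ-+ m n
  fromℤ-+ (+ m)    -[1+ n ] = fromℤ-⊖ m (suc n)
  fromℤ-+ -[1+ m ] (+ n)    = trans (fromℤ-⊖ n (suc m)) (+-comm _ _)
  fromℤ-+ -[1+ m ] -[1+ n ] = begin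
    - fromℕ (suc (suc (m ℕ.+ n)))     ≡⟨ ≡.cong (λ k → - fromℕ (suc k)) (ℕ.+-suc m n) ⟨
    - fromℕ (suc m ℕ.+ suc n)         ≈⟨ -‿cong (fromℕ-+ (suc m) (suc n)) ⟩
    - (fromℕ (suc m) + fromℕ (suc n)) ≈⟨ ⁻¹-∙-comm _ _ ⟨
    - fromℕ (suc m) - fromℕ (suc n)   ∎

  private
    fromℤ-+*- : ∀ m n → fromℤ (+ m ℤ.* -[1+ n ]) ≈ - (fromℕ m * fromℕ (suc n))
    fromℤ-+*- m n = begin
      fromℤ (+ m ℤ.* -[1+ n ])        ≡⟨ ≡.cong fromℤ (ℤ.neg-distribʳ-* (+ m) (+ suc n)) ⟨
      fromℤ (ℤ.- (+ m ℤ.* + suc n))   ≈⟨ fromℤ-neg (+ m ℤ.* + suc n) ⟩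
      - fromℤ (+ m ℤ.* + suc n)       ≡⟨ ≡.cong (λ i → - fromℤ i) (ℤ.pos-* m (suc n)) ⟨
      - fromℕ (m ℕ.* suc n)           ≈⟨ -‿cong (fromℕ-* m (suc n)) ⟩
      - (fromℕ m * fromℕ (suc n))     ∎

  fromℤ-* : ∀ i j → fromℤ (i ℤ.* j) ≈ fromℤ i * fromℤ j
  fromℤ-* (+ m)    (+ n)    = trans (reflexive (≡.cong fromℤ (≡.sym (ℤ.pos-* m n)))) (fromℕ-* m n)
  fromℤ-* (+ m)    -[1+ n ] = trans (fromℤ-+*- m n) (-‿distribʳ-* _ _)
  fromℤ-* -[1+ m ] (+ n)    = begin
    fromℤ (-[1+ m ] ℤ.* + n)       ≡⟨ ≡.cong fromℤ (ℤ.*-comm -[1+ m ] (+ n)) ⟩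
    fromℤ (+ n ℤ.* -[1+ m ])       ≈⟨ fromℤ-+*- n m ⟩
    - (fromℕ n * fromℕ (suc m))    ≈⟨ -‿cong (*-comm _ _) ⟩
    - (fromℕ (suc m) * fromℕ n)    ≈⟨ -‿distribˡ-* _ _ ⟩
    - fromℕ (suc m) * fromℕ n      ∎
  fromℤ-* -[1+ m ] -[1+ n ] = begin
    fromℕ (suc m ℕ.* suc n)            ≈⟨ fromℕ-* (suc m) (suc n) ⟩
    fromℕ (suc m) * fromℕ (suc n)      ≈⟨ ⁻¹-involutive _ ⟨
    - - (fromℕ (suc m) * fromℕ (suc n)) ≈⟨ -‿cong (-‿distribˡ-* _ _) ⟩
    - (- fromℕ (suc m) * fromℕ (suc n)) ≈⟨ -‿distribʳ-* _ _ ⟩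
    - fromℕ (suc m) * - fromℕ (suc n)  ∎

  -- fromℤ, except that + 1 goes to 1# itself rather than to 1# + 0#, so that
  -- the constant 1 of a solver expression denotes 1#.
  coefficient : ℤ → Carrier
  coefficient (+ 1) = 1#
  coefficient i     = fromℤ i

  coefficient≈fromℤ : ∀ i → coefficient i ≈ fromℤ i
  coefficient≈fromℤ (+ 0)           = refl
  coefficient≈fromℤ (+ 1)           = sym (+-identityʳ 1#)
  coefficient≈fromℤ (+ suc (suc n)) = refl
  coefficient≈fromℤ -[1+ n ]        = refl

  private
    morphism : ℤ.+-*-rawRing -Raw-AlmostCommutative⟶ fromCommutativeRing R
    morphism = record
      { ⟦_⟧    = coefficient
      ; +-homo = λ i j → trans (coefficient≈fromℤ (i ℤ.+ j)) (trans (fromℤ-+ i j)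
                   (sym (+-cong (coefficient≈fromℤ i) (coefficient≈fromℤ j))))
      ; *-homo = λ i j → trans (coefficient≈fromℤ (i ℤ.* j)) (trans (fromℤ-* i j)
                   (sym (*-cong (coefficient≈fromℤ i) (coefficient≈fromℤ j))))
      ; -‿homo = λ i → trans (coefficient≈fromℤ (ℤ.- i)) (trans (fromℤ-neg i)
                   (sym (-‿cong (coefficient≈fromℤ i))))
      ; 0-homo = refl
      ; 1-homo = refl
      }

    _≟_ : ∀ i j → Maybe (coefficient i ≈ coefficient j)
    i ≟ j with i ℤ.≟ j
    ... | yes ≡.refl = just refl
    ... | no _       = nothing

  module Solver = RingSolver ℤ.+-*-rawRing (fromCommutativeRing R) morphism _≟_

-- Consequences of the axioms of a complete ordered field

module OrderedField {c ℓ : Level} (𝔽 : CompleteOrderedField c ℓ) where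
  open CompleteOrderedField 𝔽 public hiding (zero)
  open IntegerCoefficients commutativeRing public
  open Solver public using (solve; con; _:=_; _:+_; _:*_; _:-_; :-_)

  poset : Poset c ℓ ℓ
  poset = TotalOrder.poset totalOrder

  open TotalOrder totalOrder public using (≤-respˡ-≈; ≤-respʳ-≈)

  module ≤-Reasoning = PartialOrderReasoning poset

  private
    module Strict = ToStrict _≈_ _≤_

  <⇒≤ : ∀ {x y} → x < y → x ≤ y
  <⇒≤ = Strict.<⇒≤

  <⇒≱ : ∀ {x y} → x < y → ¬ (y ≤ x)
  <⇒≱ = Strict.<⇒≱ ≤-antisym

  ≰⇒> : ∀ {x y} → ¬ (x ≤ y) → y < x
  ≰⇒> = Strict.≰⇒> sym ≤-reflexive ≤-total

  <-≤-trans : ∀ {x y z} → x < y → y ≤ z → x < z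
  <-≤-trans = Strict.<-≤-trans sym ≤-trans ≤-antisym ≤-respʳ-≈

  ≤-<-trans : ∀ {x y z} → x ≤ y → y < z → x < z
  ≤-<-trans = Strict.≤-<-trans ≤-trans ≤-antisym ≤-respˡ-≈

  ≤-or-> : ∀ x y → (x ≤ y) ⊎ (y < x)
  ≤-or-> x y with x ≤? y
  ... | yes x≤y = inj₁ x≤y
  ... | no  x≰y = inj₂ (≰⇒> x≰y)

  0<⇒≉0 : ∀ {x} → 0# < x → ¬ (x ≈ 0#)
  0<⇒≉0 (_ , 0≉x) x≈0 = 0≉x (sym x≈0)

  0≤-difference : ∀ {x y} → x ≤ y → 0# ≤ y - x
  0≤-difference {x} x≤y = ≤-respˡ-≈ (-‿inverseʳ x) (+-monoˡ-≤ (- x) x≤y)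

  ≤-from-difference : ∀ {x y z} → 0# ≤ z → y - x ≈ z → x ≤ y
  ≤-from-difference {x} {y} {z} 0≤z eq = begin
    x           ≈⟨ +-identityˡ x ⟨
    0# + x      ≤⟨ +-monoˡ-≤ x 0≤z ⟩
    z + x       ≈⟨ +-congʳ eq ⟨
    y - x + x   ≈⟨ solve 2 (λ x y → y :- x :+ x := y) refl x y ⟩
    y           ∎
    where open ≤-Reasoning

  -- The form in which linear inequalities are proved below: the hypotheses
  -- are combined into a ≤ b, and the solver compares the two differences.
  ≤-from : ∀ {a b x y} → a ≤ b → y - x ≈ b - a → x ≤ y
  ≤-from a≤b = ≤-from-difference (0≤-difference a≤b)

  ≈-from : ∀ {a b x y} → a ≈ b → x - y ≈ a - b → x ≈ y
  ≈-from {a} {b} {x} {y} a≈b eq = begin-equality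
    x           ≈⟨ solve 2 (λ x y → x := x :- y :+ y) refl x y ⟩
    x - y + y   ≈⟨ +-congʳ eq ⟩
    a - b + y   ≈⟨ +-congʳ (+-congʳ a≈b) ⟩
    b - b + y   ≈⟨ solve 2 (λ b y → b :- b :+ y := y) refl b y ⟩
    y           ∎
    where open ≤-Reasoning

  <-from : ∀ {a b x y} → a < b → y - x ≈ b - a → x < y
  <-from {a} {b} {x} {y} (a≤b , a≉b) eq = ≤-from a≤b eq , λ x≈y → a≉b (sym (≈-from (sym x≈y) (sym eq)))

  +-mono-≤ : ∀ {x y u v} → x ≤ y → u ≤ v → x + u ≤ y + v
  +-mono-≤ {x} {y} {u} {v} x≤y u≤v = begin
    x + u ≤⟨ +-monoˡ-≤ u x≤y ⟩
    y + u ≈⟨ +-comm y u ⟩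
    u + y ≤⟨ +-monoˡ-≤ y u≤v ⟩
    v + y ≈⟨ +-comm v y ⟩
    y + v ∎
    where open ≤-Reasoning

  0≤+ : ∀ {x y} → 0# ≤ x → 0# ≤ y → 0# ≤ x + y
  0≤+ 0≤x 0≤y = ≤-respˡ-≈ (+-identityˡ 0#) (+-mono-≤ 0≤x 0≤y)

  *-monoˡ-≤ : ∀ {x y z} → 0# ≤ z → x ≤ y → z * x ≤ z * y
  *-monoˡ-≤ {x} {y} {z} 0≤z x≤y = ≤-from-difference (*-nonneg 0≤z (0≤-difference x≤y))
    (solve 3 (λ x y z → z :* y :- z :* x := z :* (y :- x)) refl x y z)

  *-monoʳ-≤ : ∀ {x y z} → 0# ≤ z → x ≤ y → x * z ≤ y * z
  *-monoʳ-≤ {x} {y} {z} 0≤z x≤y = ≤-from-difference (*-nonneg 0≤z (0≤-difference x≤y))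
    (solve 3 (λ x y z → y :* z :- x :* z := z :* (y :- x)) refl x y z)

  *-mono-≤ : ∀ {x y u v} → 0# ≤ x → x ≤ y → 0# ≤ u → u ≤ v → x * u ≤ y * v
  *-mono-≤ 0≤x x≤y 0≤u u≤v =
    ≤-trans (*-monoˡ-≤ 0≤x u≤v) (*-monoʳ-≤ (≤-trans 0≤u u≤v) x≤y)

  neg-mono-≤ : ∀ {x y} → x ≤ y → - y ≤ - x
  neg-mono-≤ {x} {y} x≤y = ≤-from x≤y (solve 2 (λ x y → :- x :- :- y := y :- x) refl x y)

  0≤x² : ∀ x → 0# ≤ x * x
  0≤x² x with ≤-total 0# x
  ... | inj₁ 0≤x = *-nonneg 0≤x 0≤x
  ... | inj₂ x≤0 = ≤-respʳ-≈ (solve 1 (λ x → (con (+ 0) :- x) :* (con (+ 0) :- x) := x :* x) refl x)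
                     (*-nonneg (0≤-difference x≤0) (0≤-difference x≤0))

  0≤1 : 0# ≤ 1#
  0≤1 = ≤-respʳ-≈ (*-identityˡ 1#) (0≤x² 1#)

  0<1 : 0# < 1#
  0<1 = 0≤1 , 0≉1

  *-pos : ∀ {x y} → 0# < x → 0# < y → 0# < x * y
  *-pos {x} {y} (0≤x , 0≉x) (0≤y , 0≉y) = *-nonneg 0≤x 0≤y , λ 0≈xy → 0≉y (begin-equality
    0#               ≈⟨ zeroʳ (x ⁻¹) ⟨
    x ⁻¹ * 0#        ≈⟨ *-congˡ 0≈xy ⟩
    x ⁻¹ * (x * y)   ≈⟨ solve 3 (λ i x y → i :* (x :* y) := (x :* i) :* y) refl (x ⁻¹) x y ⟩
    (x * x ⁻¹) * y   ≈⟨ *-congʳ (⁻¹-inverseʳ x (λ x≈0 → 0≉x (sym x≈0))) ⟩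
    1# * y           ≈⟨ *-identityˡ y ⟩
    y                ∎)
    where open ≤-Reasoning

  *-monoˡ-< : ∀ {x y z} → 0# < z → x < y → z * x < z * y
  *-monoˡ-< {x} {y} {z} 0<z x<y = <-from {0#} {z * (y - x)}
    (*-pos 0<z (<-from x<y (solve 2 (λ x y → y :- x :- con (+ 0) := y :- x) refl x y)))
    (solve 3 (λ x y z → z :* y :- z :* x := z :* (y :- x) :- con (+ 0)) refl x y z)

  *-cancelˡ-≤ : ∀ {x y} z → 0# < z → z * x ≤ z * y → x ≤ y
  *-cancelˡ-≤ {x} {y} z 0<z zx≤zy with ≤-or-> x y
  ... | inj₁ x≤y = x≤y
  ... | inj₂ y<x = contradiction zx≤zy (<⇒≱ (*-monoˡ-< 0<z y<x))

  *-cancelˡ-< : ∀ {x y} z → 0# < z → z * x < z * y → x < y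
  *-cancelˡ-< {x} {y} z 0<z zx<zy with ≤-or-> y x
  ... | inj₂ x<y = x<y
  ... | inj₁ y≤x = contradiction (*-monoˡ-≤ (<⇒≤ 0<z) y≤x) (<⇒≱ zx<zy)

  *-cancelˡ-≈ : ∀ {x y} z → 0# < z → z * x ≈ z * y → x ≈ y
  *-cancelˡ-≈ z 0<z eq = ≤-antisym (*-cancelˡ-≤ z 0<z (≤-reflexive eq))
                                   (*-cancelˡ-≤ z 0<z (≤-reflexive (sym eq)))

  0<⁻¹ : ∀ {x} → 0# < x → 0# < x ⁻¹
  0<⁻¹ {x} 0<x = *-cancelˡ-< x 0<x
    (<-from 0<1 (-‿sub (zeroʳ x) (⁻¹-inverseʳ x (0<⇒≉0 0<x))))
    where
    -‿sub : ∀ {a b c d} → a ≈ b → c ≈ d → c - a ≈ d - b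
    -‿sub a≈b c≈d = +-cong c≈d (-‿cong a≈b)

  0≤/ : ∀ {x y} → 0# ≤ x → 0# < y → 0# ≤ x / y
  0≤/ 0≤x 0<y = *-nonneg 0≤x (<⇒≤ (0<⁻¹ 0<y))

  0</ : ∀ {x y} → 0# < x → 0# < y → 0# < x / y
  0</ 0<x 0<y = *-pos 0<x (0<⁻¹ 0<y)

  /-*-cancel : ∀ {x y} → 0# < y → x / y * y ≈ x
  /-*-cancel {x} {y} 0<y = begin-equality
    x * y ⁻¹ * y   ≈⟨ solve 3 (λ i x y → x :* i :* y := x :* (y :* i)) refl (y ⁻¹) x y ⟩
    x * (y * y ⁻¹) ≈⟨ *-congˡ (⁻¹-inverseʳ y (0<⇒≉0 0<y)) ⟩
    x * 1#         ≈⟨ *-identityʳ x ⟩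
    x              ∎
    where open ≤-Reasoning

  *-/-cancel : ∀ {x y} → 0# < y → x * y / y ≈ x
  *-/-cancel {x} {y} 0<y = trans
    (solve 3 (λ i x y → x :* y :* i := x :* i :* y) refl (y ⁻¹) x y) (/-*-cancel 0<y)

  /-monoˡ-≤ : ∀ {x y z} → 0# < z → x ≤ y → x / z ≤ y / z
  /-monoˡ-≤ 0<z = *-monoʳ-≤ (<⇒≤ (0<⁻¹ 0<z))

  ≤*⇒/≤ : ∀ {x y z} → 0# < z → x ≤ y * z → x / z ≤ y
  ≤*⇒/≤ 0<z x≤yz = ≤-respʳ-≈ (*-/-cancel 0<z) (/-monoˡ-≤ 0<z x≤yz)

  *≤⇒≤/ : ∀ {x y z} → 0# < z → x * z ≤ y → x ≤ y / z
  *≤⇒≤/ 0<z xz≤y = ≤-respˡ-≈ (*-/-cancel 0<z) (/-monoˡ-≤ 0<z xz≤y)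

  /≤⇒≤* : ∀ {x y z} → 0# < z → x / z ≤ y → x ≤ y * z
  /≤⇒≤* 0<z x/z≤y = ≤-respˡ-≈ (/-*-cancel 0<z) (*-monoʳ-≤ (<⇒≤ 0<z) x/z≤y)

  -- Natural numbers and integers

  0≤fromℕ : ∀ n → 0# ≤ fromℕ n
  0≤fromℕ zero    = ≤-refl
  0≤fromℕ (suc n) = 0≤+ 0≤1 (0≤fromℕ n)

  0<fromℕ : ∀ n → 0# < fromℕ (suc n)
  0<fromℕ n = <-≤-trans 0<1 (≤-respˡ-≈ (+-identityʳ 1#) (+-mono-≤ ≤-refl (0≤fromℕ n)))

  fromℕ-mono-≤ : ∀ {m n} → m ℕ.≤ n → fromℕ m ≤ fromℕ n
  fromℕ-mono-≤ {n = n} ℕ.z≤n = 0≤fromℕ n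
  fromℕ-mono-≤ (ℕ.s≤s m≤n) = +-mono-≤ ≤-refl (fromℕ-mono-≤ m≤n)

  fromℕ-cancel-< : ∀ {m n} → fromℕ m < fromℕ n → m ℕ.< n
  fromℕ-cancel-< {m} {n} m<n with n ℕ.≤? m
  ... | yes n≤m = contradiction (fromℕ-mono-≤ n≤m) (<⇒≱ m<n)
  ... | no  n≰m = ℕ.≰⇒> n≰m

  fromℕ-cancel-≤ : ∀ {m n} → fromℕ m ≤ fromℕ n → m ℕ.≤ n
  fromℕ-cancel-≤ {m} {n} m≤n with suc n ℕ.≤? m
  ... | no  n≮m = ℕ.≮⇒≥ n≮m
  ... | yes n<m = contradiction m≤n (<⇒≱ (<-≤-trans
    (<-from 0<1 (solve 1 (λ x → con (+ 1) :+ x :- x := con (+ 1) :- con (+ 0)) refl (fromℕ n)))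
    (fromℕ-mono-≤ n<m)))

  fromℕ-∸ : ∀ m n → fromℕ m - fromℕ n ≤ fromℕ (m ℕ.∸ n)
  fromℕ-∸ m n = ≤-from (fromℕ-mono-≤ (ℕ.m≤n+m∸n m n)) (begin-equality
    fromℕ (m ℕ.∸ n) - (fromℕ m - fromℕ n)
      ≈⟨ solve 3 (λ a b c → c :- (a :- b) := b :+ c :- a) refl (fromℕ m) (fromℕ n) (fromℕ (m ℕ.∸ n)) ⟩
    fromℕ n + fromℕ (m ℕ.∸ n) - fromℕ m
      ≈⟨ +-congʳ (fromℕ-+ n (m ℕ.∸ n)) ⟨
    fromℕ (n ℕ.+ (m ℕ.∸ n)) - fromℕ m ∎)
    where open ≤-Reasoning

  fromℤ-mono-≤ : ∀ {i j} → i ℤ.≤ j → fromℤ i ≤ fromℤ j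
  fromℤ-mono-≤ (ℤ.+≤+ m≤n) = fromℕ-mono-≤ m≤n
  fromℤ-mono-≤ { -[1+ m ]} {+ n} ℤ.-≤+ = ≤-trans (≤-from (0≤fromℕ (suc m))
    (solve 1 (λ x → con (+ 0) :- :- x := x :- con (+ 0)) refl (fromℕ (suc m)))) (0≤fromℕ n)
  fromℤ-mono-≤ (ℤ.-≤- n≤m) = neg-mono-≤ (fromℕ-mono-≤ (ℕ.s≤s n≤m))

  fromℤ-cancel-< : ∀ {i j} → fromℤ i < fromℤ j → i ℤ.< j
  fromℤ-cancel-< {i} {j} i<j with j ℤ.≤? i
  ... | yes j≤i = contradiction (fromℤ-mono-≤ j≤i) (<⇒≱ i<j)
  ... | no  j≰i = ℤ.≰⇒> j≰i

  1+fromℤ : ∀ i → fromℤ (ℤ.suc i) ≈ 1# + fromℤ i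
  1+fromℤ i = trans (fromℤ-+ (+ 1) i) (+-congʳ (+-identityʳ 1#))

  <⇒1+fromℤ≤ : ∀ {i j} → i ℤ.< j → fromℤ i + 1# ≤ fromℤ j
  <⇒1+fromℤ≤ {i} i<j = ≤-respˡ-≈ (trans (1+fromℤ i) (+-comm _ _)) (fromℤ-mono-≤ (ℤ.i<j⇒suc[i]≤j i<j))

  fromℤ≤⇒≤⌊⌋ : ∀ {i x} → fromℤ i ≤ x → i ℤ.≤ ⌊ x ⌋
  fromℤ≤⇒≤⌊⌋ {i} {x} i≤x with i ℤ.≤? ⌊ x ⌋
  ... | yes i≤⌊x⌋ = i≤⌊x⌋
  ... | no  i≰⌊x⌋ = contradiction
    (≤-trans (<⇒1+fromℤ≤ (ℤ.≰⇒> i≰⌊x⌋)) i≤x) (<⇒≱ (⌊⌋-upper x))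

  ⌊⌋-mono-≤ : ∀ {x y} → x ≤ y → ⌊ x ⌋ ℤ.≤ ⌊ y ⌋
  ⌊⌋-mono-≤ {x} x≤y = fromℤ≤⇒≤⌊⌋ (≤-trans (⌊⌋-lower x) x≤y)

  ⌊⌋-nonneg : ∀ {x} → 0# ≤ x → ∃ λ n → ⌊ x ⌋ ≡ + n
  ⌊⌋-nonneg {x} 0≤x with ⌊ x ⌋ | fromℤ≤⇒≤⌊⌋ {+ 0} 0≤x
  ... | + n | _ = n , ≡.refl

  archimedean : ∀ x → ∃ λ n → x ≤ fromℕ n
  archimedean x with ≤-total 0# x
  ... | inj₂ x≤0 = 0 , x≤0
  ... | inj₁ 0≤x with ⌊⌋-nonneg 0≤x
  ...   | n , eq = suc n , ≤-trans (<⇒≤ (⌊⌋-upper x))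
    (≤-reflexive (trans (+-congʳ (reflexive (≡.cong fromℤ eq))) (+-comm _ _)))

  -- Every integer below `x` is at most the floor, so its gap to `x` is at least `frac x`. Thus any
  -- convenient integer bounds the norm, and the floor of a difference never has to be computed.
  ‖‖-≤-above : ∀ {x d} i → fromℤ i ≤ x → x - fromℤ i ≤ d → ‖ x ‖ ≤ d
  ‖‖-≤-above {x} {d} i i≤x x-i≤d = begin
    ‖ x ‖               ≤⟨ Min.x⊓y≤x totalOrder (frac x) (1# - frac x) ⟩
    x - fromℤ ⌊ x ⌋     ≤⟨ +-mono-≤ ≤-refl (neg-mono-≤ (fromℤ-mono-≤ (fromℤ≤⇒≤⌊⌋ {i} i≤x))) ⟩
    x - fromℤ i         ≤⟨ x-i≤d ⟩
    d                   ∎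
    where open ≤-Reasoning

  ‖‖-≤-below : ∀ {x d} i → x ≤ fromℤ i → fromℤ i - x ≤ d → ‖ x ‖ ≤ d
  ‖‖-≤-below {x} {d} i x≤i i-x≤d with i ℤ.≤? ⌊ x ⌋
  -- Possible only when `x` is the integer `i` itself; otherwise `i` is at least the floor plus 1.
  ... | yes i≤⌊x⌋ = ‖‖-≤-above i i≤x (≤-trans {j = fromℤ i - x} (≤-reflexive
    (≈-from x≈i (solve 2 (λ x i → (x :- i) :- (i :- x) := (x :+ x) :- (i :+ i)) refl x (fromℤ i)))) i-x≤d)
    where
    i≤x : fromℤ i ≤ x
    i≤x = ≤-trans (fromℤ-mono-≤ i≤⌊x⌋) (⌊⌋-lower x)
    x≈i : x + x ≈ fromℤ i + fromℤ i
    x≈i = +-cong (≤-antisym x≤i i≤x) (≤-antisym x≤i i≤x)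
  ... | no  i≰⌊x⌋ = begin
    ‖ x ‖                     ≤⟨ Min.x⊓y≤y totalOrder (frac x) (1# - frac x) ⟩
    1# - (x - fromℤ ⌊ x ⌋)    ≈⟨ solve 2 (λ x j → con (+ 1) :- (x :- j) := j :+ con (+ 1) :- x) refl x (fromℤ ⌊ x ⌋) ⟩
    fromℤ ⌊ x ⌋ + 1# - x      ≤⟨ +-monoˡ-≤ (- x) (<⇒1+fromℤ≤ (ℤ.≰⇒> i≰⌊x⌋)) ⟩
    fromℤ i - x               ≤⟨ i-x≤d ⟩
    d                         ∎
    where open ≤-Reasoning

  -- Absolute values and limits

  x≤abs : ∀ x → x ≤ abs x
  x≤abs x = Max.x≤x⊔y totalOrder x (- x)

  -x≤abs : ∀ x → - x ≤ abs x
  -x≤abs x = Max.x≤y⊔x totalOrder x (- x)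

  0≤abs : ∀ x → 0# ≤ abs x
  0≤abs x with ≤-total 0# x
  ... | inj₁ 0≤x = ≤-trans 0≤x (x≤abs x)
  ... | inj₂ x≤0 = ≤-trans (≤-from x≤0 (solve 1 (λ x → :- x :- con (+ 0) := con (+ 0) :- x) refl x)) (-x≤abs x)

  abs-≤ : ∀ {x b} → x ≤ b → - x ≤ b → abs x ≤ b
  abs-≤ = Max.⊔-lub totalOrder

  infix 4 _∈±_
  -- A two-sided bound instead of `abs x ≤ b`: both halves are inequalities between polynomials,
  -- within reach of the ring solver, which cannot see through the maximum in `abs`.
  _∈±_ : Carrier → Carrier → Set ℓ
  x ∈± b = (- b ≤ x) × (x ≤ b)

  ∈±abs : ∀ x → x ∈± abs x
  ∈±abs x = ≤-from (-x≤abs x) (solve 2 (λ x a → x :- :- a := a :- :- x) refl x (abs x)) , x≤abs x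

  ∈±⇒abs≤ : ∀ {x b} → x ∈± b → abs x ≤ b
  ∈±⇒abs≤ {x} {b} (l , u) = abs-≤ u (≤-from l (solve 2 (λ x b → b :- :- x := x :- :- b) refl x b))

  ∈±-resp : ∀ {x y a b} → x ≈ y → a ≈ b → x ∈± a → y ∈± b
  ∈±-resp x≈y a≈b (l , u) =
    ≤-respˡ-≈ (-‿cong a≈b) (≤-respʳ-≈ x≈y l) , ≤-respˡ-≈ x≈y (≤-respʳ-≈ a≈b u)

  ∈±-weaken : ∀ {x a b} → a ≤ b → x ∈± a → x ∈± b
  ∈±-weaken a≤b (l , u) = ≤-trans (neg-mono-≤ a≤b) l , ≤-trans u a≤b

  ∈±-bound-nonneg : ∀ {x b} → x ∈± b → 0# ≤ b
  ∈±-bound-nonneg {x} {b} (l , u) = *-cancelˡ-≤ (fromℕ 2) (0<fromℕ 1)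
    (≤-from (+-mono-≤ l u)
      (solve 2 (λ x b → con (+ 2) :* b :- con (+ 2) :* con (+ 0) := (x :+ b) :- (:- b :+ x)) refl x b))

  nonneg⇒∈± : ∀ {x} → 0# ≤ x → x ∈± x
  nonneg⇒∈± {x} 0≤x = ≤-trans (≤-from 0≤x (solve 1 (λ x → con (+ 0) :- :- x := x :- con (+ 0)) refl x)) 0≤x , ≤-refl

  ∈±-+ : ∀ {x y a b} → x ∈± a → y ∈± b → x + y ∈± a + b
  ∈±-+ {a = a} {b} (l , u) (l′ , u′) =
    ≤-respˡ-≈ (solve 2 (λ a b → :- a :+ :- b := :- (a :+ b)) refl a b) (+-mono-≤ l l′) , +-mono-≤ u u′

  ∈±-neg : ∀ {x b} → x ∈± b → - x ∈± b
  ∈±-neg {x} {b} (l , u) = neg-mono-≤ u , ≤-from l (solve 2 (λ x b → b :- :- x := x :- :- b) refl x b)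

  -- No signs are distinguished: `2 (a b + x y)` and `2 (a b - x y)` are sums of two products of the
  -- nonnegative numbers `a - x`, `a + x`, `b - y`, `b + y`.
  ∈±-* : ∀ {x y a b} → x ∈± a → y ∈± b → x * y ∈± a * b
  ∈±-* {x} {y} {a} {b} (l , u) (l′ , u′) =
      half (0≤+ (*-nonneg 0≤a-x 0≤b-y) (*-nonneg 0≤a+x 0≤b+y))
        (solve 4 (λ x y a b → (a :- x) :* (b :- y) :+ (x :- :- a) :* (y :- :- b)
          := con (+ 2) :* (x :* y) :- con (+ 2) :* (:- (a :* b))) refl x y a b)
    , half (0≤+ (*-nonneg 0≤a-x 0≤b+y) (*-nonneg 0≤a+x 0≤b-y))
        (solve 4 (λ x y a b → (a :- x) :* (y :- :- b) :+ (x :- :- a) :* (b :- y)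
          := con (+ 2) :* (a :* b) :- con (+ 2) :* (x :* y)) refl x y a b)
    where
    0≤a-x : 0# ≤ a - x
    0≤a-x = 0≤-difference u
    0≤b-y : 0# ≤ b - y
    0≤b-y = 0≤-difference u′
    0≤a+x : 0# ≤ x - - a
    0≤a+x = 0≤-difference l
    0≤b+y : 0# ≤ y - - b
    0≤b+y = 0≤-difference l′
    half : ∀ {u v z} → 0# ≤ z → z ≈ fromℕ 2 * v - fromℕ 2 * u → u ≤ v
    half 0≤z eq = *-cancelˡ-≤ (fromℕ 2) (0<fromℕ 1) (≤-from-difference 0≤z (sym eq))

  abs≈0⇒≈0 : ∀ {x} → abs x ≈ 0# → x ≈ 0#
  abs≈0⇒≈0 {x} eq = ≤-antisym (≤-trans (x≤abs x) (≤-reflexive eq))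
    (≤-from (≤-trans (-x≤abs x) (≤-reflexive eq)) (solve 1 (λ x → x :- con (+ 0) := con (+ 0) :- :- x) refl x))

  -- If `z` were not zero, `ε = abs z / (2 b)` would give `abs z ≤ abs z / 2`. The bound at `ε = 1`
  -- shows `abs z ≤ b`, which makes this `ε` admissible. The restriction `ε ≤ 1` allows `ε * ε` to
  -- be absorbed into `ε` when the bound is established.
  ∈±⇒≈0 : ∀ {z} b → (∀ ε → 0# < ε → ε ≤ 1# → z ∈± ε * b) → z ≈ 0#
  ∈±⇒≈0 {z} b bound with abs z ≤? 0#
  ... | yes ∣z∣≤0 = abs≈0⇒≈0 (≤-antisym ∣z∣≤0 (0≤abs z))
  ... | no  ∣z∣≰0 = contradiction (abs-bound ε 0<ε (≤*⇒/≤ 0<2b ∣z∣≤1*2b)) (<⇒≱ εb<∣z∣)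
    where
    abs-bound : ∀ ε → 0# < ε → ε ≤ 1# → abs z ≤ ε * b
    abs-bound ε 0<ε ε≤1 = ∈±⇒abs≤ (bound ε 0<ε ε≤1)
    w : Carrier
    w = abs z
    0<w : 0# < w
    0<w = ≰⇒> ∣z∣≰0
    w≤b : w ≤ b
    w≤b = ≤-respʳ-≈ (*-identityˡ b) (abs-bound 1# 0<1 ≤-refl)
    0<2b : 0# < b + b
    0<2b = <-≤-trans 0<w (≤-trans w≤b (≤-from (≤-trans (<⇒≤ 0<w) w≤b)
      (solve 1 (λ b → b :+ b :- b := b :- con (+ 0)) refl b)))
    ε : Carrier
    ε = w / (b + b)
    0<ε : 0# < ε
    0<ε = 0</ 0<w 0<2b
    ∣z∣≤1*2b : w ≤ 1# * (b + b)
    ∣z∣≤1*2b = ≤-from (+-mono-≤ w≤b (≤-trans (<⇒≤ 0<w) w≤b))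
      (solve 2 (λ w b → con (+ 1) :* (b :+ b) :- w := b :+ b :- (w :+ con (+ 0))) refl w b)
    εb<∣z∣ : ε * b < w
    εb<∣z∣ = <-from 0<εb (begin-equality
      w - ε * b                 ≈⟨ +-congʳ (/-*-cancel 0<2b) ⟨
      ε * (b + b) - ε * b       ≈⟨ solve 2 (λ e b → e :* (b :+ b) :- e :* b := e :* b :- con (+ 0)) refl ε b ⟩
      ε * b - 0#                ∎)
      where
      open ≤-Reasoning
      0<εb : 0# < ε * b
      0<εb = *-pos 0<ε (<-≤-trans 0<w w≤b)

  limit-∈± : ∀ {a L} → a ⟶ L → ∀ ε → 0# < ε → ∃ λ n₀ → ∀ n → n₀ ℕ.≤ n → (a n - L) ∈± ε
  limit-∈± {a} {L} lim ε 0<ε with lim ε 0<ε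
  ... | n₀ , bound = n₀ , λ n n₀≤n → ∈±-weaken (<⇒≤ (bound n n₀≤n)) (∈±abs (a n - L))

  limit-≤ : ∀ {a L b} m → a ⟶ L → (∀ n → m ℕ.≤ n → a n ≤ b) → L ≤ b
  limit-≤ {a} {L} {b} m lim a≤b with ≤-or-> L b
  ... | inj₁ L≤b = L≤b
  ... | inj₂ b<L with lim (L - b) (<-from b<L (solve 2 (λ L b → L :- b :- con (+ 0) := L :- b) refl L b))
  ...   | n₀ , bound = contradiction (a≤b n (ℕ.m≤n⊔m n₀ m)) (<⇒≱
    (<-from (≤-<-trans (-x≤abs (a n - L)) (bound n (ℕ.m≤m⊔n n₀ m)))
      (solve 3 (λ a b L → a :- b := L :- b :- :- (a :- L)) refl (a n) b L)))
    where
    n : ℕ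
    n = n₀ ℕ.⊔ m

  limit-≥ : ∀ {a L b} m → a ⟶ L → (∀ n → m ℕ.≤ n → b ≤ a n) → b ≤ L
  limit-≥ {a} {L} {b} m lim b≤a with ≤-or-> b L
  ... | inj₁ b≤L = b≤L
  ... | inj₂ L<b with lim (b - L) (<-from L<b (solve 2 (λ L b → b :- L :- con (+ 0) := b :- L) refl L b))
  ...   | n₀ , bound = contradiction (b≤a n (ℕ.m≤n⊔m n₀ m)) (<⇒≱
    (<-from (≤-<-trans (x≤abs (a n - L)) (bound n (ℕ.m≤m⊔n n₀ m)))
      (solve 3 (λ a b L → b :- a := b :- L :- (a :- L)) refl (a n) b L)))
    where
    n : ℕ
    n = n₀ ℕ.⊔ m

-- Cauchy products and the terms of the exponential series

module Series {c ℓ : Level} (𝔽 : CompleteOrderedField c ℓ) where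
  open OrderedField 𝔽
  open CommutativeMonoidSum +-commutativeMonoid using (∑-distrib-+; sum-cong-≋)
  open SemiringSum semiring using (*-distribˡ-sum)

  Seq : Set c
  Seq = ℕ → Carrier

  S : ℕ → Seq → Carrier
  S n f = sum {n} (λ k → f (toℕ k))

  S-last : ∀ n f → S (suc n) f ≈ S n f + f n
  S-last zero    f = +-comm _ _
  S-last (suc n) f = trans (+-congˡ (S-last n (f ∘ suc))) (sym (+-assoc _ _ _))

  S-cong : ∀ n {f g} → (∀ k → f k ≈ g k) → S n f ≈ S n g
  S-cong n f≈g = sum-cong-≋ {n} (λ k → f≈g (toℕ k))

  S-nonneg : ∀ n {f} → (∀ k → 0# ≤ f k) → 0# ≤ S n f
  S-nonneg zero    0≤f = ≤-refl
  S-nonneg (suc n) 0≤f = 0≤+ (0≤f 0) (S-nonneg n (0≤f ∘ suc))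

  S-mono-≤ : ∀ {m n f} → (∀ k → 0# ≤ f k) → m ℕ.≤ n → S m f ≤ S n f
  S-mono-≤ {n = n} 0≤f ℕ.z≤n       = S-nonneg n 0≤f
  S-mono-≤         0≤f (ℕ.s≤s m≤n) = +-mono-≤ ≤-refl (S-mono-≤ (0≤f ∘ suc) m≤n)

  S-∈± : ∀ n {f f′} → (∀ k → f k ∈± f′ k) → S n f ∈± S n f′
  S-∈± zero    f∈ = nonneg⇒∈± ≤-refl
  S-∈± (suc n) f∈ = ∈±-+ (f∈ 0) (S-∈± n (f∈ ∘ suc))

  S-difference-∈± : ∀ {m n f f′} → (∀ k → f k ∈± f′ k) → m ℕ.≤ n →
                    S n f - S m f ∈± S n f′ - S m f′
  S-difference-∈± {n = n} {f} {f′} f∈ ℕ.z≤n =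
    ∈±-resp (solve 1 (λ x → x := x :- con (+ 0)) refl (S n f))
            (solve 1 (λ x → x := x :- con (+ 0)) refl (S n f′)) (S-∈± n f∈)
  S-difference-∈± {suc m} {suc n} {f} {f′} f∈ (ℕ.s≤s m≤n) =
    ∈±-resp (cancel (f 0) _ _) (cancel (f′ 0) _ _) (S-difference-∈± (f∈ ∘ suc) m≤n)
    where
    cancel : ∀ z x y → x - y ≈ z + x - (z + y)
    cancel = solve 3 (λ z x y → x :- y := z :+ x :- (z :+ y)) refl

  -- The coefficients of the Cauchy product of the power series with coefficients `f` and `g`.
  conv : Seq → Seq → Seq
  conv f g zero    = f 0 * g 0
  conv f g (suc n) = f 0 * g (suc n) + conv (f ∘ suc) g n

  conv-cong : ∀ {f f′ g g′} → (∀ k → f k ≈ f′ k) → (∀ k → g k ≈ g′ k) →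
              ∀ n → conv f g n ≈ conv f′ g′ n
  conv-cong f≈ g≈ zero    = *-cong (f≈ 0) (g≈ 0)
  conv-cong f≈ g≈ (suc n) = +-cong (*-cong (f≈ 0) (g≈ (suc n))) (conv-cong (f≈ ∘ suc) g≈ n)

  conv-+ˡ : ∀ f h g n → conv (λ k → f k + h k) g n ≈ conv f g n + conv h g n
  conv-+ˡ f h g zero    = distribʳ _ _ _
  conv-+ˡ f h g (suc n) = trans (+-congˡ (conv-+ˡ (f ∘ suc) (h ∘ suc) g n))
    (solve 5 (λ f h g x y → (f :+ h) :* g :+ (x :+ y) := f :* g :+ x :+ (h :* g :+ y)) refl
      (f 0) (h 0) (g (suc n)) (conv (f ∘ suc) g n) (conv (h ∘ suc) g n))

  conv-*ˡ : ∀ z f g n → conv (λ k → z * f k) g n ≈ z * conv f g n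
  conv-*ˡ z f g zero    = *-assoc _ _ _
  conv-*ˡ z f g (suc n) = trans (+-congˡ (conv-*ˡ z (f ∘ suc) g n))
    (solve 4 (λ z f g x → z :* f :* g :+ z :* x := z :* (f :* g :+ x)) refl
      z (f 0) (g (suc n)) (conv (f ∘ suc) g n))

  conv-*ʳ : ∀ z f g n → conv f (λ k → z * g k) n ≈ z * conv f g n
  conv-*ʳ z f g zero    = solve 3 (λ z f g → f :* (z :* g) := z :* (f :* g)) refl z (f 0) (g 0)
  conv-*ʳ z f g (suc n) = trans (+-congˡ (conv-*ʳ z (f ∘ suc) g n))
    (solve 4 (λ z f g x → f :* (z :* g) :+ z :* x := z :* (f :* g :+ x)) refl
      z (f 0) (g (suc n)) (conv (f ∘ suc) g n))

  conv-nonneg : ∀ {f g} → (∀ k → 0# ≤ f k) → (∀ k → 0# ≤ g k) → ∀ n → 0# ≤ conv f g n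
  conv-nonneg 0≤f 0≤g zero    = *-nonneg (0≤f 0) (0≤g 0)
  conv-nonneg 0≤f 0≤g (suc n) = 0≤+ (*-nonneg (0≤f 0) (0≤g (suc n))) (conv-nonneg (0≤f ∘ suc) 0≤g n)

  -- The formal derivative of the power series with coefficients `f`.
  derivative : Seq → Seq
  derivative f k = fromℕ (suc k) * f (suc k)

  -- The product rule for formal power series; it takes the place of the binomial theorem in
  -- multiplying exponential series.
  leibniz : ∀ f g n → derivative (conv f g) n ≈ conv (derivative f) g n + conv f (derivative g) n
  leibniz f g zero = solve 5 (λ u a b c d → u :* (a :* b :+ c :* d) := u :* c :* d :+ a :* (u :* b)) refl
    (fromℕ 1) (f 0) (g 1) (f 1) (g 0)
  leibniz f g (suc n) = begin-equality
    (1# + k) * (f 0 * g (suc (suc n)) + (f 1 * g (suc n) + A))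
      ≈⟨ solve 5 (λ k x y z A → (con (+ 1) :+ k) :* (x :* y :+ (z :+ A))
           := (con (+ 1) :+ k) :* (x :* y) :+ (k :* (z :+ A) :+ z :+ A)) refl
           k (f 0) (g (suc (suc n))) (f 1 * g (suc n)) A ⟩
    (1# + k) * (f 0 * g (suc (suc n))) + (k * conv (f ∘ suc) g (suc n) + f 1 * g (suc n) + A)
      ≈⟨ +-congˡ (+-congʳ (+-congʳ (leibniz (f ∘ suc) g n))) ⟩
    (1# + k) * (f 0 * g (suc (suc n))) + (B + C + f 1 * g (suc n) + A)
      ≈⟨ solve 8 (λ k x y u v A B C → (con (+ 1) :+ k) :* (x :* y) :+ (B :+ C :+ u :* v :+ A)
           := (con (+ 1) :+ con (+ 0)) :* u :* v :+ (B :+ A) :+ (x :* ((con (+ 1) :+ k) :* y) :+ C)) refl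
           k (f 0) (g (suc (suc n))) (f 1) (g (suc n)) A B C ⟩
    derivative f 0 * g (suc n) + (B + A) + conv f (derivative g) (suc n)
      -- `derivative` of the shifted sequence carries the weight `suc j` where `derivative f`
      -- carries one more; the term `A` makes up the difference.
      ≈⟨ +-congʳ (+-congˡ (trans (conv-cong derivative-suc (λ _ → refl) n) (conv-+ˡ _ _ g n))) ⟨
    conv (derivative f) g (suc n) + conv f (derivative g) (suc n) ∎
    where
    open ≤-Reasoning
    k A B C : Carrier
    k = fromℕ (suc n)
    A = conv (f ∘ suc ∘ suc) g n
    B = conv (derivative (f ∘ suc)) g n
    C = conv (f ∘ suc) (derivative g) n
    derivative-suc : ∀ j → derivative f (suc j) ≈ derivative (f ∘ suc) j + f (suc (suc j))
    derivative-suc j = solve 2 (λ k x → (con (+ 1) :+ k) :* x := k :* x :+ x) refl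
      (fromℕ (suc j)) (f (suc (suc j)))

  S-conv-suc : ∀ f g n → S (suc n) (conv f g) ≈ f 0 * S (suc n) g + S n (conv (f ∘ suc) g)
  S-conv-suc f g n = begin-equality
    f 0 * g 0 + S n (λ k → f 0 * g (suc k) + conv (f ∘ suc) g k)
      ≈⟨ +-congˡ (∑-distrib-+ {n} (λ k → f 0 * g (suc (toℕ k))) (λ k → conv (f ∘ suc) g (toℕ k))) ⟩
    f 0 * g 0 + (S n (λ k → f 0 * g (suc k)) + S n (conv (f ∘ suc) g))
      ≈⟨ +-congˡ (+-congʳ (*-distribˡ-sum {n} (f 0) (λ k → g (suc (toℕ k))))) ⟨
    f 0 * g 0 + (f 0 * S n (g ∘ suc) + S n (conv (f ∘ suc) g))
      ≈⟨ solve 4 (λ f g s t → f :* g :+ (f :* s :+ t) := f :* (g :+ s) :+ t) refl (f 0) (g 0) _ _ ⟩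
    f 0 * S (suc n) g + S n (conv (f ∘ suc) g) ∎
    where open ≤-Reasoning

  -- What remains of the rectangle `i < n`, `j < m` after removing the triangle `i + j < n` is a
  -- plain sum of products `f i * g j`, so termwise majorants suffice. The induction strips the row
  -- `i = 0`.
  square-triangle-∈± : ∀ n m {f f′ g g′} → (∀ k → f k ∈± f′ k) → (∀ k → g k ∈± g′ k) → n ℕ.≤ m →
    S n f * S m g - S n (conv f g) ∈± S n f′ * S m g′ - S n (conv f′ g′)
  square-triangle-∈± zero m {f} {f′} {g} {g′} f∈ g∈ n≤m =
    ∈±-resp (solve 1 (λ x → con (+ 0) := con (+ 0) :* x :- con (+ 0)) refl (S m g))
            (solve 1 (λ x → con (+ 0) := con (+ 0) :* x :- con (+ 0)) refl (S m g′)) (nonneg⇒∈± ≤-refl)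
  square-triangle-∈± (suc n) m {f} {f′} {g} {g′} f∈ g∈ n<m =
    ∈±-resp (split f g) (split f′ g′)
      (∈±-+ (∈±-* (f∈ 0) (S-difference-∈± g∈ n<m))
            (square-triangle-∈± n m (f∈ ∘ suc) g∈ (ℕ.<⇒≤ n<m)))
    where
    split : ∀ f g → f 0 * (S m g - S (suc n) g) + (S n (f ∘ suc) * S m g - S n (conv (f ∘ suc) g))
                    ≈ S (suc n) f * S m g - S (suc n) (conv f g)
    split f g = trans
      (solve 5 (λ x M N F T → x :* (M :- N) :+ (F :* M :- T) := (x :+ F) :* M :- (x :* N :+ T)) refl
        (f 0) (S m g) (S (suc n) g) (S n (f ∘ suc)) (S n (conv (f ∘ suc) g)))
      (+-congˡ (-‿cong (sym (S-conv-suc f g n))))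

  -- The rectangle `i < n`, `j < m` lies inside the triangle `i + j < n + m`.
  square≤triangle : ∀ n m {f g} → (∀ k → 0# ≤ f k) → (∀ k → 0# ≤ g k) →
                    S n f * S m g ≤ S (n ℕ.+ m) (conv f g)
  square≤triangle zero m {f} {g} 0≤f 0≤g =
    ≤-respˡ-≈ (sym (zeroˡ _)) (S-nonneg m (conv-nonneg 0≤f 0≤g))
  square≤triangle (suc n) m {f} {g} 0≤f 0≤g = begin
    (f 0 + S n (f ∘ suc)) * S m g
      ≈⟨ distribʳ _ _ _ ⟩
    f 0 * S m g + S n (f ∘ suc) * S m g
      ≤⟨ +-mono-≤ (*-monoˡ-≤ (0≤f 0) (S-mono-≤ 0≤g (ℕ.m≤n+m m (suc n)))) (square≤triangle n m (0≤f ∘ suc) 0≤g) ⟩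
    f 0 * S (suc n ℕ.+ m) g + S (n ℕ.+ m) (conv (f ∘ suc) g)
      ≈⟨ S-conv-suc f g (n ℕ.+ m) ⟨
    S (suc n ℕ.+ m) (conv f g) ∎
    where open ≤-Reasoning

  0<fromℕ-nonZero : ∀ n .{{_ : ℕ.NonZero n}} → 0# < fromℕ n
  0<fromℕ-nonZero (suc n) = 0<fromℕ n

  0<! : ∀ n → 0# < fromℕ (n !)
  0<! n = 0<fromℕ-nonZero (n !) {{ℕ._!≢0 n}}

  expTerm : Carrier → Seq
  expTerm x k = x ^ k / fromℕ (k !)

  expTerm-0 : ∀ x → expTerm x 0 ≈ 1#
  expTerm-0 x = trans (*-congˡ (⁻¹-cong (+-identityʳ 1#)))
    (≈-from (⁻¹-inverseʳ 1# (0<⇒≉0 0<1)) refl)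

  derivative-expTerm : ∀ x k → derivative (expTerm x) k ≈ x * expTerm x k
  derivative-expTerm x k = *-cancelˡ-≈ (fromℕ (k !)) (0<! k) (begin-equality
    fromℕ (k !) * (fromℕ (suc k) * expTerm x (suc k))
      ≈⟨ solve 3 (λ a b e → a :* (b :* e) := e :* (b :* a)) refl _ _ _ ⟩
    expTerm x (suc k) * (fromℕ (suc k) * fromℕ (k !))
      ≈⟨ *-congˡ (fromℕ-* (suc k) (k !)) ⟨
    expTerm x (suc k) * fromℕ (suc k !)
      ≈⟨ /-*-cancel (0<! (suc k)) ⟩
    x * x ^ k
      ≈⟨ *-congˡ (/-*-cancel (0<! k)) ⟨
    x * (expTerm x k * fromℕ (k !))
      ≈⟨ solve 3 (λ x e a → x :* (e :* a) := a :* (x :* e)) refl _ _ _ ⟩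
    fromℕ (k !) * (x * expTerm x k) ∎)
    where open ≤-Reasoning

  -- The differential equation determines each coefficient from the one before. By `leibniz` the
  -- Cauchy product of the series for `x` and `y` solves it for `x + y`, which is the addition law
  -- for coefficients.
  expTerm-unique : ∀ {f} x → f 0 ≈ 1# → (∀ k → derivative f k ≈ x * f k) → ∀ k → f k ≈ expTerm x k
  expTerm-unique x f0≈1 f′≈xf zero    = trans f0≈1 (sym (expTerm-0 x))
  expTerm-unique x f0≈1 f′≈xf (suc k) = *-cancelˡ-≈ (fromℕ (suc k)) (0<fromℕ k)
    (trans (f′≈xf k) (trans (*-congˡ (expTerm-unique x f0≈1 f′≈xf k)) (sym (derivative-expTerm x k))))

  conv-expTerm : ∀ x y k → conv (expTerm x) (expTerm y) k ≈ expTerm (x + y) k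
  conv-expTerm x y = expTerm-unique (x + y)
    (trans (*-cong (expTerm-0 x) (expTerm-0 y)) (*-identityˡ 1#))
    (λ k → trans (leibniz (expTerm x) (expTerm y) k) (trans
      (+-cong (trans (conv-cong (derivative-expTerm x) (λ _ → refl) k) (conv-*ˡ x _ _ k))
              (trans (conv-cong (λ _ → refl) (derivative-expTerm y) k) (conv-*ʳ y _ _ k)))
      (sym (distribʳ _ x y))))

  expTerm-∈± : ∀ {x a} → x ∈± a → ∀ k → expTerm x k ∈± expTerm a k
  expTerm-∈± {x} {a} x∈ k = ∈±-* (^-∈± k) (nonneg⇒∈± (<⇒≤ (0<⁻¹ (0<! k))))
    where
    ^-∈± : ∀ k → x ^ k ∈± a ^ k
    ^-∈± zero    = nonneg⇒∈± 0≤1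
    ^-∈± (suc k) = ∈±-* x∈ (^-∈± k)

  0≤expTerm : ∀ {x} → 0# ≤ x → ∀ k → 0# ≤ expTerm x k
  0≤expTerm 0≤x k = ∈±-bound-nonneg (expTerm-∈± (nonneg⇒∈± 0≤x) k)

  -- The product of partial sums is compared with the partial sum for x + y
  -- through the same difference for ∣x∣ and ∣y∣, which is at most the block
  -- of the convergent series for ∣x∣ + ∣y∣ from n to 2n.
  expSum-* : ∀ x y n → S n (expTerm x) * S n (expTerm y) - S n (expTerm (x + y))
                       ∈± S (n ℕ.+ n) (expTerm (abs x + abs y)) - S n (expTerm (abs x + abs y))
  expSum-* x y n = ∈±-resp (+-congˡ (-‿cong (S-cong n (conv-expTerm x y)))) refl
    (∈±-weaken (begin
      S n (expTerm a) * S n (expTerm b) - S n (conv (expTerm a) (expTerm b))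
        ≤⟨ +-monoˡ-≤ _ (square≤triangle n n (0≤expTerm (0≤abs x)) (0≤expTerm (0≤abs y))) ⟩
      S (n ℕ.+ n) (conv (expTerm a) (expTerm b)) - S n (conv (expTerm a) (expTerm b))
        ≈⟨ +-cong (S-cong (n ℕ.+ n) (conv-expTerm a b)) (-‿cong (S-cong n (conv-expTerm a b))) ⟩
      S (n ℕ.+ n) (expTerm (a + b)) - S n (expTerm (a + b)) ∎)
      (square-triangle-∈± n n (expTerm-∈± (∈±abs x)) (expTerm-∈± (∈±abs y)) ℕ.≤-refl))
    where
    open ≤-Reasoning
    a b : Carrier
    a = abs x
    b = abs y

-- Exponential, logarithm and real powers

module Exponential {c ℓ : Level} (R : RealNumbers c ℓ) where
  open RealNumbers R using (completeOrderedField; exp; exp-cong; exp-series; log; log-cong; exp-log; _**_) public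
  open OrderedField completeOrderedField public
  open Series completeOrderedField

  -- Capitals are limits, small letters partial sums; `d` and `d′` belong to the majorant series at
  -- `n` and `2 n`. The product of two errors is at most `ε`, the mixed terms give
  -- `ε * (abs A + abs B)`, `e` costs `ε` and `d′ - d` costs `2 ε`; the 4 collects 1 + 1 + 2.
  product-error : ∀ {A B E D a b e d d′ ε} → 0# ≤ ε → ε ≤ 1# →
    a - A ∈± ε → b - B ∈± ε → e - E ∈± ε → d - D ∈± ε → d′ - D ∈± ε → a * b - e ∈± d′ - d →
    E - A * B ∈± ε * (abs A + abs B + fromℕ 4)
  product-error {A} {B} {E} {D} {a} {b} {e} {d} {d′} {ε} 0≤ε ε≤1 a∈ b∈ e∈ d∈ d′∈ ab∈ =
    ∈±-resp
      (solve 6 (λ A B E a b e →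
           ((a :- A) :* (b :- B) :+ (A :* (b :- B) :+ (a :- A) :* B)) :+ (:- (a :* b :- e) :+ :- (e :- E))
           := E :- A :* B) refl A B E a b e)
      refl
      (∈±-weaken
        (≤-from (+-mono-≤ (*-monoˡ-≤ 0≤ε ε≤1) (+-mono-≤ (proj₂ d′∈) (proj₁ d∈)))
          (solve 6 (λ ε α β D d d′ →
             ε :* (α :+ β :+ con (+ 4)) :- (ε :* ε :+ (α :* ε :+ ε :* β) :+ ((d′ :- d) :+ ε))
             := ε :* con (+ 1) :+ (ε :+ (d :- D)) :- (ε :* ε :+ ((d′ :- D) :+ :- ε))) refl
             ε (abs A) (abs B) D d d′))
        (∈±-+ (∈±-+ (∈±-* a∈ b∈) (∈±-+ (∈±-* (∈±abs A) b∈) (∈±-* a∈ (∈±abs B))))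
              (∈±-+ (∈±-neg ab∈) (∈±-neg e∈))))

  exp-+ : ∀ x y → exp (x + y) ≈ exp x * exp y
  exp-+ x y = ≈-from (∈±⇒≈0 (abs (exp x) + abs (exp y) + fromℕ 4) bound)
    (solve 1 (λ z → z := z :- con (+ 0)) refl (exp (x + y) - exp x * exp y))
    where
    bound : ∀ ε → 0# < ε → ε ≤ 1# → exp (x + y) - exp x * exp y ∈± ε * (abs (exp x) + abs (exp y) + fromℕ 4)
    bound ε 0<ε ε≤1 = product-error (<⇒≤ 0<ε) ε≤1
      (near x n₁≤n) (near y n₂≤n) (near (x + y) n₃≤n) (near z n₄≤n)
      (near z (ℕ.≤-trans n₄≤n (ℕ.m≤m+n n n))) (expSum-* x y n)
      where
      z : Carrier
      z = abs x + abs y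
      N : Carrier → ℕ
      N u = proj₁ (limit-∈± (exp-series u) ε 0<ε)
      near : ∀ u {k} → N u ℕ.≤ k → S k (expTerm u) - exp u ∈± ε
      near u {k} = proj₂ (limit-∈± (exp-series u) ε 0<ε) k
      n : ℕ
      n = (N x ℕ.⊔ N y) ℕ.⊔ (N (x + y) ℕ.⊔ N z)
      n₁≤n : N x ℕ.≤ n
      n₁≤n = ℕ.≤-trans (ℕ.m≤m⊔n (N x) (N y)) (ℕ.m≤m⊔n _ _)
      n₂≤n : N y ℕ.≤ n
      n₂≤n = ℕ.≤-trans (ℕ.m≤n⊔m (N x) (N y)) (ℕ.m≤m⊔n _ _)
      n₃≤n : N (x + y) ℕ.≤ n
      n₃≤n = ℕ.≤-trans (ℕ.m≤m⊔n (N (x + y)) (N z)) (ℕ.m≤n⊔m (N x ℕ.⊔ N y) _)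
      n₄≤n : N z ℕ.≤ n
      n₄≤n = ℕ.≤-trans (ℕ.m≤n⊔m (N (x + y)) (N z)) (ℕ.m≤n⊔m (N x ℕ.⊔ N y) _)

  expTerm-1 : ∀ t → expTerm t 1 ≈ t
  expTerm-1 t = *-cancelˡ-≈ (fromℕ 1) (0<fromℕ 0) (trans (derivative-expTerm t 0)
    (trans (*-congˡ (expTerm-0 t)) (solve 1 (λ t → t :* con (+ 1) := (con (+ 1) :+ con (+ 0)) :* t) refl t)))

  expTerm-2 : ∀ t → fromℕ 2 * expTerm t 2 ≈ t * t
  expTerm-2 t = trans (derivative-expTerm t 1) (*-congˡ (expTerm-1 t))

  expTerm-3 : ∀ t → fromℕ 6 * expTerm t 3 ≈ t * t * t
  expTerm-3 t = begin-equality
    fromℕ 6 * expTerm t 3             ≈⟨ solve 1 (λ e → con (+ 6) :* e := con (+ 2) :* (con (+ 3) :* e)) refl (expTerm t 3) ⟩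
    fromℕ 2 * (fromℕ 3 * expTerm t 3) ≈⟨ *-congˡ (derivative-expTerm t 2) ⟩
    fromℕ 2 * (t * expTerm t 2)       ≈⟨ solve 2 (λ t e → con (+ 2) :* (t :* e) := t :* (con (+ 2) :* e)) refl t (expTerm t 2) ⟩
    t * (fromℕ 2 * expTerm t 2)       ≈⟨ *-congˡ (expTerm-2 t) ⟩
    t * (t * t)                       ≈⟨ *-assoc t t t ⟨
    t * t * t                         ∎
    where open ≤-Reasoning

  1+t≤exp : ∀ {t} → 0# ≤ t → 1# + t ≤ exp t
  1+t≤exp {t} 0≤t = limit-≥ 2 (exp-series t) (λ n 2≤n → ≤-trans
    (≤-reflexive (+-cong (sym (expTerm-0 t)) (trans (sym (expTerm-1 t)) (sym (+-identityʳ _)))))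
    (S-mono-≤ (0≤expTerm 0≤t) 2≤n))

  -- From the cubic term on, consecutive terms at least halve.
  exp-upper : ∀ {t} → 0# ≤ t → t ≤ 1# →
              fromℕ 6 * exp t ≤ fromℕ 6 + fromℕ 6 * t + fromℕ 3 * (t * t) + fromℕ 2 * (t * t * t)
  exp-upper {t} 0≤t t≤1 = begin
    fromℕ 6 * exp t
      ≤⟨ *-monoˡ-≤ (0≤fromℕ 6) (limit-≤ 3 (exp-series t) below) ⟩
    fromℕ 6 * (e 0 + (e 1 + (e 2 + 0#)) + fromℕ 2 * e 3)
      ≈⟨ solve 4 (λ x y z w → con (+ 6) :* (x :+ (y :+ (z :+ con (+ 0))) :+ con (+ 2) :* w)
           := con (+ 6) :* x :+ con (+ 6) :* y :+ con (+ 3) :* (con (+ 2) :* z) :+ con (+ 2) :* (con (+ 6) :* w))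
           refl (e 0) (e 1) (e 2) (e 3) ⟩
    fromℕ 6 * e 0 + fromℕ 6 * e 1 + fromℕ 3 * (fromℕ 2 * e 2) + fromℕ 2 * (fromℕ 6 * e 3)
      ≈⟨ +-cong (+-cong (+-cong (trans (*-congˡ (expTerm-0 t)) (*-identityʳ _)) (*-congˡ (expTerm-1 t)))
                        (*-congˡ (expTerm-2 t))) (*-congˡ (expTerm-3 t)) ⟩
    fromℕ 6 + fromℕ 6 * t + fromℕ 3 * (t * t) + fromℕ 2 * (t * t * t) ∎
    where
    open ≤-Reasoning
    e : ℕ → Carrier
    e = expTerm t
    0≤e : ∀ k → 0# ≤ e k
    0≤e = 0≤expTerm 0≤t
    -- Adding `2 e n`, the sum of a geometric series of ratio 1/2 starting at `e n`, turns the
    -- partial sums into upper bounds that do not increase from 3 on.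
    U : ℕ → Carrier
    U n = S n e + fromℕ 2 * e n
    halving : ∀ n → 1 ℕ.≤ n → fromℕ 2 * e (suc n) ≤ e n
    halving n 1≤n = begin
      fromℕ 2 * e (suc n)         ≤⟨ *-monoʳ-≤ (0≤e (suc n)) (fromℕ-mono-≤ (ℕ.s≤s 1≤n)) ⟩
      fromℕ (suc n) * e (suc n)   ≈⟨ derivative-expTerm t n ⟩
      t * e n                     ≤⟨ *-monoʳ-≤ (0≤e n) t≤1 ⟩
      1# * e n                    ≈⟨ *-identityˡ _ ⟩
      e n                         ∎
    U-decreasing : ∀ j → U (j ℕ.+ 3) ≤ U 3
    U-decreasing zero    = ≤-refl
    U-decreasing (suc j) = ≤-trans (begin
      S (suc n) e + fromℕ 2 * e (suc n)   ≤⟨ +-mono-≤ (≤-reflexive (S-last n e)) (halving n (ℕ.m≤n⇒m≤o+n j (ℕ.s≤s ℕ.z≤n))) ⟩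
      S n e + e n + e n                   ≈⟨ solve 2 (λ s x → s :+ x :+ x := s :+ con (+ 2) :* x) refl (S n e) (e n) ⟩
      U n                                 ∎) (U-decreasing j)
      where
      n : ℕ
      n = j ℕ.+ 3
    below : ∀ n → 3 ℕ.≤ n → S n e ≤ U 3
    below n 3≤n = ≤-trans
      (≤-from (*-nonneg (0≤fromℕ 2) (0≤e n)) (solve 2 (λ s x → s :+ x :- s := x :- con (+ 0)) refl (S n e) (fromℕ 2 * e n)))
      (≡.subst (λ k → U k ≤ U 3) (ℕ.m∸n+n≡m 3≤n) (U-decreasing (n ℕ.∸ 3)))

  exp≤1+t+t² : ∀ {t} → 0# ≤ t → t ≤ 1# → exp t ≤ 1# + t + t * t
  exp≤1+t+t² {t} 0≤t t≤1 = *-cancelˡ-≤ (fromℕ 6) (0<fromℕ 5) (≤-from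
    (+-mono-≤ (exp-upper 0≤t t≤1) (+-mono-≤ (0≤x² t) (*-monoˡ-≤ (*-nonneg (0≤fromℕ 2) (0≤x² t)) t≤1)))
    (solve 2 (λ t E → con (+ 6) :* (con (+ 1) :+ t :+ t :* t) :- con (+ 6) :* E :=
       con (+ 6) :+ con (+ 6) :* t :+ con (+ 3) :* (t :* t)
         :+ con (+ 2) :* (t :* t :* t) :+ (t :* t :+ con (+ 2) :* (t :* t) :* con (+ 1))
       :- (con (+ 6) :* E :+ (con (+ 0) :+ con (+ 2) :* (t :* t) :* t))) refl t (exp t)))

  exp-0 : exp 0# ≈ 1#
  exp-0 = *-cancelˡ-≈ (exp 0#) (<-≤-trans 0<1 (≤-trans (≤-reflexive (sym (+-identityʳ 1#))) (1+t≤exp ≤-refl)))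
    (trans (sym (exp-+ 0# 0#)) (trans (exp-cong (+-identityʳ 0#)) (sym (*-identityʳ _))))

  1≤exp : ∀ {t} → 0# ≤ t → 1# ≤ exp t
  1≤exp {t} 0≤t = ≤-trans (≤-from 0≤t (solve 1 (λ t → con (+ 1) :+ t :- con (+ 1) := t :- con (+ 0)) refl t)) (1+t≤exp 0≤t)

  exp-neg : ∀ x → exp x * exp (- x) ≈ 1#
  exp-neg x = trans (sym (exp-+ x (- x))) (trans (exp-cong (-‿inverseʳ x)) exp-0)

  0<exp : ∀ x → 0# < exp x
  0<exp x with ≤-total 0# x
  ... | inj₁ 0≤x = <-≤-trans 0<1 (1≤exp 0≤x)
  ... | inj₂ x≤0 = *-cancelˡ-< (exp (- x)) 0<exp-x
    (<-from 0<1 (+-cong (trans (*-comm _ _) (exp-neg x)) (-‿cong (zeroʳ _))))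
    where
    0<exp-x : 0# < exp (- x)
    0<exp-x = <-≤-trans 0<1 (1≤exp (≤-from x≤0 (solve 1 (λ x → :- x :- con (+ 0) := con (+ 0) :- x) refl x)))

  exp-mono-< : ∀ {x y} → x < y → exp x < exp y
  exp-mono-< {x} {y} x<y = begin-strict
    exp x                   ≈⟨ *-identityʳ _ ⟨
    exp x * 1#              <⟨ *-monoˡ-< (0<exp x) (<-from x<y (solve 2 (λ x y → con (+ 1) :+ (y :- x) :- con (+ 1) := y :- x) refl x y)) ⟩
    exp x * (1# + (y - x))  ≤⟨ *-monoˡ-≤ (<⇒≤ (0<exp x)) (1+t≤exp (0≤-difference (<⇒≤ x<y))) ⟩
    exp x * exp (y - x)     ≈⟨ exp-+ x (y - x) ⟨
    exp (x + (y - x))       ≈⟨ exp-cong (solve 2 (λ x y → x :+ (y :- x) := y) refl x y) ⟩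
    exp y                   ∎
    where open ≤-Reasoning

  exp-mono-≤ : ∀ {x y} → x ≤ y → exp x ≤ exp y
  exp-mono-≤ {x} {y} x≤y with x ≈? y
  ... | yes x≈y = ≤-reflexive (exp-cong x≈y)
  ... | no  x≉y = <⇒≤ (exp-mono-< (x≤y , x≉y))

  exp-cancel-≤ : ∀ {x y} → exp x ≤ exp y → x ≤ y
  exp-cancel-≤ {x} {y} le with ≤-or-> x y
  ... | inj₁ x≤y = x≤y
  ... | inj₂ y<x = contradiction le (<⇒≱ (exp-mono-< y<x))

  exp-cancel-< : ∀ {x y} → exp x < exp y → x < y
  exp-cancel-< {x} {y} lt with ≤-or-> y x
  ... | inj₁ y≤x = contradiction (exp-mono-≤ y≤x) (<⇒≱ lt)
  ... | inj₂ x<y = x<y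

  exp-injective : ∀ {x y} → exp x ≈ exp y → x ≈ y
  exp-injective eq = ≤-antisym (exp-cancel-≤ (≤-reflexive eq)) (exp-cancel-≤ (≤-reflexive (sym eq)))

  log-mono-≤ : ∀ {x y} → 0# < x → x ≤ y → log x ≤ log y
  log-mono-≤ {x} {y} 0<x x≤y = exp-cancel-≤
    (≤-respˡ-≈ (sym (exp-log x 0<x)) (≤-respʳ-≈ (sym (exp-log y (<-≤-trans 0<x x≤y))) x≤y))

  log-* : ∀ {x y} → 0# < x → 0# < y → log (x * y) ≈ log x + log y
  log-* {x} {y} 0<x 0<y = exp-injective (begin-equality
    exp (log (x * y))           ≈⟨ exp-log _ (*-pos 0<x 0<y) ⟩
    x * y                       ≈⟨ *-cong (exp-log x 0<x) (exp-log y 0<y) ⟨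
    exp (log x) * exp (log y)   ≈⟨ exp-+ _ _ ⟨
    exp (log x + log y)         ∎)
    where open ≤-Reasoning

  log-exp : ∀ x → log (exp x) ≈ x
  log-exp x = exp-injective (exp-log _ (0<exp x))

  log-1 : log 1# ≈ 0#
  log-1 = trans (log-cong (sym exp-0)) (log-exp 0#)

  0≤log : ∀ {x} → 1# ≤ x → 0# ≤ log x
  0≤log 1≤x = ≤-respˡ-≈ log-1 (log-mono-≤ 0<1 1≤x)

  -- This is the inequality `3 log 2 > 2` that separates the limit `3 s log 2` of `g` from `2 s`;
  -- the cubic bound on `exp` is just sharp enough for it.
  ⅔<log2 : fromℕ 2 / fromℕ 3 < log (fromℕ 2)
  ⅔<log2 = exp-cancel-< (<-≤-trans exp⅔<2 (≤-reflexive (sym (exp-log _ (0<fromℕ 1)))))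
    where
    open ≤-Reasoning
    t : Carrier
    t = fromℕ 2 / fromℕ 3
    3t≈2 : fromℕ 3 * t ≈ fromℕ 2
    3t≈2 = trans (*-comm _ _) (/-*-cancel (0<fromℕ 2))
    0≤t : 0# ≤ t
    0≤t = 0≤/ (0≤fromℕ 2) (0<fromℕ 2)
    t≤1 : t ≤ 1#
    t≤1 = ≤*⇒/≤ (0<fromℕ 2) (≤-respʳ-≈ (sym (*-identityˡ _)) (fromℕ-mono-≤ {2} {3} (ℕ.s≤s (ℕ.s≤s ℕ.z≤n))))
    exp⅔<2 : exp t < fromℕ 2
    -- 162 = 27 * 6 clears all denominators of the cubic bound at 2/3, which then reads 322 < 324.
    exp⅔<2 = *-cancelˡ-< (fromℕ 162) (0<fromℕ 161) (begin-strict
      fromℕ 162 * exp t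
        ≈⟨ solve 1 (λ E → con (+ 162) :* E := con (+ 27) :* (con (+ 6) :* E)) refl (exp t) ⟩
      fromℕ 27 * (fromℕ 6 * exp t)
        ≤⟨ *-monoˡ-≤ (0≤fromℕ 27) (exp-upper 0≤t t≤1) ⟩
      fromℕ 27 * (fromℕ 6 + fromℕ 6 * t + fromℕ 3 * (t * t) + fromℕ 2 * (t * t * t))
        ≈⟨ solve 1 (λ t → con (+ 27) :* (con (+ 6) :+ con (+ 6) :* t :+ con (+ 3) :* (t :* t) :+ con (+ 2) :* (t :* t :* t))
             := con (+ 162) :+ con (+ 54) :* (con (+ 3) :* t) :+ con (+ 9) :* ((con (+ 3) :* t) :* (con (+ 3) :* t))
                :+ con (+ 2) :* ((con (+ 3) :* t) :* (con (+ 3) :* t) :* (con (+ 3) :* t))) refl t ⟩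
      fromℕ 162 + fromℕ 54 * 3t + fromℕ 9 * (3t * 3t) + fromℕ 2 * (3t * 3t * 3t)
        ≈⟨ +-cong (+-cong (+-congˡ (*-congˡ 3t≈2)) (*-congˡ (*-cong 3t≈2 3t≈2)))
                  (*-congˡ (*-cong (*-cong 3t≈2 3t≈2) 3t≈2)) ⟩
      fromℕ 162 + fromℕ 54 * fromℕ 2 + fromℕ 9 * (fromℕ 2 * fromℕ 2) + fromℕ 2 * (fromℕ 2 * fromℕ 2 * fromℕ 2)
        <⟨ <-from (0<fromℕ 1) (solve 0 (con (+ 162) :* con (+ 2)
             :- (con (+ 162) :+ con (+ 54) :* con (+ 2)
               :+ con (+ 9) :* (con (+ 2) :* con (+ 2)) :+ con (+ 2) :* (con (+ 2) :* con (+ 2) :* con (+ 2)))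
             := con (+ 2) :- con (+ 0)) refl) ⟩
      fromℕ 162 * fromℕ 2 ∎)
      where
      3t : Carrier
      3t = fromℕ 3 * t

  0<log2 : 0# < log (fromℕ 2)
  0<log2 = <-≤-trans (0</ (0<fromℕ 1) (0<fromℕ 2)) (<⇒≤ ⅔<log2)

  -- Powers

  0<** : ∀ x y → 0# < x ** y
  0<** x y = 0<exp _

  **-cong : ∀ {x y} z → x ≈ y → z ** x ≈ z ** y
  **-cong z x≈y = exp-cong (*-congʳ x≈y)

  **-+ : ∀ x y z → x ** (y + z) ≈ x ** y * x ** z
  **-+ x y z = trans (exp-cong (distribʳ _ y z)) (exp-+ _ _)

  **-1 : ∀ {x} → 0# < x → x ** 1# ≈ x
  **-1 0<x = trans (exp-cong (*-identityˡ _)) (exp-log _ 0<x)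

  1≤** : ∀ {x y} → 1# ≤ x → 0# ≤ y → 1# ≤ x ** y
  1≤** 1≤x 0≤y = 1≤exp (*-nonneg 0≤y (0≤log 1≤x))

  1≤fromℕ : ∀ n → 1# ≤ fromℕ (suc n)
  1≤fromℕ n = ≤-from (0≤fromℕ n) (solve 1 (λ x → con (+ 1) :+ x :- con (+ 1) := x :- con (+ 0)) refl (fromℕ n))

  -- From `exp (B / β) ≤ n` follows `B ≤ β log n`, and `x ≤ exp x` passes from there to the power.
  **-unbounded : ∀ β → 0# < β → ∀ B → ∃ λ n₀ → ∀ n → n₀ ℕ.≤ n → B ≤ fromℕ n ** β
  **-unbounded β 0<β B with archimedean (exp (B / β))
  ... | n₀ , le = n₀ , λ n n₀≤n → begin
    B                       ≈⟨ /-*-cancel 0<β ⟨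
    B / β * β               ≈⟨ *-comm _ _ ⟩
    β * (B / β)             ≤⟨ *-monoˡ-≤ (<⇒≤ 0<β) (begin
      B / β                   ≈⟨ log-exp _ ⟨
      log (exp (B / β))       ≤⟨ log-mono-≤ (0<exp _) (≤-trans le (fromℕ-mono-≤ n₀≤n)) ⟩
      log (fromℕ n)           ∎) ⟩
    β * log (fromℕ n)       ≤⟨ x≤exp _ ⟩
    fromℕ n ** β            ∎
    where
    open ≤-Reasoning
    x≤exp : ∀ x → x ≤ exp x
    x≤exp x with ≤-total 0# x
    ... | inj₁ 0≤x = ≤-trans (≤-from 0≤1 (solve 1 (λ x → con (+ 1) :+ x :- x := con (+ 1) :- con (+ 0)) refl x)) (1+t≤exp 0≤x)
    ... | inj₂ x≤0 = ≤-trans x≤0 (<⇒≤ (0<exp x))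

-- The size of `g`, its limit, and the failure of weak correlations

module Asymptotics {c ℓ : Level} (R : RealNumbers c ℓ) where
  open PairCorrelation R
  open Exponential R

  -- Here u, v are the arguments of the floors Kmax, Kmin, and r is the factor
  -- (C + 1) / (C N) of K̃ in N ^ (1 - α) g; note r v = 1 + C and r u = 2.
  module _ {c u v kx kn w r : Carrier}
    (0≤c : 0# ≤ c) (c≤1 : c ≤ 1#) (0≤v : 0# ≤ v) (u-eq : u * (1# + c) ≈ fromℕ 2 * v)
    (0≤kx : 0# ≤ kx) (kx≤u : kx ≤ u) (u≤kx+1 : u ≤ kx + 1#)
    (0≤kn : 0# ≤ kn) (kn≤v : kn ≤ v) (v≤kn+1 : v ≤ kn + 1#)
    (0≤w : 0# ≤ w) (w≤2 : w ≤ fromℕ 2) where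

    private
      k̃ : Carrier
      k̃ = kx * (kx + 1#) - kn * (kn + 1#)

      0≤u : 0# ≤ u
      0≤u = ≤-trans 0≤kx kx≤u

      u≤2v : u ≤ fromℕ 2 * v
      u≤2v = ≤-trans (≤-from (*-nonneg 0≤u 0≤c)
        (solve 2 (λ u c → u :* (con (+ 1) :+ c) :- u := u :* c :- con (+ 0)) refl u c)) (≤-reflexive u-eq)

      2v-2vc≤u : fromℕ 2 * v - fromℕ 2 * v * c ≤ u
      2v-2vc≤u = ≤-from (+-mono-≤ (≤-reflexive (sym u-eq)) (*-monoʳ-≤ 0≤c u≤2v))
        (solve 3 (λ u v c → u :- (con (+ 2) :* v :- con (+ 2) :* v :* c)
          := u :* (con (+ 1) :+ c) :+ con (+ 2) :* v :* c :- (con (+ 2) :* v :+ u :* c)) refl u v c)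

      -- The product `x (x + 1)` is monotone, so the floors can be removed: `kx ≥ u - 1` makes the
      -- first product at least `u (u - 1)`, and `kn ≤ v` makes the second at most `v (v + 1)`.
      k̃-lower : u * (u - 1#) - v * (v + 1#) ≤ k̃
      k̃-lower = ≤-from-difference
        (0≤+ (*-nonneg (0≤-difference u≤kx+1) (0≤+ 0≤kx 0≤u))
             (*-nonneg (0≤-difference kn≤v) (0≤+ (0≤+ 0≤v 0≤kn) 0≤1)))
        (solve 4 (λ u v x n → x :* (x :+ con (+ 1)) :- n :* (n :+ con (+ 1)) :- (u :* (u :- con (+ 1)) :- v :* (v :+ con (+ 1)))
          := (x :+ con (+ 1) :- u) :* (x :+ u) :+ (v :- n) :* (v :+ n :+ con (+ 1))) refl u v kx kn)

      k̃-upper : k̃ ≤ u * (u + 1#) - v * (v - 1#)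
      k̃-upper = ≤-from-difference
        (0≤+ (*-nonneg (0≤-difference kx≤u) (0≤+ (0≤+ 0≤u 0≤kx) 0≤1))
             (*-nonneg (0≤-difference v≤kn+1) (0≤+ 0≤v 0≤kn)))
        (solve 4 (λ u v x n → u :* (u :+ con (+ 1)) :- v :* (v :- con (+ 1)) :- (x :* (x :+ con (+ 1)) :- n :* (n :+ con (+ 1)))
          := (u :- x) :* (u :+ x :+ con (+ 1)) :+ (n :+ con (+ 1) :- v) :* (v :+ n)) refl u v kx kn)

      G : Carrier
      G = fromℕ 4 * kx - fromℕ 2 * kn - w - k̃ * r

    -- Up to bounded errors `k̃ r` is `2 u - (1 + c) v`, which leaves `2 u - v + v c` of `G`; since
    -- `u` lies between `2 v - 2 v c` and `2 v`, this is `3 v` up to `3 v c`. The bounded errors sum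
    -- to at most 10 below and 6 above, both rounded up to 12.
    scaled-estimate : 0# ≤ r → r * v ≈ 1# + c → G - fromℕ 3 * v ∈± fromℕ 12 + fromℕ 3 * (v * c)
    scaled-estimate 0≤r rv≈1+c = lower , upper
      where
      ru≈2 : r * u ≈ fromℕ 2
      ru≈2 = *-cancelˡ-≈ (1# + c) (<-≤-trans 0<1 (≤-from 0≤c (solve 1 (λ c → con (+ 1) :+ c :- con (+ 1) := c :- con (+ 0)) refl c)))
        (begin-equality
          (1# + c) * (r * u)     ≈⟨ solve 3 (λ c r u → (con (+ 1) :+ c) :* (r :* u) := r :* (u :* (con (+ 1) :+ c))) refl c r u ⟩
          r * (u * (1# + c))     ≈⟨ *-congˡ u-eq ⟩
          r * (fromℕ 2 * v)      ≈⟨ solve 2 (λ r v → r :* (con (+ 2) :* v) := (r :* v) :* con (+ 2)) refl r v ⟩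
          r * v * fromℕ 2        ≈⟨ *-congʳ rv≈1+c ⟩
          (1# + c) * fromℕ 2     ∎)
        where open ≤-Reasoning
      k̃r-lower : fromℕ 2 * (u - 1#) - (1# + c) * (v + 1#) ≤ k̃ * r
      k̃r-lower = ≤-respˡ-≈ (trans
        (solve 3 (λ r u v → (u :* (u :- con (+ 1)) :- v :* (v :+ con (+ 1))) :* r
          := (r :* u) :* (u :- con (+ 1)) :- (r :* v) :* (v :+ con (+ 1))) refl r u v)
        (+-cong (*-congʳ ru≈2) (-‿cong (*-congʳ rv≈1+c)))) (*-monoʳ-≤ 0≤r k̃-lower)
      k̃r-upper : k̃ * r ≤ fromℕ 2 * (u + 1#) - (1# + c) * (v - 1#)
      k̃r-upper = ≤-respʳ-≈ (trans
        (solve 3 (λ r u v → (u :* (u :+ con (+ 1)) :- v :* (v :- con (+ 1))) :* r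
          := (r :* u) :* (u :+ con (+ 1)) :- (r :* v) :* (v :- con (+ 1))) refl r u v)
        (+-cong (*-congʳ ru≈2) (-‿cong (*-congʳ rv≈1+c)))) (*-monoʳ-≤ 0≤r k̃-upper)
      2≤4 : fromℕ 2 ≤ fromℕ 4
      2≤4 = fromℕ-mono-≤ {2} {4} (ℕ.s≤s (ℕ.s≤s ℕ.z≤n))
      upper : G - fromℕ 3 * v ≤ fromℕ 12 + fromℕ 3 * (v * c)
      upper = ≤-from
        (+-mono-≤ (*-monoˡ-≤ (0≤fromℕ 4) kx≤u) (+-mono-≤ (*-monoˡ-≤ (0≤fromℕ 2) v≤kn+1)
           (+-mono-≤ 0≤w (+-mono-≤ k̃r-lower
          (+-mono-≤ (*-monoˡ-≤ (0≤fromℕ 2) u≤2v) (+-mono-≤ c≤1 (+-mono-≤ (*-monoˡ-≤ (0≤fromℕ 2) (*-nonneg 0≤v 0≤c)) (0≤fromℕ 6))))))))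
        (solve 7 (λ c u v x n w z →
          con (+ 12) :+ con (+ 3) :* (v :* c) :- (con (+ 4) :* x :- con (+ 2) :* n :- w :- z :- con (+ 3) :* v)
          := con (+ 4) :* u :+ (con (+ 2) :* (n :+ con (+ 1)) :+ (w :+ (z
               :+ (con (+ 2) :* (con (+ 2) :* v) :+ (con (+ 1) :+ (con (+ 2) :* (v :* c) :+ con (+ 6)))))))
          :- (con (+ 4) :* x :+ (con (+ 2) :* v :+ (con (+ 0)
               :+ (con (+ 2) :* (u :- con (+ 1)) :- (con (+ 1) :+ c) :* (v :+ con (+ 1))
               :+ (con (+ 2) :* u :+ (c :+ (con (+ 2) :* con (+ 0) :+ con (+ 0)))))))))
          refl c u v kx kn w (k̃ * r))
      lower : - (fromℕ 12 + fromℕ 3 * (v * c)) ≤ G - fromℕ 3 * v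
      lower = ≤-from
        (+-mono-≤ (*-monoˡ-≤ (0≤fromℕ 4) u≤kx+1) (+-mono-≤ (*-monoˡ-≤ (0≤fromℕ 2) kn≤v) (+-mono-≤ w≤2 (+-mono-≤ k̃r-upper
          (+-mono-≤ (*-monoˡ-≤ (0≤fromℕ 2) 2v-2vc≤u) (+-mono-≤ c≤1 2≤4))))))
        (solve 7 (λ c u v x n w z →
          (con (+ 4) :* x :- con (+ 2) :* n :- w :- z :- con (+ 3) :* v) :- :- (con (+ 12) :+ con (+ 3) :* (v :* c))
          := con (+ 4) :* (x :+ con (+ 1)) :+ (con (+ 2) :* v :+ (con (+ 2)
               :+ (con (+ 2) :* (u :+ con (+ 1)) :- (con (+ 1) :+ c) :* (v :- con (+ 1))
               :+ (con (+ 2) :* u :+ (con (+ 1) :+ con (+ 4))))))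
          :- (con (+ 4) :* u :+ (con (+ 2) :* n :+ (w
               :+ (z :+ (con (+ 2) :* (con (+ 2) :* v :- con (+ 2) :* v :* c) :+ (c :+ con (+ 2))))))))
          refl c u v kx kn w (k̃ * r))

    -- Covers `s = 0`, where `c` vanishes and `r` contains the unspecified `0# ⁻¹`: both floors are
    -- 0, and with them the factor of `r`.
    G-degenerate : v ≈ 0# → G ≈ - w
    G-degenerate v≈0 = trans
      (+-cong (+-congʳ (+-cong (*-congˡ kx≈0) (-‿cong (*-congˡ kn≈0))))
        (-‿cong (*-congʳ (+-cong (*-cong kx≈0 (+-congʳ kx≈0)) (-‿cong (*-cong kn≈0 (+-congʳ kn≈0)))))))
      (solve 2 (λ w r → con (+ 4) :* con (+ 0) :- con (+ 2) :* con (+ 0) :- w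
        :- (con (+ 0) :* (con (+ 0) :+ con (+ 1)) :- con (+ 0) :* (con (+ 0) :+ con (+ 1))) :* r := :- w) refl w r)
      where
      kn≈0 : kn ≈ 0#
      kn≈0 = ≤-antisym (≤-trans kn≤v (≤-reflexive v≈0)) 0≤kn
      kx≈0 : kx ≈ 0#
      kx≈0 = ≤-antisym (≤-trans kx≤u (≤-trans u≤2v (≤-reflexive (trans (*-congˡ v≈0) (zeroʳ _))))) 0≤kx

    scaled-estimate-degenerate : v ≈ 0# → G - fromℕ 3 * v ∈± fromℕ 12 + fromℕ 3 * (v * c)
    scaled-estimate-degenerate v≈0 = ∈±-resp (sym G-3v≈-w) refl
      (∈±-weaken w≤bound (∈±-neg (nonneg⇒∈± 0≤w)))
      where
      G-3v≈-w : G - fromℕ 3 * v ≈ - w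
      G-3v≈-w = trans (+-cong (G-degenerate v≈0) (-‿cong (trans (*-congˡ v≈0) (zeroʳ _))))
        (solve 1 (λ w → :- w :- con (+ 0) := :- w) refl w)
      w≤bound : w ≤ fromℕ 12 + fromℕ 3 * (v * c)
      w≤bound = ≤-from (+-mono-≤ w≤2 (+-mono-≤ (0≤fromℕ 10) (*-monoˡ-≤ (0≤fromℕ 3) (*-nonneg 0≤v 0≤c))))
        (solve 3 (λ w v c → con (+ 12) :+ con (+ 3) :* (v :* c) :- w
          := con (+ 2) :+ (con (+ 10) :+ con (+ 3) :* (v :* c)) :- (w :+ (con (+ 0) :+ con (+ 3) :* con (+ 0)))) refl w v c)

  fromℤ-K̃ : ∀ i j → fromℤ (i ℤ.* (i ℤ.+ ℤ.1ℤ) ℤ.- j ℤ.* (j ℤ.+ ℤ.1ℤ))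
                    ≈ fromℤ i * (fromℤ i + 1#) - fromℤ j * (fromℤ j + 1#)
  fromℤ-K̃ i j = trans (fromℤ-+ (i ℤ.* (i ℤ.+ ℤ.1ℤ)) (ℤ.- (j ℤ.* (j ℤ.+ ℤ.1ℤ))))
    (+-cong (pronic i) (trans (fromℤ-neg (j ℤ.* (j ℤ.+ ℤ.1ℤ))) (-‿cong (pronic j))))
    where
    pronic : ∀ i → fromℤ (i ℤ.* (i ℤ.+ ℤ.1ℤ)) ≈ fromℤ i * (fromℤ i + 1#)
    pronic i = trans (fromℤ-* i (i ℤ.+ ℤ.1ℤ)) (*-congˡ (trans (fromℤ-+ i ℤ.1ℤ) (+-congˡ (+-identityʳ 1#))))

  module Parameters (N : ℕ) (1≤N : 1# ≤ fromℕ N) (s α : Carrier) (0≤s : 0# ≤ s) where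
    N′ P M W δ t c′ u v : Carrier
    N′ = fromℕ N
    P  = N′ ** α
    M  = N′ ** (1# - α)
    W  = N′ ** (fromℕ 2 - α)
    δ  = s / P
    t  = δ * log (fromℕ 2)
    c′ = C N s α
    u  = (fromℕ 2 * N′ * c′) / (1# + c′)
    v  = N′ * c′

    0<N′ : 0# < N′
    0<N′ = <-≤-trans 0<1 1≤N

    0<P : 0# < P
    0<P = 0<** N′ α

    0<M : 0# < M
    0<M = 0<** N′ (1# - α)

    0<W : 0# < W
    0<W = 0<** N′ (fromℕ 2 - α)

    PM≈N : P * M ≈ N′
    PM≈N = trans (sym (**-+ N′ α (1# - α))) (trans
      (**-cong N′ (solve 1 (λ α → α :+ (con (+ 1) :- α) := con (+ 1)) refl α)) (**-1 0<N′))

    W≈NM : W ≈ N′ * M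
    W≈NM = trans (**-cong N′ (solve 1 (λ α → con (+ 2) :- α := con (+ 1) :+ (con (+ 1) :- α)) refl α))
      (trans (**-+ N′ 1# (1# - α)) (*-congʳ (**-1 0<N′)))

    0≤δ : 0# ≤ δ
    0≤δ = 0≤/ 0≤s 0<P

    0≤t : 0# ≤ t
    0≤t = *-nonneg 0≤δ (<⇒≤ 0<log2)

    t≤c : t ≤ c′
    t≤c = ≤-from (1+t≤exp 0≤t) (solve 2 (λ t e → e :- con (+ 1) :- t := e :- (con (+ 1) :+ t)) refl t (exp t))

    0≤c : 0# ≤ c′
    0≤c = ≤-trans 0≤t t≤c

    0<1+c : 0# < 1# + c′
    0<1+c = <-≤-trans 0<1 (≤-from 0≤c (solve 1 (λ c → con (+ 1) :+ c :- con (+ 1) := c :- con (+ 0)) refl c′))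

    0≤v : 0# ≤ v
    0≤v = *-nonneg (<⇒≤ 0<N′) 0≤c

    0≤u : 0# ≤ u
    0≤u = 0≤/ (*-nonneg (*-nonneg (0≤fromℕ 2) (<⇒≤ 0<N′)) 0≤c) 0<1+c

    u-eq : u * (1# + c′) ≈ fromℕ 2 * v
    u-eq = trans (/-*-cancel 0<1+c) (*-assoc _ _ _)

    0≤⌊_⌋ : ∀ {x} → 0# ≤ x → 0# ≤ fromℤ ⌊ x ⌋
    0≤⌊_⌋ 0≤x = fromℤ-mono-≤ (fromℤ≤⇒≤⌊⌋ {+ 0} 0≤x)

    r w : Carrier
    r = (c′ + 1#) / (c′ * W) * M
    w = fromℕ 2 / W * M

    0≤w : 0# ≤ w
    0≤w = *-nonneg (0≤/ (0≤fromℕ 2) 0<W) (<⇒≤ 0<M)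

    w≤2 : w ≤ fromℕ 2
    w≤2 = ≤-respʳ-≈ (/-*-cancel 0<W) (*-monoˡ-≤ (0≤/ (0≤fromℕ 2) 0<W)
      (≤-respʳ-≈ (sym W≈NM) (≤-respˡ-≈ (*-identityˡ M) (*-monoʳ-≤ (<⇒≤ 0<M) 1≤N))))

    0≤r : 0# < c′ → 0# ≤ r
    0≤r 0<c = *-nonneg (0≤/ (≤-respʳ-≈ (+-comm _ _) (<⇒≤ 0<1+c)) (*-pos 0<c 0<W)) (<⇒≤ 0<M)

    rv≈1+c : 0# < c′ → r * v ≈ 1# + c′
    rv≈1+c 0<c = begin-equality
      (c′ + 1#) / (c′ * W) * M * (N′ * c′)
        ≈⟨ solve 4 (λ q M N c → q :* M :* (N :* c) := q :* (c :* (N :* M))) refl ((c′ + 1#) / (c′ * W)) M N′ c′ ⟩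
      (c′ + 1#) / (c′ * W) * (c′ * (N′ * M))
        ≈⟨ *-congˡ (*-congˡ W≈NM) ⟨
      (c′ + 1#) / (c′ * W) * (c′ * W)
        ≈⟨ /-*-cancel (*-pos 0<c 0<W) ⟩
      c′ + 1#
        ≈⟨ +-comm _ _ ⟩
      1# + c′ ∎
      where open ≤-Reasoning

    -- Multiplication by `M = N ^ (1 - α)` clears the denominators of the floors and brings `g` into
    -- the form of `G`, with `w` and `r` written out.
    g-scaled : g N s α * M ≈ fromℕ 4 * fromℤ (Kmax N s α) - fromℕ 2 * fromℤ (Kmin N s α) - fromℕ 2 / W * M
      - (fromℤ (Kmax N s α) * (fromℤ (Kmax N s α) + 1#) - fromℤ (Kmin N s α) * (fromℤ (Kmin N s α) + 1#))
        * ((c′ + 1#) / (c′ * W) * M)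
    g-scaled = trans
      (solve 6 (λ x n w k q M → (con (+ 4) :* x :- con (+ 2) :* n :- w :- k :* q) :* M
        := con (+ 4) :* (x :* M) :- con (+ 2) :* (n :* M) :- w :* M :- k :* (q :* M)) refl
        (fromℤ (Kmax N s α) / M) (fromℤ (Kmin N s α) / M) (fromℕ 2 / W) (fromℤ (K̃ N s α)) ((c′ + 1#) / (c′ * W)) M)
      (+-cong (+-congʳ (+-cong (*-congˡ (/-*-cancel 0<M)) (-‿cong (*-congˡ (/-*-cancel 0<M)))))
        (-‿cong (*-congʳ (fromℤ-K̃ (Kmax N s α) (Kmin N s α)))))

    σ : Carrier
    σ = s * log (fromℕ 2)

    module _ (2σ≤P : fromℕ 2 * σ ≤ P) where
      private
        tP≈σ : t * P ≈ σ
        tP≈σ = trans (solve 3 (λ d l P → d :* l :* P := d :* P :* l) refl δ (log (fromℕ 2)) P) (*-congʳ (/-*-cancel 0<P))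

        -- The purpose of the threshold `2σ≤P`: together with `c′ ≤ 2 t` it yields `c′ ≤ 1`.
        2t≤1 : fromℕ 2 * t ≤ 1#
        2t≤1 = *-cancelˡ-≤ P 0<P (≤-respˡ-≈
          (trans (*-congˡ (sym tP≈σ)) (solve 2 (λ t P → con (+ 2) :* (t :* P) := P :* (con (+ 2) :* t)) refl t P))
          (≤-respʳ-≈ (sym (*-identityʳ P)) 2σ≤P))

        t≤1 : t ≤ 1#
        t≤1 = ≤-trans (≤-from 0≤t (solve 1 (λ t → con (+ 2) :* t :- t := t :- con (+ 0)) refl t)) 2t≤1

        c≤t+t² : c′ ≤ t + t * t
        c≤t+t² = ≤-from (exp≤1+t+t² 0≤t t≤1)
          (solve 2 (λ t e → t :+ t :* t :- (e :- con (+ 1)) := con (+ 1) :+ t :+ t :* t :- e) refl t (exp t))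

        c≤2t : c′ ≤ fromℕ 2 * t
        c≤2t = ≤-trans c≤t+t² (≤-from (*-monoˡ-≤ 0≤t t≤1)
          (solve 1 (λ t → con (+ 2) :* t :- (t :+ t :* t) := t :* con (+ 1) :- t :* t) refl t))

        G-bound : g N s α * M - fromℕ 3 * v ∈± fromℕ 12 + fromℕ 3 * (v * c′)
        G-bound = ∈±-resp (+-congʳ (sym g-scaled)) refl (estimate (c′ ≤? 0#))
          where
          estimate : Dec (c′ ≤ 0#) → _ ∈± _
          estimate (yes c≤0) = scaled-estimate-degenerate {r = r}
            0≤c (≤-trans c≤2t 2t≤1) 0≤v u-eq
            0≤⌊ 0≤u ⌋ (⌊⌋-lower u) (<⇒≤ (⌊⌋-upper u)) 0≤⌊ 0≤v ⌋ (⌊⌋-lower v) (<⇒≤ (⌊⌋-upper v)) 0≤w w≤2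
            (trans (*-congˡ (≤-antisym c≤0 0≤c)) (zeroʳ _))
          estimate (no c≰0) = scaled-estimate {r = r}
            0≤c (≤-trans c≤2t 2t≤1) 0≤v u-eq
            0≤⌊ 0≤u ⌋ (⌊⌋-lower u) (<⇒≤ (⌊⌋-upper u)) 0≤⌊ 0≤v ⌋ (⌊⌋-lower v) (<⇒≤ (⌊⌋-upper v)) 0≤w w≤2
            (0≤r (≰⇒> c≰0))
            (rv≈1+c (≰⇒> c≰0))

      -- `M` times the deviation is `g M - 3 v` plus `3 (v - M σ)`. From `c′ ≤ 2 t` and
      -- `c′ - t ≤ t²` come `v c′ ≤ 4 M P t²` and `v - M σ ≤ M P t²`; then 15 = 3 * 4 + 3, and
      -- `P t² = σ² / P`.
      g-estimate : g N s α - fromℕ 3 * σ ∈± fromℕ 12 / M + (fromℕ 15 * (σ * σ)) / P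
      g-estimate = ∈±-cancel (∈±-resp
        (solve 4 (λ g M v σ → g :* M :- con (+ 3) :* v :+ con (+ 3) :* (v :- M :* σ) := M :* (g :- con (+ 3) :* σ)) refl (g N s α) M v σ)
        refl
        (∈±-weaken bound (∈±-+ G-bound (nonneg⇒∈± (*-nonneg (0≤fromℕ 3) 0≤v-Mσ)))))
        where
        open ≤-Reasoning
        ∈±-cancel : ∀ {x b} → M * x ∈± M * b → x ∈± b
        ∈±-cancel {x} {b} (l , u) = *-cancelˡ-≤ M 0<M (≤-respˡ-≈ (solve 2 (λ M b → :- (M :* b) := M :* :- b) refl M b) l)
                          , *-cancelˡ-≤ M 0<M u
        v≈MPc : v ≈ M * (P * c′)
        v≈MPc = trans (*-congʳ (sym PM≈N)) (solve 3 (λ P M c → P :* M :* c := M :* (P :* c)) refl P M c′)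
        0≤MP : 0# ≤ M * P
        0≤MP = *-nonneg (<⇒≤ 0<M) (<⇒≤ 0<P)
        σ≈Pt : σ ≈ P * t
        σ≈Pt = trans (sym tP≈σ) (*-comm t P)
        v-Mσ≈ : v - M * σ ≈ M * P * (c′ - t)
        v-Mσ≈ = trans (+-cong v≈MPc (-‿cong (*-congˡ σ≈Pt)))
          (solve 4 (λ M P c t → M :* (P :* c) :- M :* (P :* t) := M :* P :* (c :- t)) refl M P c′ t)
        0≤v-Mσ : 0# ≤ v - M * σ
        0≤v-Mσ = ≤-respʳ-≈ (sym v-Mσ≈) (*-nonneg 0≤MP (0≤-difference t≤c))
        v-Mσ≤ : v - M * σ ≤ M * P * (t * t)
        v-Mσ≤ = ≤-respˡ-≈ (sym v-Mσ≈) (*-monoˡ-≤ 0≤MP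
          (≤-from c≤t+t² (solve 2 (λ t c → t :* t :- (c :- t) := t :+ t :* t :- c) refl t c′)))
        vc≤ : v * c′ ≤ M * P * (fromℕ 4 * (t * t))
        vc≤ = begin
          v * c′                      ≈⟨ *-congʳ v≈MPc ⟩
          M * (P * c′) * c′           ≈⟨ solve 3 (λ M P c → M :* (P :* c) :* c := M :* P :* (c :* c)) refl M P c′ ⟩
          M * P * (c′ * c′)           ≤⟨ *-monoˡ-≤ 0≤MP (*-mono-≤ 0≤c c≤2t 0≤c c≤2t) ⟩
          M * P * (fromℕ 2 * t * (fromℕ 2 * t))
            ≈⟨ *-congˡ (solve 1 (λ t → con (+ 2) :* t :* (con (+ 2) :* t) := con (+ 4) :* (t :* t)) refl t) ⟩
          M * P * (fromℕ 4 * (t * t)) ∎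
        σ²/P≈ : (fromℕ 15 * (σ * σ)) / P ≈ fromℕ 15 * (P * (t * t))
        σ²/P≈ = trans (*-congʳ (trans (*-congˡ (*-cong σ≈Pt σ≈Pt))
            (solve 2 (λ P t → con (+ 15) :* (P :* t :* (P :* t)) := con (+ 15) :* (P :* (t :* t)) :* P) refl P t)))
          (*-/-cancel 0<P)
        bound : fromℕ 12 + fromℕ 3 * (v * c′) + fromℕ 3 * (v - M * σ) ≤ M * (fromℕ 12 / M + (fromℕ 15 * (σ * σ)) / P)
        bound = begin
          fromℕ 12 + fromℕ 3 * (v * c′) + fromℕ 3 * (v - M * σ)
            ≤⟨ +-mono-≤ (+-mono-≤ ≤-refl (*-monoˡ-≤ (0≤fromℕ 3) vc≤)) (*-monoˡ-≤ (0≤fromℕ 3) v-Mσ≤) ⟩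
          fromℕ 12 + fromℕ 3 * (M * P * (fromℕ 4 * (t * t))) + fromℕ 3 * (M * P * (t * t))
            ≈⟨ +-congʳ (+-congʳ (/-*-cancel 0<M)) ⟨
          fromℕ 12 / M * M + fromℕ 3 * (M * P * (fromℕ 4 * (t * t))) + fromℕ 3 * (M * P * (t * t))
            ≈⟨ solve 4 (λ q M P t → q :* M :+ con (+ 3) :* (M :* P :* (con (+ 4) :* (t :* t))) :+ con (+ 3) :* (M :* P :* (t :* t))
                 := M :* (q :+ con (+ 15) :* (P :* (t :* t)))) refl (fromℕ 12 / M) M P t ⟩
          M * (fromℕ 12 / M + fromℕ 15 * (P * (t * t)))
            ≈⟨ *-congˡ (+-congˡ σ²/P≈) ⟨
          M * (fromℕ 12 / M + (fromℕ 15 * (σ * σ)) / P) ∎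

  /**-null : ∀ {A β ε} → 0# < β → 0# < ε → ∃ λ n₀ → ∀ n → n₀ ℕ.≤ n → A / fromℕ n ** β ≤ ε
  /**-null {A} {β} {ε} 0<β 0<ε with **-unbounded β 0<β (A / ε)
  ... | n₀ , large = n₀ , λ n n₀≤n → ≤*⇒/≤ (0<** (fromℕ n) β)
    (≤-respʳ-≈ (*-comm _ _) (/≤⇒≤* 0<ε (large n n₀≤n)))

  g-limit : ∀ α s → 0# < α → α < 1# → 0# ≤ s →
            (λ N → g N s α) ⟶ fromℕ 2 * s * (fromℕ 3 / fromℕ 4) * log (fromℕ 4)
  g-limit α s 0<α α<1 0≤s ε 0<ε = n₀ , close
    where
    open ≤-Reasoning
    σ ε′ L : Carrier
    σ  = s * log (fromℕ 2)
    ε′ = ε / fromℕ 3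
    L  = fromℕ 2 * s * (fromℕ 3 / fromℕ 4) * log (fromℕ 4)
    0<ε′ : 0# < ε′
    0<ε′ = 0</ 0<ε (0<fromℕ 2)
    0<1-α : 0# < 1# - α
    0<1-α = <-from α<1 (solve 1 (λ α → con (+ 1) :- α :- con (+ 0) := con (+ 1) :- α) refl α)
    large-P : ∃ λ n₀ → ∀ n → n₀ ℕ.≤ n → fromℕ 2 * σ ≤ fromℕ n ** α
    large-P = **-unbounded α 0<α (fromℕ 2 * σ)
    small-M : ∃ λ n₀ → ∀ n → n₀ ℕ.≤ n → fromℕ 12 / fromℕ n ** (1# - α) ≤ ε′
    small-M = /**-null 0<1-α 0<ε′
    small-P : ∃ λ n₀ → ∀ n → n₀ ℕ.≤ n → (fromℕ 15 * (σ * σ)) / fromℕ n ** α ≤ ε′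
    small-P = /**-null 0<α 0<ε′
    n₁ n₂ n₃ n₀ : ℕ
    n₁ = proj₁ large-P
    n₂ = proj₁ small-M
    n₃ = proj₁ small-P
    -- The `suc` excludes `N = 0`, at which `log` and with it the powers of `N` are unspecified.
    n₀ = suc (n₁ ℕ.+ (n₂ ℕ.+ n₃))
    L≈3σ : L ≈ fromℕ 3 * σ
    L≈3σ = begin-equality
      fromℕ 2 * s * (fromℕ 3 / fromℕ 4) * log (fromℕ 4)
        ≈⟨ *-congˡ (trans (log-cong (fromℕ-* 2 2)) (log-* (0<fromℕ 1) (0<fromℕ 1))) ⟩
      fromℕ 2 * s * (fromℕ 3 / fromℕ 4) * (log (fromℕ 2) + log (fromℕ 2))
        ≈⟨ solve 3 (λ s q l → con (+ 2) :* s :* q :* (l :+ l) := q :* con (+ 4) :* (s :* l)) refl s (fromℕ 3 / fromℕ 4) (log (fromℕ 2)) ⟩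
      fromℕ 3 / fromℕ 4 * fromℕ 4 * σ
        ≈⟨ *-congʳ (/-*-cancel (0<fromℕ 3)) ⟩
      fromℕ 3 * σ ∎
    ε′+ε′<ε : ε′ + ε′ < ε
    ε′+ε′<ε = <-from 0<ε′ (begin-equality
      ε - (ε′ + ε′)             ≈⟨ +-congʳ (/-*-cancel (0<fromℕ 2)) ⟨
      ε′ * fromℕ 3 - (ε′ + ε′)  ≈⟨ solve 1 (λ e → e :* con (+ 3) :- (e :+ e) := e :- con (+ 0)) refl ε′ ⟩
      ε′ - 0#                   ∎)
    close : ∀ n → n₀ ℕ.≤ n → abs (g n s α - L) < ε
    close (suc n) (ℕ.s≤s le) = ≤-<-trans
      (∈±⇒abs≤ (∈±-resp (+-congˡ (-‿cong (sym L≈3σ))) refl (∈±-weaken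
        (+-mono-≤ (proj₂ small-M (suc n) (ℕ.m≤n⇒m≤1+n (ℕ.m+n≤o⇒m≤o n₂ n₂+n₃≤n)))
                  (proj₂ small-P (suc n) (ℕ.m≤n⇒m≤1+n (ℕ.m+n≤o⇒n≤o n₂ n₂+n₃≤n))))
        (Parameters.g-estimate (suc n) (1≤fromℕ n) s α 0≤s
          (proj₂ large-P (suc n) (ℕ.m≤n⇒m≤1+n (ℕ.m+n≤o⇒m≤o n₁ le)))))))
      ε′+ε′<ε
      where
      n₂+n₃≤n : n₂ ℕ.+ n₃ ℕ.≤ n
      n₂+n₃≤n = ℕ.m+n≤o⇒n≤o n₁ le

  ⟶⇒eventually-≤ : ∀ {a L b} → a ⟶ L → L < b → ∃ λ n₀ → ∀ n → n₀ ℕ.≤ n → a n ≤ b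
  ⟶⇒eventually-≤ {a} {L} {b} lim L<b
    with lim (b - L) (<-from L<b (solve 2 (λ b L → b :- L :- con (+ 0) := b :- L) refl b L))
  ... | n₀ , close = n₀ , λ n n₀≤n → ≤-from (≤-trans (x≤abs (a n - L)) (<⇒≤ (close n n₀≤n)))
    (solve 3 (λ a b L → b :- a := b :- L :- (a :- L)) refl (a n) b L)

  -- Taken as a hypothesis here, because the count that proves it rests on the parameters introduced
  -- above.
  LowerBound : Set (c ⊔ ℓ)
  LowerBound = ∀ α s N → 0# ≤ α → α ≤ 1# → 0# ≤ s → s / fromℕ (suc N) ** α ≤ 1# / fromℕ 2 →
               g (suc N) s α ≤ F logSeq (suc N) s α

  -- The deviation of g from 3 s log 2 stays bounded as s grows, even for
  -- α = 1, and 3 log 2 > 2.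
  no-weak-correlations : LowerBound → ∀ α → 0# < α → α ≤ 1# → ¬ HasWeakCorrelations logSeq α
  no-weak-correlations g≤F α 0<α α≤1 weak = contradiction too-small (<⇒≱ 14<16)
    where
    open ≤-Reasoning
    d s σ : Carrier
    d = fromℕ 3 * log (fromℕ 2) - fromℕ 2
    -- Chosen so that `d * s` is 16, above the total error 14: 12 from `12 / M` with `M ≥ 1`, 1 from
    -- the term with `N ^ α`, and 1 from the distance of `F` to `2 s`.
    s = fromℕ 16 / d
    σ = s * log (fromℕ 2)
    0<d : 0# < d
    0<d = <-from (≤-<-trans (≤-reflexive (sym (trans (*-comm _ _) (/-*-cancel (0<fromℕ 2))))) (*-monoˡ-< (0<fromℕ 2) ⅔<log2))
      (solve 1 (λ d → d :- con (+ 0) := d) refl d)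
    0≤s : 0# ≤ s
    0≤s = 0≤/ (0≤fromℕ 16) 0<d
    F-small : ∃ λ n₀ → ∀ n → n₀ ℕ.≤ n → F logSeq n s α ≤ fromℕ 2 * s + 1#
    F-small = ⟶⇒eventually-≤ (weak s 0≤s)
      (<-from 0<1 (solve 1 (λ s → con (+ 2) :* s :+ con (+ 1) :- con (+ 2) :* s := con (+ 1) :- con (+ 0)) refl s))
    large-P : ∃ λ n₀ → ∀ n → n₀ ℕ.≤ n → fromℕ 2 * σ ≤ fromℕ n ** α
    large-P = **-unbounded α 0<α (fromℕ 2 * σ)
    small-P : ∃ λ n₀ → ∀ n → n₀ ℕ.≤ n → (fromℕ 15 * (σ * σ)) / fromℕ n ** α ≤ 1#
    small-P = /**-null 0<α 0<1
    small-δ : ∃ λ n₀ → ∀ n → n₀ ℕ.≤ n → s / fromℕ n ** α ≤ 1# / fromℕ 2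
    small-δ = /**-null 0<α (0</ 0<1 (0<fromℕ 1))
    n₁ n₂ n₃ n₄ n : ℕ
    n₁ = proj₁ F-small
    n₂ = proj₁ large-P
    n₃ = proj₁ small-P
    n₄ = proj₁ small-δ
    n  = n₁ ℕ.+ (n₂ ℕ.+ (n₃ ℕ.+ n₄))
    r₁ : n₂ ℕ.+ (n₃ ℕ.+ n₄) ℕ.≤ suc n
    r₁ = ℕ.m≤n⇒m≤1+n (ℕ.m≤n+m _ n₁)
    r₂ : n₃ ℕ.+ n₄ ℕ.≤ suc n
    r₂ = ℕ.m+n≤o⇒n≤o n₂ r₁
    M : Carrier
    M = fromℕ (suc n) ** (1# - α)
    1≤M : 1# ≤ M
    1≤M = 1≤** (1≤fromℕ n) (0≤-difference α≤1)
    12/M≤12 : fromℕ 12 / M ≤ fromℕ 12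
    12/M≤12 = ≤*⇒/≤ (<-≤-trans 0<1 1≤M) (≤-respˡ-≈ (*-identityʳ _) (*-monoˡ-≤ (0≤fromℕ 12) 1≤M))
    g-lower : - (fromℕ 12 / M + (fromℕ 15 * (σ * σ)) / fromℕ (suc n) ** α) ≤ g (suc n) s α - fromℕ 3 * σ
    g-lower = proj₁ (Parameters.g-estimate (suc n) (1≤fromℕ n) s α 0≤s (proj₂ large-P (suc n) (ℕ.m+n≤o⇒m≤o n₂ r₁)))
    g-upper : g (suc n) s α ≤ fromℕ 2 * s + 1#
    g-upper = ≤-trans
      (g≤F α s n (<⇒≤ 0<α) α≤1 0≤s (proj₂ small-δ (suc n) (ℕ.m+n≤o⇒n≤o n₃ r₂)))
      (proj₂ F-small (suc n) (ℕ.m≤n⇒m≤1+n (ℕ.m≤m+n n₁ _)))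
    too-small : fromℕ 16 ≤ fromℕ 14
    too-small = ≤-respˡ-≈ (trans (*-comm d s) (/-*-cancel 0<d)) (≤-from
      (+-mono-≤ g-lower (+-mono-≤ g-upper (+-mono-≤ 12/M≤12 (proj₂ small-P (suc n) (ℕ.m+n≤o⇒m≤o n₃ r₂)))))
      (solve 5 (λ g s l p q → con (+ 14) :- (con (+ 3) :* l :- con (+ 2)) :* s
        := g :- con (+ 3) :* (s :* l) :+ (con (+ 2) :* s :+ con (+ 1) :+ (con (+ 12) :+ con (+ 1)))
           :- (:- (p :+ q) :+ (g :+ (p :+ q)))) refl
        (g (suc n) s α) s (log (fromℕ 2)) (fromℕ 12 / M) ((fromℕ 15 * (σ * σ)) / fromℕ (suc n) ** α)))
    14<16 : fromℕ 14 < fromℕ 16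
    14<16 = <-from (0<fromℕ 1) (solve 0 (con (+ 16) :- con (+ 14) := con (+ 2) :- con (+ 0)) refl)

  #closePairs≤N² : ∀ x N s α → #closePairs x N s α ℕ.≤ N ℕ.* N
  #closePairs≤N² x N s α = ℕ.≤-trans
    (List.length-filter (closePair? x N s α) (cartesianProduct (indices N) (indices N)))
    (ℕ.≤-reflexive (≡.trans (length-cartesianProduct (indices N) (indices N))
      (≡.cong₂ ℕ._*_ (List.length-applyUpTo suc N) (List.length-applyUpTo suc N))))

  -- For α = 0 already F ≤ 1 < 2 s at s = 1.
  no-weak-correlations-0 : ∀ x α → α ≈ 0# → ¬ HasWeakCorrelations x α
  no-weak-correlations-0 x α α≈0 weak = contradiction (limit-≤ 1 (weak 1# 0≤1) F≤1) (<⇒≱ 1<2)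
    where
    1<2 : 1# < fromℕ 2 * 1#
    1<2 = <-from 0<1 (solve 0 (con (+ 2) :* con (+ 1) :- con (+ 1) := con (+ 1) :- con (+ 0)) refl)
    F≤1 : ∀ n → 1 ℕ.≤ n → F x n 1# α ≤ 1#
    F≤1 (suc n) _ = ≤*⇒/≤ (0<** _ _) (begin
      fromℕ (#closePairs x (suc n) 1# α)
        ≤⟨ fromℕ-mono-≤ (#closePairs≤N² x (suc n) 1# α) ⟩
      fromℕ (suc n ℕ.* suc n)
        ≈⟨ fromℕ-* (suc n) (suc n) ⟩
      fromℕ (suc n) * fromℕ (suc n)
        ≈⟨ *-cong (**-1 (0<fromℕ n)) (**-1 (0<fromℕ n)) ⟨
      fromℕ (suc n) ** 1# * fromℕ (suc n) ** 1#
        ≈⟨ **-+ _ 1# 1# ⟨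
      fromℕ (suc n) ** (1# + 1#)
        ≈⟨ **-cong _ (trans (+-congˡ (-‿cong α≈0)) (solve 0 (con (+ 2) :- con (+ 0) := con (+ 1) :+ con (+ 1)) refl)) ⟨
      fromℕ (suc n) ** (fromℕ 2 - α)
        ≈⟨ *-identityˡ _ ⟨
      1# * fromℕ (suc n) ** (fromℕ 2 - α) ∎)
      where open ≤-Reasoning

open Combinatorics

-- The points of the sequence on the circle

module Geometry {c ℓ : Level} (R : RealNumbers c ℓ) where
  open PairCorrelation R
  open Exponential R

  log₂ : ℕ → Carrier
  log₂ n = log (fromℕ n) / log (fromℕ 2)

  log-fromℕ-* : ∀ {m n} → 1 ℕ.≤ m → 1 ℕ.≤ n → log (fromℕ (m ℕ.* n)) ≈ log (fromℕ m) + log (fromℕ n)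
  log-fromℕ-* {suc m} {suc n} _ _ = trans (log-cong (fromℕ-* (suc m) (suc n))) (log-* (0<fromℕ m) (0<fromℕ n))

  log₂-double : ∀ n → 1 ℕ.≤ n → log₂ (2 ℕ.* n) ≈ 1# + log₂ n
  log₂-double n 1≤n = trans (*-congʳ (log-fromℕ-* {2} (ℕ.s≤s ℕ.z≤n) 1≤n)) (trans (distribʳ _ _ _)
    (+-congʳ (⁻¹-inverseʳ _ (0<⇒≉0 0<log2))))

  log₂-2^* : ∀ e n → 1 ℕ.≤ n → log₂ (2 ℕ.^ e ℕ.* n) ≈ fromℕ e + log₂ n
  log₂-2^* zero    n 1≤n = trans (reflexive (≡.cong log₂ (ℕ.*-identityˡ n))) (sym (+-identityˡ _))
  log₂-2^* (suc e) n 1≤n = trans (reflexive (≡.cong log₂ (ℕ.*-assoc 2 (2 ℕ.^ e) n)))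
    (trans (log₂-double (2 ℕ.^ e ℕ.* n) (ℕ.*-mono-≤ (ℕ.m^n>0 2 e) 1≤n))
      (trans (+-congˡ (log₂-2^* e n 1≤n)) (sym (+-assoc _ _ _))))

  logSeq-oddIndex : ∀ n → 1 ℕ.≤ n → ∃ λ z → logSeq (oddIndex n) ≈ log₂ n - fromℤ z
  logSeq-oddIndex n 1≤n with oddIndex-spec n 1≤n
  ... | e , n≡ = + e ℤ.+ ⌊ y ⌋ , (begin-equality
    y - fromℤ ⌊ y ⌋
      ≈⟨ solve 3 (λ y z e → y :- z := e :+ y :- (e :+ z)) refl y (fromℤ ⌊ y ⌋) (fromℕ e) ⟩
    fromℕ e + y - (fromℕ e + fromℤ ⌊ y ⌋)
      ≈⟨ +-cong (trans (reflexive (≡.cong log₂ n≡)) (log₂-2^* e o 1≤o)) (-‿cong (fromℤ-+ (+ e) ⌊ y ⌋)) ⟨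
    log₂ n - fromℤ (+ e ℤ.+ ⌊ y ⌋) ∎)
    where
    open ≤-Reasoning
    o : ℕ
    o = 2 ℕ.* oddIndex n ℕ.∸ 1
    y : Carrier
    y = log₂ o
    1≤o : 1 ℕ.≤ o
    1≤o = ℕ.∸-monoˡ-≤ {2} 1 (ℕ.*-monoʳ-≤ 2 (1≤oddIndex n 1≤n))

  log₂-close : ∀ δ {n p} → 1 ℕ.≤ n → n ℕ.≤ p → fromℕ p ≤ fromℕ 2 ** δ * fromℕ n →
               (log₂ n ≤ log₂ p) × (log₂ p - log₂ n ≤ δ)
  log₂-close δ {suc n} {p} _ n≤p p≤qn = /-monoˡ-≤ 0<log2 (log-mono-≤ (0<fromℕ n) (fromℕ-mono-≤ n≤p)) ,
    (begin
      log₂ p - log₂ (suc n)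
        ≈⟨ solve 3 (λ a b i → a :* i :- b :* i := (a :- b) :* i) refl (log (fromℕ p)) (log (fromℕ (suc n))) (log (fromℕ 2) ⁻¹) ⟩
      (log (fromℕ p) - log (fromℕ (suc n))) / log (fromℕ 2)
        ≤⟨ ≤*⇒/≤ 0<log2 (≤-from (begin
          log (fromℕ p)
            ≤⟨ log-mono-≤ (<-≤-trans (0<fromℕ n) (fromℕ-mono-≤ n≤p)) p≤qn ⟩
          log (fromℕ 2 ** δ * fromℕ (suc n))
            ≈⟨ log-* (0<** _ _) (0<fromℕ n) ⟩
          log (fromℕ 2 ** δ) + log (fromℕ (suc n))
            ≈⟨ +-congʳ (log-exp _) ⟩
          δ * log (fromℕ 2) + log (fromℕ (suc n)) ∎)
          (solve 3 (λ a b d → d :- (a :- b) := d :+ b :- a) refl (log (fromℕ p)) (log (fromℕ (suc n))) (δ * log (fromℕ 2)))) ⟩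
      δ ∎)
    where open ≤-Reasoning

  -- The second alternative sees m one full turn further, as 2 m.
  RightNeighbour : Carrier → ℕ → ℕ → Set ℓ
  RightNeighbour q n m = (n ℕ.< m × fromℕ m ≤ q * fromℕ n)
                       ⊎ (n ℕ.< 2 ℕ.* m × fromℕ (2 ℕ.* m) ≤ q * fromℕ n)

  rightNeighbour⇒close : ∀ δ {n m} → 1 ℕ.≤ n → 1 ℕ.≤ m → RightNeighbour (fromℕ 2 ** δ) n m →
    (‖ logSeq (oddIndex n) - logSeq (oddIndex m) ‖ ≤ δ) × (‖ logSeq (oddIndex m) - logSeq (oddIndex n) ‖ ≤ δ)
  rightNeighbour⇒close δ {n} {m} 1≤n 1≤m right =
    both (logSeq-oddIndex n 1≤n) (logSeq-oddIndex m 1≤m) (lift right)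
    where
    lift : RightNeighbour (fromℕ 2 ** δ) n m →
           ∃ λ i → (log₂ n ≤ log₂ m + fromℤ i) × (log₂ m + fromℤ i - log₂ n ≤ δ)
    lift (inj₁ (n<m , m≤qn)) with log₂-close δ 1≤n (ℕ.<⇒≤ n<m) m≤qn
    ... | n≤m , m-n≤δ = + 0 , ≤-respʳ-≈ (sym (+-identityʳ _)) n≤m , ≤-respˡ-≈ (+-congʳ (sym (+-identityʳ _))) m-n≤δ
    lift (inj₂ (n<2m , 2m≤qn)) with log₂-close δ 1≤n (ℕ.<⇒≤ n<2m) 2m≤qn
    ... | n≤2m , 2m-n≤δ = + 1 , ≤-respʳ-≈ 2m≈ n≤2m , ≤-respˡ-≈ (+-congʳ 2m≈) 2m-n≤δ
      where
      2m≈ : log₂ (2 ℕ.* m) ≈ log₂ m + fromℤ (+ 1)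
      2m≈ = trans (log₂-double m 1≤m) (trans (+-comm _ _) (+-congˡ (sym (+-identityʳ 1#))))
    both : (∃ λ z → logSeq (oddIndex n) ≈ log₂ n - fromℤ z) → (∃ λ z → logSeq (oddIndex m) ≈ log₂ m - fromℤ z) →
           (∃ λ i → (log₂ n ≤ log₂ m + fromℤ i) × (log₂ m + fromℤ i - log₂ n ≤ δ)) →
           (‖ logSeq (oddIndex n) - logSeq (oddIndex m) ‖ ≤ δ) × (‖ logSeq (oddIndex m) - logSeq (oddIndex n) ‖ ≤ δ)
    both (z , xₙ≈) (z′ , xₘ≈) (i , n≤m , m-n≤δ) =
        ‖‖-≤-below j (≤-from n≤m below) (≤-respˡ-≈ (sym below) m-n≤δ)
      , ‖‖-≤-above (ℤ.- j) (≤-from n≤m above) (≤-respˡ-≈ (sym above) m-n≤δ)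
      where
      -- Chosen so that `j` minus the difference of the two points is exactly the distance
      -- `log₂ m + i - log₂ n` on the line; `- j` does the same for the opposite order.
      j : ℤ
      j = i ℤ.+ z′ ℤ.+ ℤ.- z
      j≈ : fromℤ j ≈ fromℤ i + fromℤ z′ - fromℤ z
      j≈ = trans (fromℤ-+ (i ℤ.+ z′) (ℤ.- z)) (+-cong (fromℤ-+ i z′) (fromℤ-neg z))
      -j≈ : fromℤ (ℤ.- j) ≈ - (fromℤ i + fromℤ z′ - fromℤ z)
      -j≈ = trans (fromℤ-neg j) (-‿cong j≈)
      xₙ-xₘ≈ : logSeq (oddIndex n) - logSeq (oddIndex m) ≈ log₂ n - fromℤ z - (log₂ m - fromℤ z′)
      xₙ-xₘ≈ = +-cong xₙ≈ (-‿cong xₘ≈)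
      xₘ-xₙ≈ : logSeq (oddIndex m) - logSeq (oddIndex n) ≈ log₂ m - fromℤ z′ - (log₂ n - fromℤ z)
      xₘ-xₙ≈ = +-cong xₘ≈ (-‿cong xₙ≈)
      below : fromℤ j - (logSeq (oddIndex n) - logSeq (oddIndex m)) ≈ log₂ m + fromℤ i - log₂ n
      below = trans (+-cong j≈ (-‿cong xₙ-xₘ≈))
        (solve 5 (λ n m z z′ i → i :+ z′ :- z :- (n :- z :- (m :- z′)) := m :+ i :- n) refl
          (log₂ n) (log₂ m) (fromℤ z) (fromℤ z′) (fromℤ i))
      above : logSeq (oddIndex m) - logSeq (oddIndex n) - fromℤ (ℤ.- j) ≈ log₂ m + fromℤ i - log₂ n
      above = trans (+-cong xₘ-xₙ≈ (-‿cong -j≈))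
        (solve 5 (λ n m z z′ i → m :- z′ :- (n :- z) :- :- (i :+ z′ :- z) := m :+ i :- n) refl
          (log₂ n) (log₂ m) (fromℤ z) (fromℤ z′) (fromℤ i))

  -- Stepping right from `n` to `m` and on to `n` again makes at least a full turn, while each step
  -- is at most half a turn. Both would be exactly half a turn, that is `m * m ≡ 2 * (n * n)` or the
  -- reverse, which the irrationality of √2 forbids.
  rightNeighbour-asym : ∀ {q n m} → 0# ≤ q → q * q ≤ fromℕ 2 → 1 ℕ.≤ n → 1 ℕ.≤ m →
                        RightNeighbour q n m → ¬ RightNeighbour q m n
  rightNeighbour-asym {q} 0≤q q²≤2 1≤n 1≤m = cases 1≤n 1≤m
    where
    square-≤ : ∀ {n m} → fromℕ m ≤ q * fromℕ n → m ℕ.* m ℕ.≤ 2 ℕ.* (n ℕ.* n)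
    square-≤ {n} {m} m≤qn = fromℕ-cancel-≤ (begin
      fromℕ (m ℕ.* m)                     ≈⟨ fromℕ-* m m ⟩
      fromℕ m * fromℕ m                   ≤⟨ *-mono-≤ (0≤fromℕ m) m≤qn (0≤fromℕ m) m≤qn ⟩
      q * fromℕ n * (q * fromℕ n)         ≈⟨ solve 2 (λ q n → q :* n :* (q :* n) := q :* q :* (n :* n)) refl q (fromℕ n) ⟩
      q * q * (fromℕ n * fromℕ n)         ≤⟨ *-monoʳ-≤ (0≤x² (fromℕ n)) q²≤2 ⟩
      fromℕ 2 * (fromℕ n * fromℕ n)       ≈⟨ *-congˡ (fromℕ-* n n) ⟨
      fromℕ 2 * fromℕ (n ℕ.* n)           ≈⟨ fromℕ-* 2 (n ℕ.* n) ⟨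
      fromℕ (2 ℕ.* (n ℕ.* n))             ∎)
      where open ≤-Reasoning
    square-≥ : ∀ {n m} → fromℕ (2 ℕ.* m) ≤ q * fromℕ n → 2 ℕ.* (m ℕ.* m) ℕ.≤ n ℕ.* n
    square-≥ {n} {m} 2m≤qn = ℕ.*-cancelˡ-≤ 2 (≡.subst (ℕ._≤ 2 ℕ.* (n ℕ.* n))
      (≡.trans (ℕ.*-assoc 2 m (2 ℕ.* m)) (≡.cong (2 ℕ.*_)
        (≡.trans (≡.sym (ℕ.*-assoc m 2 m)) (≡.trans (≡.cong (ℕ._* m) (ℕ.*-comm m 2)) (ℕ.*-assoc 2 m m)))))
      (square-≤ {n} {2 ℕ.* m} 2m≤qn))
    √2-ratio : ∀ {n m} → 1 ℕ.≤ m → fromℕ m ≤ q * fromℕ n → fromℕ (2 ℕ.* n) ≤ q * fromℕ m → ⊥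
    √2-ratio {n} {m} 1≤m m≤qn 2n≤qm =
      ℕ.n>0⇒n≢0 1≤m (√2-irrational m n (ℕ.≤-antisym (square-≤ {n} {m} m≤qn) (square-≥ {m} {n} 2n≤qm)))
    cases : ∀ {n m} → 1 ℕ.≤ n → 1 ℕ.≤ m → RightNeighbour q n m → ¬ RightNeighbour q m n
    cases 1≤n 1≤m (inj₁ (n<m , _)) (inj₁ (m<n , _)) = ℕ.<-asym n<m m<n
    cases {n} {m} 1≤n 1≤m (inj₁ (_ , m≤qn)) (inj₂ (_ , 2n≤qm)) = √2-ratio {n} {m} 1≤m m≤qn 2n≤qm
    cases {n} {m} 1≤n 1≤m (inj₂ (_ , 2m≤qn)) (inj₁ (_ , n≤qm)) = √2-ratio {m} {n} 1≤n n≤qm 2m≤qn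
    cases {suc n} {m} 1≤n 1≤m (inj₂ (_ , 2m≤qn)) (inj₂ (_ , 2n≤qm)) = ℕ.<⇒≱
      (ℕ.m<m+n (suc n ℕ.* suc n) (ℕ.s≤s ℕ.z≤n))
      (ℕ.≤-trans (square-≥ {m} {suc n} 2n≤qm) (ℕ.≤-trans (ℕ.m≤m+n (m ℕ.* m) _) (square-≥ {suc n} {m} 2m≤qn)))

-- Counting close pairs

module Counting {c ℓ : Level} (R : RealNumbers c ℓ) where
  open PairCorrelation R
  open Exponential R
  open Geometry R
  open Asymptotics R

  module _ (N : ℕ) (1≤N : 1 ℕ.≤ N) (s α : Carrier) (0≤s : 0# ≤ s)
           (δ≤½ : s / fromℕ N ** α ≤ 1# / fromℕ 2) where

    private
      1≤N′ : 1# ≤ fromℕ N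
      1≤N′ = ≤-respˡ-≈ (+-identityʳ 1#) (fromℕ-mono-≤ 1≤N)

    open Parameters N 1≤N′ s α 0≤s

    private
      q : Carrier
      q = fromℕ 2 ** δ

      0≤q : 0# ≤ q
      0≤q = <⇒≤ (0<** (fromℕ 2) δ)

      q²≤2 : q * q ≤ fromℕ 2
      q²≤2 = begin
        q * q               ≈⟨ exp-+ t t ⟨
        exp (t + t)         ≤⟨ exp-mono-≤ (begin
          t + t                          ≈⟨ solve 2 (λ d l → d :* l :+ d :* l := d :* con (+ 2) :* l) refl δ (log (fromℕ 2)) ⟩
          δ * fromℕ 2 * log (fromℕ 2)    ≤⟨ *-monoʳ-≤ (<⇒≤ 0<log2) (*-monoʳ-≤ (0≤fromℕ 2) δ≤½) ⟩
          1# / fromℕ 2 * fromℕ 2 * log (fromℕ 2) ≈⟨ *-congʳ (/-*-cancel (0<fromℕ 1)) ⟩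
          1# * log (fromℕ 2)             ≈⟨ *-identityˡ _ ⟩
          log (fromℕ 2)                  ∎) ⟩
        exp (log (fromℕ 2)) ≈⟨ exp-log _ (0<fromℕ 1) ⟩
        fromℕ 2             ∎
        where open ≤-Reasoning

      c<1 : c′ < 1#
      c<1 = ≰⇒> λ 1≤c → contradiction
        (≤-trans (*-mono-≤ (0≤fromℕ 2) (2≤q 1≤c) (0≤fromℕ 2) (2≤q 1≤c)) q²≤2)
        (<⇒≱ (<-from (0<fromℕ 1) (solve 0 (con (+ 2) :* con (+ 2) :- con (+ 2) := con (+ 2) :- con (+ 0)) refl)))
        where
        2≤q : 1# ≤ c′ → fromℕ 2 ≤ q
        2≤q 1≤c = ≤-from 1≤c (solve 1 (λ q → q :- con (+ 2) := q :- con (+ 1) :- con (+ 1)) refl q)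

      -- `k≤nc` is `n + k ≤ (1 + c′) n` and `wraps` is `2 (n + k - N) ≤ (1 + c′) n`, closeness
      -- before and after the turn. Both are demanded of every step, so that the turn at `2 N` need
      -- not be located while counting; before the turn the second follows from the first.
      record Good (n k : ℕ) : Set ℓ where
        field
          N≤n   : N ℕ.≤ n
          n<2N  : n ℕ.< N ℕ.+ N
          1≤k   : 1 ℕ.≤ k
          k<N   : k ℕ.< N
          k≤nc  : fromℕ k ≤ fromℕ n * c′
          wraps : fromℕ n + fromℕ k + fromℕ k - fromℕ N - fromℕ N ≤ fromℕ n * c′

        1≤n : 1 ℕ.≤ n
        1≤n = ℕ.≤-trans 1≤N N≤n

        N≤right : N ℕ.≤ rightOf N n k
        N≤right with rightOf-cases N n k
        ... | inj₁ (_ , r)  = ≡.subst (N ℕ.≤_) (≡.sym r) (ℕ.≤-trans N≤n (ℕ.m≤m+n n k))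
        ... | inj₂ (le , r) = ℕ.+-cancelʳ-≤ N _ _ (≡.subst (N ℕ.+ N ℕ.≤_) (≡.sym r) le)

        right<2N : rightOf N n k ℕ.< N ℕ.+ N
        right<2N with rightOf-cases N n k
        ... | inj₁ (lt , r) = ≡.subst (ℕ._< N ℕ.+ N) (≡.sym r) lt
        ... | inj₂ (_ , r)  = ℕ.+-cancelʳ-< N _ _ (≡.subst (ℕ._< N ℕ.+ N ℕ.+ N) (≡.sym r) (ℕ.+-mono-< n<2N k<N))

        right : RightNeighbour q n (rightOf N n k)
        right with rightOf N n k | rightOf-cases N n k
        ... | _ | inj₁ (_ , ≡.refl) = inj₁ (ℕ.m<m+n n 1≤k , ≤-from k≤nc
          (trans (+-congˡ (-‿cong (fromℕ-+ n k)))
            (solve 3 (λ q n k → q :* n :- (n :+ k) := n :* (q :- con (+ 1)) :- k) refl q (fromℕ n) (fromℕ k))))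
        ... | m | inj₂ (le , r) = inj₂
          ( ℕ.+-cancelʳ-< (N ℕ.+ N) n (2 ℕ.* m)
              (ℕ.<-≤-trans (ℕ.+-monoʳ-< n (ℕ.≤-<-trans le (ℕ.m<m+n (n ℕ.+ k) 1≤k)))
                (ℕ.≤-reflexive (≡.trans (regroup-left n k) (≡.trans (≡.cong₂ ℕ._+_ (≡.sym r) (≡.sym r)) (regroup-right m N)))))
          , ≤-from wraps (trans
              (+-congˡ (-‿cong (trans (fromℕ-* 2 m) (*-congˡ m≈))))
              (solve 4 (λ q n k N → q :* n :- con (+ 2) :* (n :+ k :- N) := n :* (q :- con (+ 1)) :- (n :+ k :+ k :- N :- N))
                refl q (fromℕ n) (fromℕ k) (fromℕ N))))
          where
          regroup-left : ∀ n k → n ℕ.+ (n ℕ.+ k ℕ.+ k) ≡ (n ℕ.+ k) ℕ.+ (n ℕ.+ k)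
          regroup-left = solve-∀
          regroup-right : ∀ m N → (m ℕ.+ N) ℕ.+ (m ℕ.+ N) ≡ 2 ℕ.* m ℕ.+ (N ℕ.+ N)
          regroup-right = solve-∀
          m≈ : fromℕ m ≈ fromℕ n + fromℕ k - fromℕ N
          m≈ = ≈-from (trans (sym (fromℕ-+ m N)) (trans (reflexive (≡.cong fromℕ r)) (fromℕ-+ n k)))
            (solve 4 (λ m n k N → m :- (n :+ k :- N) := m :+ N :- (n :+ k)) refl (fromℕ m) (fromℕ n) (fromℕ k) (fromℕ N))

      indexPair : ℕ × ℕ → ℕ × ℕ
      indexPair (n , k) = oddIndex n , oddIndex (rightOf N n k)

      open Good

      -- Applied twice to the same step, this also shows that no point is its own right neighbour.
      good-asym : ∀ {n k n′ k′} → Good n k → Good n′ k′ → n ≡ rightOf N n′ k′ → n′ ≢ rightOf N n k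
      good-asym {n} {k} {n′} {k′} good good′ eq eq′ =
        rightNeighbour-asym 0≤q q²≤2 (1≤n good) (1≤n good′)
          (≡.subst (RightNeighbour q n) (≡.sym eq′) (right good))
          (≡.subst (RightNeighbour q n′) (≡.sym eq) (right good′))

      oddIndex-inj : ∀ {m n} → N ℕ.≤ m → m ℕ.< N ℕ.+ N → N ℕ.≤ n → n ℕ.< N ℕ.+ N → oddIndex m ≡ oddIndex n → m ≡ n
      oddIndex-inj = oddIndex-injective 1≤N

      indexPair-injective : ∀ {n k n′ k′} → Good n k → Good n′ k′ →
                            indexPair (n , k) ≡ indexPair (n′ , k′) → (n , k) ≡ (n′ , k′)
      indexPair-injective {n} good good′ eq
        with oddIndex-inj (N≤n good) (n<2N good) (N≤n good′) (n<2N good′) (proj₁ (,-injective eq))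
      ... | ≡.refl = ≡.cong (n ,_) (rightOf-injective n (k<N good) (k<N good′)
        (oddIndex-inj (N≤right good) (right<2N good) (N≤right good′) (right<2N good′) (proj₂ (,-injective eq))))

      indexPair-≢-swap : ∀ {n k n′ k′} → Good n k → Good n′ k′ → indexPair (n , k) ≢ swap (indexPair (n′ , k′))
      indexPair-≢-swap good good′ eq = good-asym good good′
        (oddIndex-inj (N≤n good) (n<2N good) (N≤right good′) (right<2N good′) (proj₁ (,-injective eq)))
        (≡.sym (oddIndex-inj (N≤right good) (right<2N good) (N≤n good′) (n<2N good′) (proj₂ (,-injective eq))))

      ∈-indices : ∀ {n} → N ℕ.≤ n → n ℕ.< N ℕ.+ N → oddIndex n ∈ indices N
      ∈-indices {n} N≤n n<2N = positive (1≤oddIndex n 0<n) (oddIndex-≤ N n 0<n n<2N)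
        where
        0<n : 1 ℕ.≤ n
        0<n = ℕ.≤-trans 1≤N N≤n
        positive : ∀ {i} → 1 ℕ.≤ i → i ℕ.≤ N → i ∈ indices N
        positive {suc i} _ i<N = ∈-applyUpTo⁺ suc i<N

      closePairs : List (ℕ × ℕ)
      closePairs = filter (closePair? logSeq N s α) (cartesianProduct (indices N) (indices N))

      good⇒∈closePairs : ∀ {n k} → Good n k → (indexPair (n , k) ∈ closePairs) × (swap (indexPair (n , k)) ∈ closePairs)
      good⇒∈closePairs {n} {k} good =
          ∈-filter⁺ (closePair? logSeq N s α) (∈-cartesianProduct⁺ i∈ j∈) (i≢j , proj₁ close)
        , ∈-filter⁺ (closePair? logSeq N s α) (∈-cartesianProduct⁺ j∈ i∈) ((λ eq → i≢j (≡.sym eq)) , proj₂ close)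
        where
        i∈ : oddIndex n ∈ indices N
        i∈ = ∈-indices (N≤n good) (n<2N good)
        j∈ : oddIndex (rightOf N n k) ∈ indices N
        j∈ = ∈-indices (N≤right good) (right<2N good)
        i≢j : oddIndex n ≢ oddIndex (rightOf N n k)
        i≢j eq = good-asym good good n≡right n≡right
          where
          n≡right : n ≡ rightOf N n k
          n≡right = oddIndex-inj (N≤n good) (n<2N good) (N≤right good) (right<2N good) eq
        close : (‖ logSeq (oddIndex n) - logSeq (oddIndex (rightOf N n k)) ‖ ≤ δ)
              × (‖ logSeq (oddIndex (rightOf N n k)) - logSeq (oddIndex n) ‖ ≤ δ)
        close = rightNeighbour⇒close δ (1≤n good) (ℕ.≤-trans 1≤N (N≤right good)) (right good)

      -- Each step gives a pair of indices and its swap. Asymmetry of the steps keeps the two image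
      -- lists disjoint, and neither has repetitions, so both lengths count.
      twice-good≤#closePairs : ∀ {L} → Unique L → (∀ {n k} → (n , k) ∈ L → Good n k) →
                               length L ℕ.+ length L ℕ.≤ #closePairs logSeq N s α
      twice-good≤#closePairs {L} uniq good = ≡.subst (ℕ._≤ length closePairs)
        (≡.trans (List.length-++ (map indexPair L)) (≡.cong₂ ℕ._+_ (List.length-map indexPair L) (List.length-map (swap ∘ indexPair) L)))
        (length-unique-≤
          (Unique.++⁺ (unique-map uniq (λ x∈ y∈ → indexPair-injective (good x∈) (good y∈)))
                      (unique-map uniq (λ x∈ y∈ eq → indexPair-injective (good x∈) (good y∈) (≡.cong swap eq)))
                      disjoint)
          included)
        where
        disjoint : ∀ {v} → ¬ (v ∈ map indexPair L × v ∈ map (swap ∘ indexPair) L)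
        disjoint (v∈ , v∈′) with ∈-map⁻ indexPair v∈ | ∈-map⁻ (swap ∘ indexPair) v∈′
        ... | _ , x∈ , eq | _ , y∈ , eq′ = indexPair-≢-swap (good x∈) (good y∈) (≡.trans (≡.sym eq) eq′)
        included : ∀ {v} → v ∈ map indexPair L ++ map (swap ∘ indexPair) L → v ∈ closePairs
        included v∈ with ∈-++⁻ (map indexPair L) v∈
        ... | inj₁ v∈ˡ with ∈-map⁻ indexPair v∈ˡ
        ...   | _ , x∈ , ≡.refl = proj₁ (good⇒∈closePairs (good x∈))
        included v∈ | inj₂ v∈ʳ with ∈-map⁻ (swap ∘ indexPair) v∈ʳ
        ... | _ , x∈ , ≡.refl = proj₂ (good⇒∈closePairs (good x∈))

      γ : Carrier
      γ = c′ ⁻¹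

      ∣⌊_⌋∣ : Carrier → ℕ
      ∣⌊ x ⌋∣ = ℤ.∣ ⌊ x ⌋ ∣

      fromℤ-⌊⌋ : ∀ {x} → 0# ≤ x → fromℤ ⌊ x ⌋ ≈ fromℕ ∣⌊ x ⌋∣
      fromℤ-⌊⌋ {x} 0≤x = by-nonneg (⌊⌋-nonneg 0≤x)
        where
        by-nonneg : (∃ λ n → ⌊ x ⌋ ≡ + n) → fromℤ ⌊ x ⌋ ≈ fromℕ ∣⌊ x ⌋∣
        by-nonneg (n , eq) = reflexive (≡.trans (≡.cong fromℤ eq) (≡.cong (λ i → fromℕ ℤ.∣ i ∣) (≡.sym eq)))

      ∣⌊⌋∣-lower : ∀ {x} → 0# ≤ x → fromℕ ∣⌊ x ⌋∣ ≤ x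
      ∣⌊⌋∣-lower {x} 0≤x = ≤-respˡ-≈ (fromℤ-⌊⌋ 0≤x) (⌊⌋-lower x)

      ∣⌊⌋∣-upper : ∀ {x} → 0# ≤ x → x < 1# + fromℕ ∣⌊ x ⌋∣
      ∣⌊⌋∣-upper {x} 0≤x = <-≤-trans (⌊⌋-upper x) (≤-reflexive (trans (+-congʳ (fromℤ-⌊⌋ 0≤x)) (+-comm _ _)))

      a : ℕ → ℕ
      a k = ∣⌊ fromℕ k / c′ ⌋∣

      kx kn : ℕ
      kx = ∣⌊ u ⌋∣
      kn = ∣⌊ v ⌋∣

      -- The decision is an argument of its own, so that a later case split on it computes
      -- `block k`.
      block′ : ∀ k → Dec (k ℕ.≤ kn) → List ℕ
      block′ k (yes _) = range N (N ℕ.+ N)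
      -- Ranges are half open: this is `a k < n ≤ 2 N - k`, and the two `suc` cancel in the length.
      block′ k (no _)  = range (suc (a k)) (suc (N ℕ.+ N ℕ.∸ k))

      -- Numbers n in [N , 2N) whose k-th right neighbour is close; for
      -- k > Kmin, those with k / C < n ≤ 2N - k.
      block : ℕ → List ℕ
      block k = block′ k (k ℕ.≤? kn)

      block-unique : ∀ k → Unique (block k)
      block-unique k with k ℕ.≤? kn
      ... | yes _ = range-unique N (N ℕ.+ N)
      ... | no _  = range-unique (suc (a k)) (suc (N ℕ.+ N ℕ.∸ k))

      -- `u = 2 N c / (1 + c)` is below `N` because `c < 1`. Offsets below `N` are what makes the
      -- right neighbours of a point distinct.
      kx<N : kx ℕ.< N
      kx<N = fromℕ-cancel-< (≤-<-trans (∣⌊⌋∣-lower 0≤u) (*-cancelˡ-< (1# + c′) 0<1+c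
        (<-from (*-monoˡ-< 0<N′ c<1) (trans
          (+-congˡ (-‿cong (trans (*-comm _ _) u-eq)))
          (solve 2 (λ c N → (con (+ 1) :+ c) :* N :- con (+ 2) :* (N :* c) := N :* con (+ 1) :- N :* c) refl c′ N′)))))

      kn≤kx : kn ℕ.≤ kx
      kn≤kx = fromℕ-cancel-≤ (≤-respˡ-≈ (fromℤ-⌊⌋ 0≤v) (≤-respʳ-≈ (fromℤ-⌊⌋ 0≤u) (fromℤ-mono-≤ (⌊⌋-mono-≤ v≤u))))
        where
        v≤u : v ≤ u
        v≤u = *-cancelˡ-≤ (1# + c′) 0<1+c (≤-from (*-monoˡ-≤ 0≤v (<⇒≤ c<1)) (trans
          (+-congʳ (trans (*-comm _ _) u-eq))
          (solve 2 (λ c v → con (+ 2) :* v :- (con (+ 1) :+ c) :* v := v :* con (+ 1) :- v :* c) refl c′ v)))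

      module _ (0<c : 0# < c′) where
        good-near : ∀ {n k} → 1 ℕ.≤ k → k ℕ.≤ kx → k ℕ.≤ kn → N ℕ.≤ n → n ℕ.< N ℕ.+ N → Good n k
        good-near {n} {k} 1≤k k≤kx k≤kn N≤n n<2N = record
          { N≤n = N≤n ; n<2N = n<2N ; 1≤k = 1≤k ; k<N = ℕ.≤-<-trans k≤kx kx<N
          ; k≤nc = ≤-trans k≤v (*-monoʳ-≤ 0≤c (fromℕ-mono-≤ N≤n))
          -- The sum of `2 k ≤ 2 N c` and `n (1 - c) ≤ 2 N (1 - c)`.
          ; wraps = ≤-from (+-mono-≤ (+-mono-≤ k≤v k≤v) (*-monoʳ-≤ (0≤-difference (<⇒≤ c<1)) n≤2N))
              (solve 4 (λ n k N c → n :* c :- (n :+ k :+ k :- N :- N) :=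
                 N :* c :+ N :* c :+ (N :+ N) :* (con (+ 1) :- c) :- (k :+ k :+ n :* (con (+ 1) :- c))) refl (fromℕ n) (fromℕ k) N′ c′)
          }
          where
          k≤v : fromℕ k ≤ v
          k≤v = ≤-trans (fromℕ-mono-≤ k≤kn) (∣⌊⌋∣-lower 0≤v)
          n≤2N : fromℕ n ≤ N′ + N′
          n≤2N = ≤-respʳ-≈ (fromℕ-+ N N) (fromℕ-mono-≤ (ℕ.<⇒≤ n<2N))

        -- Here `k > N c`, so `k ≤ n c` already forces `n > N`. Since `n ≤ 2 N - k`, the step ends
        -- before the turn or exactly on it, and `wraps` follows from `k≤nc`.
        good-far : ∀ {n k} → 1 ℕ.≤ k → k ℕ.≤ kx → kn ℕ.< k → a k ℕ.< n → n ℕ.≤ N ℕ.+ N ℕ.∸ k → Good n k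
        good-far {n} {k} 1≤k k≤kx kn<k ak<n n≤2N∸k = record
          { N≤n = ℕ.<⇒≤ (fromℕ-cancel-< (*-cancelˡ-< c′ 0<c (<-from (<-≤-trans v<k k≤nc′)
              (solve 3 (λ n N c → c :* n :- c :* N := n :* c :- N :* c) refl (fromℕ n) N′ c′))))
          ; n<2N = ℕ.<-≤-trans (ℕ.m<m+n n 1≤k) n+k≤2N ; 1≤k = 1≤k ; k<N = k<N′
          ; k≤nc = k≤nc′
          ; wraps = ≤-from (+-mono-≤ k≤nc′ n+k≤2N′)
              (solve 4 (λ n k N z → z :- (n :+ k :+ k :- N :- N) := z :+ (N :+ N) :- (k :+ (n :+ k))) refl (fromℕ n) (fromℕ k) N′ (fromℕ n * c′))
          }
          where
          k<N′ : k ℕ.< N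
          k<N′ = ℕ.≤-<-trans k≤kx kx<N
          k≤nc′ : fromℕ k ≤ fromℕ n * c′
          k≤nc′ = /≤⇒≤* 0<c (≤-trans (<⇒≤ (∣⌊⌋∣-upper (0≤/ (0≤fromℕ k) 0<c))) (fromℕ-mono-≤ ak<n))
          v<k : v < fromℕ k
          v<k = <-≤-trans (∣⌊⌋∣-upper 0≤v) (fromℕ-mono-≤ kn<k)
          n+k≤2N : n ℕ.+ k ℕ.≤ N ℕ.+ N
          n+k≤2N = ℕ.≤-trans (ℕ.+-monoˡ-≤ k n≤2N∸k)
            (ℕ.≤-reflexive (ℕ.m∸n+n≡m (ℕ.≤-trans (ℕ.<⇒≤ k<N′) (ℕ.m≤m+n N N))))
          n+k≤2N′ : fromℕ n + fromℕ k ≤ N′ + N′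
          n+k≤2N′ = ≤-respˡ-≈ (fromℕ-+ n k) (≤-respʳ-≈ (fromℕ-+ N N) (fromℕ-mono-≤ n+k≤2N))

        good-block : ∀ {n k} → 1 ℕ.≤ k → k ℕ.≤ kx → n ∈ block k → Good n k
        good-block {n} {k} 1≤k k≤kx n∈ with k ℕ.≤? kn
        ... | yes k≤kn with ∈-range⁻ N (N ℕ.+ N) n∈
        ...   | N≤n , n<2N = good-near 1≤k k≤kx k≤kn N≤n n<2N
        good-block {n} {k} 1≤k k≤kx n∈ | no k≰kn with ∈-range⁻ (suc (a k)) (suc (N ℕ.+ N ℕ.∸ k)) n∈
        ... | ak<n , ℕ.s≤s n≤2N∸k = good-far 1≤k k≤kx (ℕ.≰⇒> k≰kn) ak<n n≤2N∸k

        length-block-near : ∀ {k} → k ℕ.≤ kn → length (block k) ≡ N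
        length-block-near {k} k≤kn with k ℕ.≤? kn
        ... | yes _   = ≡.trans (List.length-applyUpTo (N ℕ.+_) (N ℕ.+ N ℕ.∸ N)) (ℕ.m+n∸m≡n N N)
        ... | no k≰kn = contradiction k≤kn k≰kn

        -- Truncated subtraction never falls below the true difference, so the bound survives even
        -- where the block is empty.
        length-block-far : ∀ {k} → kn ℕ.< k → N′ + N′ - fromℕ k - fromℕ k * γ ≤ fromℕ (length (block k))
        length-block-far {k} kn<k with k ℕ.≤? kn
        ... | yes k≤kn = contradiction k≤kn (ℕ.<⇒≱ kn<k)
        ... | no _     = begin
          N′ + N′ - fromℕ k - fromℕ k / c′
            ≤⟨ +-mono-≤ (≤-trans (≤-reflexive (+-congʳ (sym (fromℕ-+ N N)))) (fromℕ-∸ (N ℕ.+ N) k))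
                        (neg-mono-≤ (∣⌊⌋∣-lower (0≤/ (0≤fromℕ k) 0<c))) ⟩
          fromℕ (N ℕ.+ N ℕ.∸ k) - fromℕ (a k)
            ≤⟨ fromℕ-∸ (N ℕ.+ N ℕ.∸ k) (a k) ⟩
          fromℕ (N ℕ.+ N ℕ.∸ k ℕ.∸ a k)
            ≈⟨ reflexive (≡.cong fromℕ (List.length-applyUpTo (suc (a k) ℕ.+_) (N ℕ.+ N ℕ.∸ k ℕ.∸ a k))) ⟨
          fromℕ (length (range (suc (a k)) (suc (N ℕ.+ N ℕ.∸ k)))) ∎
          where open ≤-Reasoning

        near-count : ∀ j → j ℕ.≤ kn → N ℕ.* j ≡ length (pairsUpTo block j)
        near-count zero    _    = ℕ.*-zeroʳ N
        near-count (suc j) j<kn = ≡.trans (ℕ.*-suc N j) (≡.trans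
          (≡.cong₂ ℕ._+_ (≡.sym (length-block-near j<kn)) (near-count j (ℕ.<⇒≤ j<kn)))
          (≡.sym (length-pairsUpTo-suc block j)))

        pronic : Carrier → Carrier
        pronic x = x * (x + 1#)

        -- Each `k` beyond `kn` contributes `2 (2 N - k - k γ)`, and `pronic k - pronic (k - 1)` is
        -- `2 k`, so the sum telescopes. The factor 2 avoids halves and is the one that comes from
        -- the two orders of a pair.
        far-count : ∀ j → fromℕ 2 * (N′ * fromℕ kn) + fromℕ 4 * (N′ * fromℕ j)
                            - (1# + γ) * (pronic (fromℕ j + fromℕ kn) - pronic (fromℕ kn))
                          ≤ fromℕ 2 * fromℕ (length (pairsUpTo block (j ℕ.+ kn)))
        far-count zero = ≤-reflexive (trans
          (solve 3 (λ N k γ → con (+ 2) :* (N :* k) :+ con (+ 4) :* (N :* con (+ 0))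
             :- (con (+ 1) :+ γ) :* ((con (+ 0) :+ k) :* (con (+ 0) :+ k :+ con (+ 1)) :- k :* (k :+ con (+ 1)))
             := con (+ 2) :* (N :* k)) refl N′ (fromℕ kn) γ)
          (*-congˡ (trans (sym (fromℕ-* N kn)) (reflexive (≡.cong fromℕ (near-count kn ℕ.≤-refl))))))
        far-count (suc j) = ≤-from
          (+-mono-≤ (far-count j) (*-monoˡ-≤ (0≤fromℕ 2) (length-block-far {suc (j ℕ.+ kn)} (ℕ.s≤s (ℕ.m≤n+m kn j)))))
          (trans (+-congʳ (*-congˡ (trans (reflexive (≡.cong fromℕ (length-pairsUpTo-suc block (j ℕ.+ kn))))
                                          (fromℕ-+ (length (block (suc (j ℕ.+ kn)))) _))))
          (trans
            (solve 6 (λ N k j γ b l →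
              con (+ 2) :* (b :+ l) :- (con (+ 2) :* (N :* k) :+ con (+ 4) :* (N :* (con (+ 1) :+ j))
                :- (con (+ 1) :+ γ) :* ((con (+ 1) :+ j :+ k) :* (con (+ 1) :+ j :+ k :+ con (+ 1)) :- k :* (k :+ con (+ 1))))
              := con (+ 2) :* l :+ con (+ 2) :* b
                :- (con (+ 2) :* (N :* k) :+ con (+ 4) :* (N :* j)
                    :- (con (+ 1) :+ γ) :* ((j :+ k) :* (j :+ k :+ con (+ 1)) :- k :* (k :+ con (+ 1)))
                  :+ con (+ 2) :* (N :+ N :- (con (+ 1) :+ (j :+ k)) :- (con (+ 1) :+ (j :+ k)) :* γ)))
              refl N′ (fromℕ kn) (fromℕ j) γ (fromℕ (length (block (suc (j ℕ.+ kn))))) (fromℕ (length (pairsUpTo block (j ℕ.+ kn)))))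
            (+-congˡ (-‿cong (+-congˡ (*-congˡ (+-cong (+-congˡ (-‿cong k≈)) (-‿cong (*-congʳ k≈)))))))))
          where
          k≈ : 1# + (fromℕ j + fromℕ kn) ≈ fromℕ (suc (j ℕ.+ kn))
          k≈ = +-congˡ (sym (fromℕ-+ j kn))

        #closePairs-lower : fromℕ 4 * (N′ * fromℕ kx) - fromℕ 2 * (N′ * fromℕ kn)
                              - (1# + γ) * (pronic (fromℕ kx) - pronic (fromℕ kn))
                            ≤ fromℕ (#closePairs logSeq N s α)
        #closePairs-lower = begin
          fromℕ 4 * (N′ * fromℕ kx) - fromℕ 2 * (N′ * fromℕ kn) - (1# + γ) * (pronic (fromℕ kx) - pronic (fromℕ kn))
            ≈⟨ trans (+-cong (+-congʳ (*-congˡ (*-congˡ kx≈))) (-‿cong (*-congˡ (+-congʳ (*-cong kx≈ (+-congʳ kx≈))))))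
                 (solve 4 (λ N j k z → con (+ 4) :* (N :* (j :+ k)) :- con (+ 2) :* (N :* k) :- z
                   := con (+ 2) :* (N :* k) :+ con (+ 4) :* (N :* j) :- z) refl N′ (fromℕ j) (fromℕ kn)
                   ((1# + γ) * (pronic (fromℕ j + fromℕ kn) - pronic (fromℕ kn)))) ⟩
          fromℕ 2 * (N′ * fromℕ kn) + fromℕ 4 * (N′ * fromℕ j) - (1# + γ) * (pronic (fromℕ j + fromℕ kn) - pronic (fromℕ kn))
            ≤⟨ far-count j ⟩
          fromℕ 2 * fromℕ (length (pairsUpTo block (j ℕ.+ kn)))
            ≈⟨ *-congˡ (reflexive (≡.cong (λ K → fromℕ (length (pairsUpTo block K))) (ℕ.m∸n+n≡m kn≤kx))) ⟩
          fromℕ 2 * fromℕ (length L)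
            ≈⟨ solve 1 (λ l → con (+ 2) :* l := l :+ l) refl (fromℕ (length L)) ⟩
          fromℕ (length L) + fromℕ (length L)
            ≈⟨ fromℕ-+ (length L) (length L) ⟨
          fromℕ (length L ℕ.+ length L)
            ≤⟨ fromℕ-mono-≤ (twice-good≤#closePairs (pairsUpTo-unique block-unique kx) good-L) ⟩
          fromℕ (#closePairs logSeq N s α) ∎
          where
          open ≤-Reasoning
          j : ℕ
          j = kx ℕ.∸ kn
          L : List (ℕ × ℕ)
          L = pairsUpTo block kx
          kx≈ : fromℕ kx ≈ fromℕ j + fromℕ kn
          kx≈ = trans (reflexive (≡.cong fromℕ (≡.sym (ℕ.m∸n+n≡m kn≤kx)))) (fromℕ-+ j kn)
          good-L : ∀ {n k} → (n , k) ∈ L → Good n k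
          good-L {n} {k} nk∈ with ∈-pairsUpTo⁻ kx nk∈
          ... | 1≤k , k≤kx , n∈ = good-block 1≤k k≤kx n∈

        rN≈1+γ : r * N′ ≈ 1# + γ
        rN≈1+γ = *-cancelˡ-≈ c′ 0<c (trans
          (solve 3 (λ c r N → c :* (r :* N) := r :* (N :* c)) refl c′ r N′) (trans (rv≈1+c 0<c)
          (sym (trans (distribˡ _ _ _) (trans (+-cong (*-identityʳ c′) (⁻¹-inverseʳ c′ (0<⇒≉0 0<c))) (+-comm _ _))))))

        gMN≤# : g N s α * M * N′ ≤ fromℕ (#closePairs logSeq N s α)
        gMN≤# = begin
          g N s α * M * N′
            ≈⟨ *-congʳ g-scaled ⟩
          (fromℕ 4 * x - fromℕ 2 * y - w - (pronic x - pronic y) * r) * N′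
            ≈⟨ solve 6 (λ x y w k r N → (con (+ 4) :* x :- con (+ 2) :* y :- w :- k :* r) :* N
                 := con (+ 4) :* (N :* x) :- con (+ 2) :* (N :* y) :- (r :* N) :* k :- w :* N) refl
                 x y w (pronic x - pronic y) r N′ ⟩
          fromℕ 4 * (N′ * x) - fromℕ 2 * (N′ * y) - (r * N′) * (pronic x - pronic y) - w * N′
            ≤⟨ ≤-from (*-nonneg 0≤w (<⇒≤ 0<N′)) (solve 2 (λ a b → a :- (a :- b) := b :- con (+ 0)) refl _ (w * N′)) ⟩
          fromℕ 4 * (N′ * x) - fromℕ 2 * (N′ * y) - (r * N′) * (pronic x - pronic y)
            ≈⟨ +-cong (+-cong (*-congˡ (*-congˡ x≈)) (-‿cong (*-congˡ (*-congˡ y≈))))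
                 (-‿cong (*-cong rN≈1+γ (+-cong (*-cong x≈ (+-congʳ x≈)) (-‿cong (*-cong y≈ (+-congʳ y≈)))))) ⟩
          fromℕ 4 * (N′ * fromℕ kx) - fromℕ 2 * (N′ * fromℕ kn) - (1# + γ) * (pronic (fromℕ kx) - pronic (fromℕ kn))
            ≤⟨ #closePairs-lower ⟩
          fromℕ (#closePairs logSeq N s α) ∎
          where
          open ≤-Reasoning
          x y : Carrier
          x = fromℤ (Kmax N s α)
          y = fromℤ (Kmin N s α)
          x≈ : x ≈ fromℕ kx
          x≈ = fromℤ-⌊⌋ 0≤u
          y≈ : y ≈ fromℕ kn
          y≈ = fromℤ-⌊⌋ 0≤v

      gMN≤#-degenerate : c′ ≤ 0# → g N s α * M * N′ ≤ fromℕ (#closePairs logSeq N s α)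
      gMN≤#-degenerate c≤0 = begin
        g N s α * M * N′
          ≈⟨ *-congʳ (trans g-scaled (G-degenerate {r = r} 0≤c (<⇒≤ c<1) 0≤v u-eq
               0≤⌊ 0≤u ⌋ (⌊⌋-lower u) (<⇒≤ (⌊⌋-upper u)) 0≤⌊ 0≤v ⌋ (⌊⌋-lower v) (<⇒≤ (⌊⌋-upper v)) 0≤w w≤2
               (trans (*-congˡ (≤-antisym c≤0 0≤c)) (zeroʳ _)))) ⟩
        - w * N′
          ≤⟨ ≤-from (*-nonneg 0≤w (<⇒≤ 0<N′)) (solve 2 (λ w N → con (+ 0) :- (:- w) :* N := w :* N :- con (+ 0)) refl w N′) ⟩
        0#
          ≤⟨ 0≤fromℕ (#closePairs logSeq N s α) ⟩
        fromℕ (#closePairs logSeq N s α) ∎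
        where open ≤-Reasoning

    g≤F : g N s α ≤ F logSeq N s α
    g≤F = *≤⇒≤/ 0<W (≤-respˡ-≈
      (trans (solve 3 (λ g M N → g :* M :* N := g :* (N :* M)) refl (g N s α) M N′) (*-congˡ (sym W≈NM)))
      (by-cases (c′ ≤? 0#)))
      where
      by-cases : Dec (c′ ≤ 0#) → g N s α * M * N′ ≤ fromℕ (#closePairs logSeq N s α)
      by-cases (yes c≤0) = gMN≤#-degenerate c≤0
      by-cases (no c≰0)  = gMN≤# (≰⇒> c≰0)

mainTheorem5 : {c ℓ : Level} (R : RealNumbers c ℓ) →
    let open RealNumbers R
        open PairCorrelation R in
    (∀ α s (N : ℕ) .{{_ : NonZero N}} → 0# ≤ α → α ≤ 1# → 0# ≤ s →
       s / fromℕ N ** α ≤ 1# / fromℕ 2 →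
       g N s α ≤ F logSeq N s α)
    × (∀ α s → 0# < α → α < 1# → 0# ≤ s →
       (λ N → g N s α) ⟶ fromℕ 2 * s * (fromℕ 3 / fromℕ 4) * log (fromℕ 4))
    × (∀ α → 0# ≤ α → α ≤ 1# → ¬ HasWeakCorrelations logSeq α)
mainTheorem5 {c} {ℓ} R = lower-bound , g-limit , not-weak
  where
  open PairCorrelation R
  open Exponential R
  open Asymptotics R
  open Counting R

  lower-bound : ∀ α s (N : ℕ) .{{_ : NonZero N}} → 0# ≤ α → α ≤ 1# → 0# ≤ s →
                s / fromℕ N ** α ≤ 1# / fromℕ 2 → g N s α ≤ F logSeq N s α
  lower-bound α s (suc N) _ _ 0≤s = g≤F (suc N) (ℕ.s≤s ℕ.z≤n) s α 0≤s

  not-weak : ∀ α → 0# ≤ α → α ≤ 1# → ¬ HasWeakCorrelations logSeq α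
  not-weak α 0≤α α≤1 with α ≤? 0#
  ... | yes α≤0 = no-weak-correlations-0 logSeq α (≤-antisym α≤0 0≤α)
  ... | no  α≰0 = no-weak-correlations (λ α s N → lower-bound α s (suc N)) α (≰⇒> α≰0) α≤1
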